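{- For $r\in\mathbb{Z}$ let $$\Phi^{r}(x,y):=1+\sum_{n\geq1}\sum_{\sigma\in S_{n}}\frac{y^{n}}{n!}\det(I_{n}-xM_{\sigma})^{r}.$$ Then, for every $r\in\mathbb{Z}$, $$\mathrm{Res}_{y=1}\Phi^{r}(x,y)=-\prod_{k\geq1}(1-x^{k})^{ -\binom{k-r-1}{k}}.$$ In particular, when $c=-r>0$, $-\mathrm{Res}_{y=1}\Phi^{ -c}(x,y)$ is the generating function $\sum_{n\ge 0}p_c(n)x^n$, where $p_c(n)$ is the number of colored partitions of $n$ with $c$ colors (with $p_c(0)=1$).
   Context: $S_n$ is the symmetric group on $n$ letters, $M_\sigma$ the $n\times n$ permutation matrix of $\sigma\in S_n$, $I_n$ the $n\times n$ identity matrix. The polynomial $\det(I_n-xM_\sigma)$ has constant term $1$, so its integer powers are formal power series in $x$. Binomial numbers: $\binom{a}{k}=\frac{a(a-1)\cdots(a-k+1)}{k!}$ for integers $a$ and $k\ge0$, $\binom{a}{0}=1$. Residue: $\Phi^r(x,y)$ has a factor $1/(1-y)$, corresponding to a pole of order $1$ at $y=1$. The residue at $y=1$ is taken coefficientwise in $x$: for each $m\ge 0$ the coefficient of $x^m$ in $\Phi^r(x,y)$ is a rational function of $y$ with at most a simple pole at $y=1$, and $\mathrm{Res}_{y=1}\Phi^r(x,y)$ is the formal power series in $x$ whose $x^m$-coefficient is the residue at $y=1$ of that rational function (so if $\Phi^r(x,y)=(1-y)^{ -1}A(x,y)$ with $A$ a power series in $x$ with coefficients polynomial in $y$, the residue is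 $-A(x,1)$). Colored partitions: a colored partition of $n\in\mathbb{N}$ with $c$ colors is obtained by taking a partition $n=n_1+\cdots+n_m$, $n_1\ge\cdots\ge n_m\ge1$, regarding each part $n_j$ as a collection of $n_j$ identical objects, and coloring each object with one of $c$ colors, disregarding the order of the colored objects. That is, it is a finite multiset of nonempty multisets of colors (the parts), with total number of objects $n$. For example, for $c=3$ with colors $b,w,r$ the colored partitions of $2$ are the 12 elements $bb,bw,br,ww,wr,rr,b+b,b+w,b+r,w+w,w+r,r+r$. -}

module Defs where

open import Algebra.Bundles.Raw using (RawRing)
import Algebra.Definitions.RawSemiring as RawSemiringDefs
open import Data.Bool.Base using (if_then_else_)
open import Data.Fin.Base using (Fin; zero; suc; toℕ)
import Data.Fin.Properties as Fin
open import Data.Fin.Permutation using (Permutation′; _⟨$⟩ʳ_; insert; id)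
open import Data.Integer.Base as ℤ using (ℤ; +_; -[1+_])
open import Data.List.Base as List
  using (List; []; _∷_; allFin; cartesianProduct; cartesianProductWith; filter; foldr; length)
open import Data.List.NonEmpty.Base as List⁺ using (List⁺)
open import Data.List.Relation.Binary.Permutation.Propositional using (↭-setoid)
import Data.List.Relation.Binary.Permutation.Setoid as PermutationSetoid
open import Data.Nat.Base as ℕ using (ℕ; zero; suc; _∸_; _≥_; _!)
import Data.Nat.ListAction as ListAction
open import Data.Nat.Properties using (_!≢0)
open import Data.Product.Base using (Σ; ∃; _×_; _,_; proj₁)
open import Data.Rational.Base as ℚ using (ℚ; 0ℚ; 1ℚ)
open import Function.Bundles using (Inverse)
open import Level using (0ℓ)
open import Relation.Binary.Bundles using (Setoid)
import Relation.Binary.Construct.On as On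
open import Relation.Binary.PropositionalEquality.Core using (_≡_; _≢_)
import Relation.Binary.PropositionalEquality.Properties as ≡
open import Relation.Nullary.Decidable using (does; _×-dec_)

------------------------------------------------------------------------
-- The symmetric group and determinants

-- Every permutation of Fin (suc n) is `insert zero j π` for exactly one
-- pair (j , π), namely j the image of zero and π = remove zero σ, so each
-- element of the symmetric group is listed once (up to pointwise equality).
permutations : ∀ n → List (Permutation′ n)
permutations zero    = id ∷ []
permutations (suc n) = cartesianProductWith (insert zero) (allFin (suc n)) (permutations n)

inversions : ∀ {n} → Permutation′ n → ℕ
inversions {n} σ =
  length (filter (λ (i , j) → (i Fin.<? j) ×-dec ((σ ⟨$⟩ʳ j) Fin.<? (σ ⟨$⟩ʳ i)))
                 (cartesianProduct (allFin n) (allFin n)))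

module Determinant {c ℓ} (R : RawRing c ℓ) where
  open RawRing R
  open RawSemiringDefs rawSemiring using (product; _^_)

  Matrix : ℕ → Set c
  Matrix n = Fin n → Fin n → Carrier

  ∑S : ∀ n → (Permutation′ n → Carrier) → Carrier
  ∑S n f = foldr (λ σ s → f σ + s) 0# (permutations n)

  sgn : ∀ {n} → Permutation′ n → Carrier
  sgn σ = (- 1#) ^ inversions σ

  det : ∀ {n} → Matrix n → Carrier
  det {n} A = ∑S n (λ σ → sgn σ * product (λ i → A i (σ ⟨$⟩ʳ i)))

  identity : ∀ n → Matrix n
  identity n i j = if does (i Fin.≟ j) then 1# else 0#

  -- Column j has its 1 in row σ(j), i.e. M_σ e_j = e_{σ(j)}.
  permMatrix : ∀ {n} → Permutation′ n → Matrix n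
  permMatrix σ i j = if does (i Fin.≟ (σ ⟨$⟩ʳ j)) then 1# else 0#

------------------------------------------------------------------------
-- Formal power series over ℚ, as coefficient sequences

FPS : Set
FPS = ℕ → ℚ

fpsRawRing : RawRing 0ℓ 0ℓ
fpsRawRing = record
  { Carrier = FPS
  ; _≈_     = λ f g → ∀ n → f n ≡ g n
  ; _+_     = λ f g n → f n ℚ.+ g n
  ; _*_     = λ f g n → sum {suc n} (λ i → f (toℕ i) ℚ.* g (n ∸ toℕ i))
  ; -_      = λ f n → ℚ.- f n
  ; 0#      = λ _ → 0ℚ
  ; 1#      = λ { zero → 1ℚ ; (suc _) → 0ℚ }
  }
  where open RawSemiringDefs (RawRing.rawSemiring ℚ.+-*-rawRing) using (sum)

open RawRing fpsRawRing public using (_≈_; _+_; _*_; -_; 0#; 1#)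
open RawSemiringDefs (RawRing.rawSemiring fpsRawRing) public using (sum; product; _^_)
open Determinant fpsRawRing public

infixl 6 _-_
_-_ : FPS → FPS → FPS
f - g = f + (- g)

infixr 7 _·_
_·_ : ℚ → FPS → FPS
(a · f) n = a ℚ.* f n

X : FPS
X 1 = 1ℚ
X _ = 0ℚ

-- The inverse of a series with constant term 1, from the geometric series
-- f⁻¹ = Σ_k (1 - f)^k, whose terms with k > n do not contribute to the
-- coefficient of index n.  Meaningful only for constant term 1.
inverse : FPS → FPS
inverse f n = sum {suc n} (λ k → (1# - f) ^ toℕ k) n

-- For negative exponents, meaningful only for constant term 1.
infixr 8 _^ℤ_
_^ℤ_ : FPS → ℤ → FPS
f ^ℤ (+ n)    = f ^ n
f ^ℤ -[1+ n ] = inverse f ^ suc n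

-- P = ∏_{k ≥ 1} F k, as a limit in the X-adic topology: every coefficient
-- of the partial products is eventually constant, with the value in P.
IsInfiniteProduct : (ℕ → FPS) → FPS → Set
IsInfiniteProduct F P =
  ∀ m → ∃ λ N → ∀ K → K ≥ N → product {K} (λ i → F (suc (toℕ i))) m ≡ P m

------------------------------------------------------------------------
-- Residues

-- Polynomials as coefficient lists, constant term first.
Poly : Set
Poly = List ℚ

⟦_⟧ : Poly → FPS
⟦ []    ⟧ n       = 0ℚ
⟦ a ∷ p ⟧ zero    = a
⟦ a ∷ p ⟧ (suc n) = ⟦ p ⟧ n

eval : Poly → ℚ → ℚ
eval p a = foldr (λ b v → b ℚ.+ a ℚ.* v) 0ℚ p

-- The series f in y is the expansion at y = 0 of a rational function with at
-- most a simple pole at y = a, whose residue there is ρ: the function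
-- (y - a) f(y) equals num / den with den(a) ≠ 0, and its value at y = a is ρ.
record HasSimpleResidueAt (a : ℚ) (f : FPS) (ρ : ℚ) : Set where
  field
    num den   : Poly
    den[a]≢0  : eval den a ≢ 0ℚ
    rational  : ⟦ den ⟧ * (⟦ ℚ.- a ∷ 1ℚ ∷ [] ⟧ * f) ≈ ⟦ num ⟧
    residue   : eval num a ≡ ρ ℚ.* eval den a

-- Power series in x and y: Ψ n m is the coefficient of yⁿ xᵐ.
FPS₂ : Set
FPS₂ = ℕ → FPS

-- Coefficientwise in x.
HasResidue₁ : FPS₂ → FPS → Set
HasResidue₁ Ψ ρ = ∀ m → HasSimpleResidueAt 1ℚ (λ n → Ψ n m) (ρ m)

------------------------------------------------------------------------
-- The series Φ^r and binomial numbers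

I-xM : ∀ {n} → Permutation′ n → Matrix n
I-xM {n} σ i j = identity n i j - X * permMatrix σ i j

Φ : ℤ → FPS₂
Φ r zero      = 1#
Φ r n@(suc _) = ((+ 1) ℚ./ (n !)) {{n !≢0}} · ∑S n (λ σ → det (I-xM σ) ^ℤ r)

-- a (a - 1) ⋯ (a - k + 1)
falling : ℤ → ℕ → ℤ
falling a zero    = + 1
falling a (suc k) = falling a k ℤ.* (a ℤ.- + k)

-- The division is exact.
binomial : ℤ → ℕ → ℤ
binomial a k = (falling a k ℤ./ℕ (k !)) {{k !≢0}}

------------------------------------------------------------------------
-- Coloured partitions

-- A part is a nonempty multiset of colours: a nonempty list up to reordering.
partSetoid : ℕ → Setoid 0ℓ 0ℓ
partSetoid c = On.setoid (↭-setoid {A = Fin c}) List⁺.toList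

size : ∀ {c} → List (List⁺ (Fin c)) → ℕ
size π = ListAction.sum (List.map List⁺.length π)

-- A multiset of parts: a list of parts up to reordering, where parts are
-- themselves compared up to reordering.
coloredPartitionSetoid : (c n : ℕ) → Setoid 0ℓ 0ℓ
coloredPartitionSetoid c n =
  On.setoid (PermutationSetoid.↭-setoid (partSetoid c))
            (proj₁ {A = List (List⁺ (Fin c))} {B = λ π → size π ≡ n})

-- p n is the number of coloured partitions of n with c colours, for all n.
CountsColoredPartitions : ℕ → (ℕ → ℕ) → Set
CountsColoredPartitions c p =
  ∀ n → Inverse (≡.setoid (Fin (p n))) (coloredPartitionSetoid c n)

generatingFunction : (ℕ → ℕ) → FPS
generatingFunction p n = (+ p n) ℚ./ 1

-- Write t n for the coefficient of yⁿ in Φʳ and p k = (1 - xᵏ)ʳ.  Deleting the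
-- element 0 from its cycle shows that the sums of det(I - W M_σ)ʳ over σ ∈ Sₙ, where
-- W is a diagonal matrix of powers of x, satisfy a recursion in which the weight of 0
-- either leaves as a factor (1 - w)ʳ (fixed point) or is multiplied into the weight of
-- another element.  These sums are therefore symmetric in the weights, and unrolling
-- the recursion gives n t n = Σ_{k=1..n} p k t (n - k), that is
-- Φʳ = exp (Σ_{k ≥ 1} p k yᵏ / k).  With (1 - x)ʳ = Σ_j β j xʲ the exponent is
-- Σ_{j,k} β j (xʲ y)ᵏ / k, whose term j = 0 is - log (1 - y) and whose other terms give
-- at y = 1 the logarithm of ∏_j (1 - xʲ)^(- β j).  To avoid two-variable logarithms,
-- logarithmic derivatives in x are compared instead: by induction on m, the
-- coefficient of xᵐ in t n for n ≥ m is that of the product, so that multiplying by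
-- y - 1 leaves a polynomial in y.  Finally β j = binomial(j - r - 1, j), which for
-- r = - c counts the multisets of size j of colours.

module Submission where

open import Algebra.Bundles using (CommutativeRing; Semiring)
open import Data.Bool.Base using (Bool; true; false; if_then_else_; _∧_)
open import Data.Fin.Base as Fin using (Fin; zero; suc; toℕ; punchIn; punchOut)
open import Data.Fin.Permutation as Perm using (Permutation′; _⟨$⟩ʳ_; _∘ₚ_; insert; remove; _⟨$⟩ˡ_)
import Data.Fin.Properties as Fin
open import Data.Integer.Base as ℤ using (ℤ; +_; -[1+_])
import Data.Integer.Properties as ℤ
import Data.Integer.Solver
open import Data.List.Base as List
  using (List; []; _∷_; _++_; foldr; tabulate; cartesianProductWith; filter; length; cartesianProduct; allFin)
import Data.List.Membership.Propositional.Properties as ∈ₚ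
import Data.List.Membership.Setoid as Membership
import Data.List.Membership.Setoid.Properties as Membershipₚ
open import Data.List.NonEmpty.Base as List⁺ using (List⁺; _∷_)
import Data.List.Properties as List
import Data.List.Relation.Binary.Permutation.Propositional as ↭
open import Data.List.Relation.Binary.Permutation.Propositional.Properties using (↭-length)
import Data.List.Relation.Binary.Permutation.Setoid as PermutationSetoid
import Data.List.Relation.Binary.Permutation.Setoid.Properties as PermutationSetoid′
open import Data.List.Relation.Binary.Pointwise.Base as Pointwise using ([]; _∷_)
open import Data.List.Relation.Unary.All as All using (All; []; _∷_)
import Data.List.Relation.Unary.All.Properties as All
open import Data.List.Relation.Unary.AllPairs as AllPairs using (AllPairs; []; _∷_)
import Data.List.Relation.Unary.AllPairs.Properties as AllPairs
open import Data.List.Relation.Unary.Any as Any using (Any; here; there)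
import Data.List.Relation.Unary.Any.Properties as Any
import Data.List.Relation.Unary.Unique.Propositional.Properties as Unique
open import Data.Nat.Base as ℕ using (ℕ; zero; suc; _<ᵇ_; _∸_; _≤_; _<_; z≤n; s≤s; _!; NonZero)
import Data.Nat.DivMod as ℕ
open import Data.Nat.Induction using (<-rec)
import Data.Nat.ListAction as ℕ
import Data.Nat.Properties as ℕ
open import Data.Product.Base as Product using (_,_; ∃; proj₁)
open import Data.Rational.Base as ℚ using (ℚ; 0ℚ; 1ℚ)
import Data.Rational.Properties as ℚ
import Data.Rational.Unnormalised.Base as ℚᵘ
import Data.Rational.Unnormalised.Properties as ℚᵘ
open import Data.Sum.Base using (_⊎_; inj₁; inj₂)
open import Data.Vec.Base as Vec using (Vec; []; _∷_; lookup; updateAt; replicate)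
import Data.Vec.Properties as Vec
import Defs
open import Function.Base using (_∘_)
open import Function.Bundles using (Inverse)
open import Level using (0ℓ)
open import Relation.Binary.Bundles using (Setoid)
import Relation.Binary.Construct.On as On
open import Relation.Binary.PropositionalEquality as ≡ using (_≡_; _≢_)
open import Relation.Nullary.Decidable using (does; yes; no; _×-dec_; dec-false)
open import Relation.Nullary.Negation.Core using (contradiction; ¬_)
open import Relation.Unary using (Decidable)

-- The weights are forced: contracting a cycle multiplies two of them, so the sums with all weights
-- equal to x are not closed under deleting an element. Symmetry then makes the terms that merge one
-- weight into each of n equal ones coincide, so that they count n times.
--
-- The cycle decomposition of a permutation is never formed, nor is the determinant written as a
-- product over cycles. It is the Leibniz sum signed by inversions, and deleting 0 is a column
-- elimination whose signs cancel. The contracted permutation appears followed by an extra cycle,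
-- which disappears when the sum over the group is translated.
--
-- Infinite sums and products are replaced by congruences modulo powers of x between finite ones:
-- the two logarithmic derivatives are truncations of one double sum, the sum of j β j x^(j k),
-- taken in the two orders.
--
-- The binomial numbers are defined by integer division. Its exactness is read off from the
-- integrality of the coefficients of (1 - x)ʳ.

-- Finite sums over lists.

module ListSum {c ℓ} (S : Semiring c ℓ) where
  open Semiring S hiding (zero)
  open import Algebra.Properties.Semiring.Sum S
  open import Relation.Binary.Reasoning.Setoid setoid

  ∑L : ∀ {a} {A : Set a} → List A → (A → Carrier) → Carrier
  ∑L xs f = foldr (λ x s → f x + s) 0# xs

  module _ {a} {A : Set a} where

    ∑L-cong : ∀ (xs : List A) {f g : A → Carrier} → (∀ x → f x ≈ g x) → ∑L xs f ≈ ∑L xs g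
    ∑L-cong []       eq = refl
    ∑L-cong (x ∷ xs) eq = +-cong (eq x) (∑L-cong xs eq)

    ∑L-++ : ∀ (xs ys : List A) f → ∑L (xs ++ ys) f ≈ ∑L xs f + ∑L ys f
    ∑L-++ []       ys f = sym (+-identityˡ _)
    ∑L-++ (x ∷ xs) ys f = trans (+-congˡ (∑L-++ xs ys f)) (sym (+-assoc _ _ _))

    *-distribˡ-∑L : ∀ a (xs : List A) f → a * ∑L xs f ≈ ∑L xs (λ x → a * f x)
    *-distribˡ-∑L a []       f = zeroʳ a
    *-distribˡ-∑L a (x ∷ xs) f = trans (distribˡ a _ _) (+-congˡ (*-distribˡ-∑L a xs f))

    ∑L-+ : ∀ (xs : List A) f g → ∑L xs (λ x → f x + g x) ≈ ∑L xs f + ∑L xs g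
    ∑L-+ []       f g = sym (+-identityˡ 0#)
    ∑L-+ (x ∷ xs) f g = begin
      f x + g x + ∑L xs (λ y → f y + g y) ≈⟨ +-congˡ (∑L-+ xs f g) ⟩
      f x + g x + (∑L xs f + ∑L xs g)     ≈⟨ interchange (f x) (g x) _ _ ⟩
      f x + ∑L xs f + (g x + ∑L xs g)     ∎
      where open import Algebra.Properties.CommutativeSemigroup +-commutativeSemigroup

    ∑L-∑ : ∀ (xs : List A) {n} (f : A → Fin n → Carrier) →
           ∑L xs (λ x → ∑[ j < n ] f x j) ≈ ∑[ j < n ] ∑L xs (λ x → f x j)
    ∑L-∑ []       {n} f = sym (sum-replicate-zero n)
    ∑L-∑ (x ∷ xs) {n} f = trans (+-congˡ (∑L-∑ xs f)) (sym (∑-distrib-+ (f x) _))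

  ∑L-map : ∀ {a b} {A : Set a} {B : Set b} (g : A → B) xs f → ∑L (List.map g xs) f ≡ ∑L xs (f ∘ g)
  ∑L-map g []       f = ≡.refl
  ∑L-map g (x ∷ xs) f = ≡.cong (λ s → f (g x) + s) (∑L-map g xs f)

  ∑L-cartesian : ∀ {a b d} {A : Set a} {B : Set b} {D : Set d} (g : A → B → D) {n} (h : Fin n → A) ys f →
                 ∑L (cartesianProductWith g (tabulate h) ys) f ≈ ∑[ i < n ] ∑L ys (λ y → f (g (h i) y))
  ∑L-cartesian g {zero}  h ys f = refl
  ∑L-cartesian g {suc n} h ys f =
    trans (∑L-++ (List.map (g (h zero)) ys) _ f)
          (+-cong (reflexive (∑L-map (g (h zero)) ys f)) (∑L-cartesian g (h ∘ suc) ys f))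

-- Sums over the symmetric group.

module SymmetricGroup {c ℓ} (R : CommutativeRing c ℓ) where
  open CommutativeRing R hiding (zero)
  open Defs.Determinant rawRing
  open import Algebra.Properties.Semiring.Sum semiring
  open import Relation.Binary.Reasoning.Setoid setoid
  open ListSum semiring

  ∑S-suc : ∀ n f → ∑S (suc n) f ≈ ∑[ j < suc n ] ∑S n (λ π → f (insert zero j π))
  ∑S-suc n f = ∑L-cartesian (insert zero) (λ j → j) (permutations n) f
    where open Defs using (permutations)

  -- A permutation is a record that carries proofs, so a function of it has to be required to
  -- respect pointwise equality of the underlying maps.
  Extensional : ∀ {n} → (Permutation′ n → Carrier) → Set ℓ
  Extensional f = ∀ σ τ → σ Perm.≈ τ → f σ ≈ f τ

  insert-cong : ∀ {n} j (π ρ : Permutation′ n) → π Perm.≈ ρ → insert zero j π Perm.≈ insert zero j ρ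
  insert-cong j π ρ eq zero    = ≡.refl
  insert-cong j π ρ eq (suc i) = ≡.cong (punchIn j) (eq i)

  insert-∘ : ∀ {n} j (π : Permutation′ n) (τ : Permutation′ (suc n)) →
             (insert zero j π ∘ₚ τ) Perm.≈ insert zero (τ ⟨$⟩ʳ j) (π ∘ₚ remove j τ)
  insert-∘ j π τ zero    = ≡.refl
  insert-∘ j π τ (suc i) = Perm.punchIn-permute τ j (π ⟨$⟩ʳ i)

  ∑S-cong : ∀ n {f g : Permutation′ n → Carrier} → (∀ π → f π ≈ g π) → ∑S n f ≈ ∑S n g
  ∑S-cong n = ∑L-cong (Defs.permutations n)

  -- Translation by `τ` carries the block of permutations with image `j` of zero to the block with
  -- image `τ j`, and acts inside it as translation by `remove j τ`; hence induction on `n`.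
  ∑S-translate : ∀ n (τ : Permutation′ n) {f} → Extensional f → ∑S n (λ π → f (π ∘ₚ τ)) ≈ ∑S n f
  ∑S-translate zero    τ ext = ∑S-cong zero (λ π → ext (π ∘ₚ τ) π (λ ()))
  ∑S-translate (suc n) τ {f} ext = begin
    ∑S (suc n) (λ π → f (π ∘ₚ τ))
      ≈⟨ ∑S-suc n _ ⟩
    ∑[ j < suc n ] ∑S n (λ π → f (insert zero j π ∘ₚ τ))
      ≈⟨ sum-cong-≋ (λ j → ∑S-cong n (λ π → ext (insert zero j π ∘ₚ τ) (insert zero (τ ⟨$⟩ʳ j) (π ∘ₚ remove j τ)) (insert-∘ j π τ))) ⟩
    ∑[ j < suc n ] ∑S n (λ π → f (insert zero (τ ⟨$⟩ʳ j) (π ∘ₚ remove j τ)))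
      ≈⟨ sum-cong-≋ (λ j → ∑S-translate n (remove j τ) (λ π ρ eq → ext (insert zero (τ ⟨$⟩ʳ j) π) (insert zero (τ ⟨$⟩ʳ j) ρ) (insert-cong (τ ⟨$⟩ʳ j) π ρ eq))) ⟩
    ∑[ j < suc n ] ∑S n (λ π → f (insert zero (τ ⟨$⟩ʳ j) π))
      ≈⟨ ∑-permute (λ j → ∑S n (λ π → f (insert zero j π))) τ ⟨
    ∑[ j < suc n ] ∑S n (λ π → f (insert zero j π))
      ≈⟨ ∑S-suc n f ⟨
    ∑S (suc n) f ∎

-- Inversions of a permutation after inserting a point.

module Inversions where
  open import Algebra.Properties.Semiring.Sum ℕ.+-*-semiring
  open ListSum ℕ.+-*-semiring
  open Defs using (inversions)
  open ≡.≡-Reasoning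

  ⟦_⟧ᵇ : Bool → ℕ
  ⟦ b ⟧ᵇ = if b then 1 else 0

  length-filter : ∀ {a p} {A : Set a} {P : A → Set p} (P? : Decidable P) xs →
                  length (filter P? xs) ≡ ∑L xs (λ x → ⟦ does (P? x) ⟧ᵇ)
  length-filter P? []       = ≡.refl
  length-filter P? (x ∷ xs) with does (P? x)
  ... | true  = ≡.cong suc (length-filter P? xs)
  ... | false = length-filter P? xs

  ∑L-allFin : ∀ {n} m (h : Fin m → Fin n) f → ∑L (tabulate h) f ≡ ∑[ j < m ] f (h j)
  ∑L-allFin zero    h f = ≡.refl
  ∑L-allFin (suc m) h f = ≡.cong (_ ℕ.+_) (∑L-allFin m (h ∘ suc) f)

  -- The boolean comparison computes on `zero` and `suc`, so that the terms of the double sum in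
  -- which the second index is zero reduce away in `inversions-insert`.
  isInversion : ∀ {n} → (Fin n → Fin n) → Fin n → Fin n → ℕ
  isInversion σ i j = ⟦ (toℕ i <ᵇ toℕ j) ∧ (toℕ (σ j) <ᵇ toℕ (σ i)) ⟧ᵇ

  inversions-∑ : ∀ {n} (σ : Permutation′ n) → inversions σ ≡ ∑[ i < n ] ∑[ j < n ] isInversion (σ ⟨$⟩ʳ_) i j
  inversions-∑ {n} σ = begin
    inversions σ
      ≡⟨ length-filter (λ (i , j) → (i Fin.<? j) ×-dec ((σ ⟨$⟩ʳ j) Fin.<? (σ ⟨$⟩ʳ i))) (cartesianProduct (allFin n) (allFin n)) ⟩
    ∑L (cartesianProduct (allFin n) (allFin n)) f
      ≡⟨ ∑L-cartesian _,_ (λ i → i) (allFin n) f ⟩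
    ∑[ i < n ] ∑L (allFin n) (λ j → f (i , j))
      ≡⟨ sum-cong-≗ {n} (λ i → ∑L-allFin n (λ j → j) (λ j → f (i , j))) ⟩
    ∑[ i < n ] ∑[ j < n ] isInversion (σ ⟨$⟩ʳ_) i j ∎
    where
    f : Fin n Product.× Fin n → ℕ
    f (i , j) = isInversion (σ ⟨$⟩ʳ_) i j

  inversions-cong : ∀ {n} (σ τ : Permutation′ n) → σ Perm.≈ τ → inversions σ ≡ inversions τ
  inversions-cong {n} σ τ eq = begin
    inversions σ                                        ≡⟨ inversions-∑ σ ⟩
    ∑[ i < n ] ∑[ j < n ] isInversion (σ ⟨$⟩ʳ_) i j
      ≡⟨ sum-cong-≗ {n} (λ i → sum-cong-≗ {n} (λ j → ≡.cong₂ (λ a b → ⟦ (toℕ i <ᵇ toℕ j) ∧ (toℕ a <ᵇ toℕ b) ⟧ᵇ) (eq j) (eq i))) ⟩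
    ∑[ i < n ] ∑[ j < n ] isInversion (τ ⟨$⟩ʳ_) i j     ≡⟨ inversions-∑ τ ⟨
    inversions τ                                        ∎

  punchIn-<ᵇ : ∀ {n} (j : Fin (suc n)) a b → (toℕ (punchIn j a) <ᵇ toℕ (punchIn j b)) ≡ (toℕ a <ᵇ toℕ b)
  punchIn-<ᵇ zero    a       b       = ≡.refl
  punchIn-<ᵇ (suc j) zero    zero    = ≡.refl
  punchIn-<ᵇ (suc j) zero    (suc b) = ≡.refl
  punchIn-<ᵇ (suc j) (suc a) zero    = ≡.refl
  punchIn-<ᵇ (suc j) (suc a) (suc b) = punchIn-<ᵇ j a b

  count-punchIn-< : ∀ {n} (j : Fin (suc n)) → ∑[ b < n ] ⟦ toℕ (punchIn j b) <ᵇ toℕ j ⟧ᵇ ≡ toℕ j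
  count-punchIn-< {n} zero            = sum-replicate-zero n
  count-punchIn-< {suc n} (suc j) = ≡.cong suc (count-punchIn-< j)

  -- The new inversions pair zero with the positions whose value lies below `j`, and `punchIn j`
  -- takes exactly `toℕ j` values there. As `punchIn j` is monotone, the other inversions are those
  -- of `π`.
  inversions-insert : ∀ {n} j (π : Permutation′ n) → inversions (insert zero j π) ≡ toℕ j ℕ.+ inversions π
  inversions-insert {n} j π = begin
    inversions (insert zero j π)
      ≡⟨ inversions-∑ (insert zero j π) ⟩
    ∑[ b < n ] ⟦ toℕ (punchIn j (π ⟨$⟩ʳ b)) <ᵇ toℕ j ⟧ᵇ ℕ.+
      ∑[ a < n ] ∑[ b < n ] ⟦ (toℕ a <ᵇ toℕ b) ∧ (toℕ (punchIn j (π ⟨$⟩ʳ b)) <ᵇ toℕ (punchIn j (π ⟨$⟩ʳ a))) ⟧ᵇ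
      ≡⟨ ≡.cong₂ ℕ._+_ (≡.sym (∑-permute (λ b → ⟦ toℕ (punchIn j b) <ᵇ toℕ j ⟧ᵇ) π))
           (sum-cong-≗ {n} (λ a → sum-cong-≗ {n} (λ b → ≡.cong (λ p → ⟦ (toℕ a <ᵇ toℕ b) ∧ p ⟧ᵇ) (punchIn-<ᵇ j _ _)))) ⟩
    ∑[ b < n ] ⟦ toℕ (punchIn j b) <ᵇ toℕ j ⟧ᵇ ℕ.+ ∑[ a < n ] ∑[ b < n ] isInversion (π ⟨$⟩ʳ_) a b
      ≡⟨ ≡.cong₂ ℕ._+_ (count-punchIn-< j) (≡.sym (inversions-∑ π)) ⟩
    toℕ j ℕ.+ inversions π ∎

-- Deleting two points in either order.

module PunchInExchange where

  -- The position of `k` in the complement of `punchIn k i`. A direct recursion spares the proof of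
  -- distinctness that `punchOut` demands.
  q : ∀ {n} → Fin (suc (suc n)) → Fin (suc n) → Fin (suc n)
  q         zero    i       = zero
  q         (suc k) zero    = k
  q {suc n} (suc k) (suc i) = suc (q k i)

  punchIn-q : ∀ {n} (k : Fin (suc (suc n))) i → punchIn (punchIn k i) (q k i) ≡ k
  punchIn-q         zero    i       = ≡.refl
  punchIn-q         (suc k) zero    = ≡.refl
  punchIn-q {suc n} (suc k) (suc i) = ≡.cong suc (punchIn-q k i)

  -- Either side enumerates in increasing order the points other than `k` and `punchIn k i`.
  punchIn-exchange : ∀ {n} (k : Fin (suc (suc n))) i z →
                     punchIn k (punchIn i z) ≡ punchIn (punchIn k i) (punchIn (q k i) z)
  punchIn-exchange         zero    i       z       = ≡.refl
  punchIn-exchange         (suc k) zero    z       = ≡.refl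
  punchIn-exchange {suc n} (suc k) (suc i) zero    = ≡.refl
  punchIn-exchange {suc n} (suc k) (suc i) (suc z) = ≡.cong suc (punchIn-exchange k i z)

-- Signs, Laplace expansion and column operations.

module DeterminantProperties {c ℓ} (R : CommutativeRing c ℓ) where
  open CommutativeRing R hiding (zero)
  open Defs.Determinant rawRing
  open import Algebra.Definitions.RawSemiring (Semiring.rawSemiring semiring) using (product; _^_)
  open import Algebra.Properties.Semiring.Sum semiring
  import Algebra.Properties.CommutativeMonoid.Sum *-commutativeMonoid as ∏
  open import Algebra.Properties.Semiring.Exp semiring using (^-homo-*)
  open import Algebra.Properties.Ring ring
  open import Algebra.Properties.CommutativeSemigroup *-commutativeSemigroup using (x∙yz≈y∙xz; interchange)
  open import Relation.Binary.Reasoning.Setoid setoid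
  open ListSum semiring
  open SymmetricGroup R
  open Inversions using (inversions-insert; inversions-cong)
  open PunchInExchange

  sign : ℕ → Carrier
  sign m = (- 1#) ^ m

  sgn-cong : ∀ {n} (σ τ : Permutation′ n) → σ Perm.≈ τ → sgn σ ≈ sgn τ
  sgn-cong σ τ eq = reflexive (≡.cong sign (inversions-cong σ τ eq))

  sgn-insert : ∀ {n} j (π : Permutation′ n) → sgn (insert zero j π) ≈ sign (toℕ j) * sgn π
  sgn-insert j π = trans (reflexive (≡.cong sign (inversions-insert j π))) (^-homo-* (- 1#) (toℕ j) (Defs.inversions π))

  sign-2+ : ∀ m → sign (suc (suc m)) ≈ sign m
  sign-2+ m = begin
    - 1# * (- 1# * sign m) ≈⟨ -1*x≈-x _ ⟩
    - (- 1# * sign m)      ≈⟨ -‿cong (-1*x≈-x _) ⟩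
    - - sign m             ≈⟨ -‿involutive _ ⟩
    sign m                 ∎

  sign² : ∀ m → sign m * sign m ≈ 1#
  sign² zero    = *-identityˡ 1#
  sign² (suc m) = begin
    (- 1# * sign m) * (- 1# * sign m) ≈⟨ *-cong (-1*x≈-x _) (-1*x≈-x _) ⟩
    - sign m * - sign m               ≈⟨ -x*-y≈x*y _ _ ⟩
    sign m * sign m                   ≈⟨ sign² m ⟩
    1#                                ∎
    where
    -x*-y≈x*y : ∀ x y → - x * - y ≈ x * y
    -x*-y≈x*y x y = trans (sym (-‿distribˡ-* x (- y))) (trans (-‿cong (sym (-‿distribʳ-* x y))) (-‿involutive _))

  -- If `i` lies below `k`, the left exponent is k + i - 1; otherwise it is k + i + 1. The parity is
  -- the same.
  sign-exchange : ∀ {n} (k : Fin (suc (suc n))) i →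
                  sign (toℕ (punchIn k i) ℕ.+ toℕ (q k i)) ≈ sign (toℕ k ℕ.+ suc (toℕ i))
  sign-exchange zero    i       = reflexive (≡.cong sign (ℕ.+-identityʳ (suc (toℕ i))))
  sign-exchange (suc k) zero    = sym (trans (reflexive (≡.cong (sign ∘ suc) (ℕ.+-comm (toℕ k) 1))) (sign-2+ (toℕ k)))
  sign-exchange {suc n} (suc k) (suc i) = begin
    sign (suc (toℕ (punchIn k i) ℕ.+ suc (toℕ (q k i))))   ≡⟨ ≡.cong (sign ∘ suc) (ℕ.+-suc (toℕ (punchIn k i)) (toℕ (q k i))) ⟩
    sign (suc (suc (toℕ (punchIn k i) ℕ.+ toℕ (q k i))))   ≈⟨ sign-2+ (toℕ (punchIn k i) ℕ.+ toℕ (q k i)) ⟩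
    sign (toℕ (punchIn k i) ℕ.+ toℕ (q k i))               ≈⟨ sign-exchange k i ⟩
    sign (toℕ k ℕ.+ suc (toℕ i))                           ≈⟨ sign-2+ (toℕ k ℕ.+ suc (toℕ i)) ⟨
    sign (suc (suc (toℕ k ℕ.+ suc (toℕ i))))               ≡⟨ ≡.cong (sign ∘ suc) (ℕ.+-suc (toℕ k) (suc (toℕ i))) ⟨
    sign (suc (toℕ k ℕ.+ suc (suc (toℕ i))))               ∎

  -- The cycle 0 ↦ k ↦ k - 1 ↦ ⋯ ↦ 1 ↦ 0.
  ρ : ∀ {n} → Fin (suc n) → Permutation′ (suc n)
  ρ k = insert zero k Perm.id

  insert-zero-ρ : ∀ {n} k (π : Permutation′ n) → (insert zero zero π ∘ₚ ρ k) Perm.≈ insert zero k π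
  insert-zero-ρ k π zero    = ≡.refl
  insert-zero-ρ k π (suc i) = ≡.refl

  insert-suc-ρ : ∀ {n} k i (π : Permutation′ (suc n)) →
                 (insert zero (suc i) π ∘ₚ ρ k) Perm.≈ insert zero (punchIn k i) (π ∘ₚ ρ (q k i))
  insert-suc-ρ k i π zero    = ≡.refl
  insert-suc-ρ k i π (suc x) with π ⟨$⟩ʳ x
  ... | zero  = ≡.sym (punchIn-q k i)
  ... | suc z = punchIn-exchange k i z

  -- An insertion followed by a cycle is again an insertion, whose inner permutation is followed by
  -- a cycle on one point fewer. This gives an induction on the size, mutual with `sgn-ρ`; the
  -- leading signs are compared by `sign-exchange`.
  sgn-ρ-insert : ∀ {n} k j (π : Permutation′ n) → sgn (insert zero j π ∘ₚ ρ k) ≈ sign (toℕ k) * sgn (insert zero j π)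

  sgn-ρ : ∀ {n} k (τ : Permutation′ (suc n)) → sgn (τ ∘ₚ ρ k) ≈ sign (toℕ k) * sgn τ
  sgn-ρ k τ = begin
    sgn (τ ∘ₚ ρ k)   ≈⟨ sgn-cong (τ ∘ₚ ρ k) (τ′ ∘ₚ ρ k) (λ i → ≡.cong (ρ k ⟨$⟩ʳ_) (≡.sym (Perm.insert-remove zero τ i))) ⟩
    sgn (τ′ ∘ₚ ρ k)  ≈⟨ sgn-ρ-insert k (τ ⟨$⟩ʳ zero) (remove zero τ) ⟩
    _ * sgn τ′       ≈⟨ *-congˡ (sgn-cong τ′ τ (Perm.insert-remove zero τ)) ⟩
    _ * sgn τ        ∎
    where τ′ = insert zero (τ ⟨$⟩ʳ zero) (remove zero τ)

  sgn-ρ-insert k zero π = begin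
    sgn (insert zero zero π ∘ₚ ρ k)         ≈⟨ sgn-cong (insert zero zero π ∘ₚ ρ k) (insert zero k π) (insert-zero-ρ k π) ⟩
    sgn (insert zero k π)                   ≈⟨ sgn-insert k π ⟩
    sign (toℕ k) * sgn π                    ≈⟨ *-congˡ (trans (sgn-insert zero π) (*-identityˡ _)) ⟨
    sign (toℕ k) * sgn (insert zero zero π) ∎
  sgn-ρ-insert {suc n} k (suc i) π = begin
    sgn (insert zero (suc i) π ∘ₚ ρ k)
      ≈⟨ sgn-cong (insert zero (suc i) π ∘ₚ ρ k) (insert zero (punchIn k i) (π ∘ₚ ρ (q k i))) (insert-suc-ρ k i π) ⟩
    sgn (insert zero (punchIn k i) (π ∘ₚ ρ (q k i)))
      ≈⟨ sgn-insert (punchIn k i) (π ∘ₚ ρ (q k i)) ⟩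
    sign (toℕ (punchIn k i)) * sgn (π ∘ₚ ρ (q k i))
      ≈⟨ *-congˡ (sgn-ρ (q k i) π) ⟩
    sign (toℕ (punchIn k i)) * (sign (toℕ (q k i)) * sgn π)
      ≈⟨ *-assoc _ _ _ ⟨
    sign (toℕ (punchIn k i)) * sign (toℕ (q k i)) * sgn π
      ≈⟨ *-congʳ (trans (sym (^-homo-* (- 1#) (toℕ (punchIn k i)) (toℕ (q k i)))) (trans (sign-exchange k i) (^-homo-* (- 1#) (toℕ k) (suc (toℕ i))))) ⟩
    sign (toℕ k) * sign (toℕ (suc i)) * sgn π
      ≈⟨ *-assoc _ _ _ ⟩
    sign (toℕ k) * (sign (toℕ (suc i)) * sgn π)
      ≈⟨ *-congˡ (sgn-insert (suc i) π) ⟨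
    sign (toℕ k) * sgn (insert zero (suc i) π) ∎

  minor : ∀ {n} → Fin (suc n) → Matrix (suc n) → Matrix n
  minor j A i k = A (suc i) (punchIn j k)

  detTerm : ∀ {n} → Matrix n → Permutation′ n → Carrier
  detTerm A σ = sgn σ * product (λ i → A i (σ ⟨$⟩ʳ i))

  detTerm-ext : ∀ {n} (A : Matrix n) → Extensional (detTerm A)
  detTerm-ext A σ τ eq = *-cong (sgn-cong σ τ eq) (∏.sum-cong-≋ (λ i → reflexive (≡.cong (A i) (eq i))))

  det-cong : ∀ {n} {A B : Matrix n} → (∀ i j → A i j ≈ B i j) → det A ≈ det B
  det-cong {n} eq = ∑S-cong n (λ σ → *-congˡ (∏.sum-cong-≋ (λ i → eq i (σ ⟨$⟩ʳ i))))

  -- The Leibniz sum is grouped by the image `j` of zero, where inserting `j` contributes the sign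
  -- of `j` by `sgn-insert`.
  laplace : ∀ {n} (A : Matrix (suc n)) →
            det A ≈ ∑[ j < suc n ] (sign (toℕ j) * A zero j * det (minor j A))
  laplace {n} A = begin
    det A ≈⟨ ∑S-suc n (detTerm A) ⟩
    ∑[ j < suc n ] ∑S n (λ π → sgn (insert zero j π) * (A zero j * P j π))
      ≈⟨ sum-cong-≋ (λ j → ∑S-cong n (λ π → step j π)) ⟩
    ∑[ j < suc n ] ∑S n (λ π → sign (toℕ j) * A zero j * (sgn π * P j π))
      ≈⟨ sum-cong-≋ (λ j → *-distribˡ-∑L (sign (toℕ j) * A zero j) (Defs.permutations n) (λ π → sgn π * P j π)) ⟨
    ∑[ j < suc n ] (sign (toℕ j) * A zero j * det (minor j A)) ∎
    where
    P : Fin (suc n) → Permutation′ n → Carrier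
    P j π = product (λ i → A (suc i) (punchIn j (π ⟨$⟩ʳ i)))

    step : ∀ j π → sgn (insert zero j π) * (A zero j * P j π) ≈ sign (toℕ j) * A zero j * (sgn π * P j π)
    step j π = trans (*-congʳ (sgn-insert j π)) (interchange _ _ _ _)

  -- The Leibniz sum is reindexed by `τ ∘ₚ ρ k`; the sign of `τ` is recovered from that of the
  -- composite because signs square to 1.
  det-ρ : ∀ {n} k (A : Matrix (suc n)) → det (λ i j → A i (ρ k ⟨$⟩ʳ j)) ≈ sign (toℕ k) * det A
  det-ρ {n} k A = begin
    det (λ i j → A i (ρ k ⟨$⟩ʳ j))
      ≈⟨ ∑S-cong (suc n) step ⟩
    ∑S (suc n) (λ τ → sign (toℕ k) * detTerm A (τ ∘ₚ ρ k))
      ≈⟨ *-distribˡ-∑L (sign (toℕ k)) (Defs.permutations (suc n)) (λ τ → detTerm A (τ ∘ₚ ρ k)) ⟨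
    sign (toℕ k) * ∑S (suc n) (λ τ → detTerm A (τ ∘ₚ ρ k))
      ≈⟨ *-congˡ (∑S-translate (suc n) (ρ k) {detTerm A} (detTerm-ext A)) ⟩
    sign (toℕ k) * det A ∎
    where
    step : ∀ τ → sgn τ * product (λ i → A i (ρ k ⟨$⟩ʳ (τ ⟨$⟩ʳ i))) ≈ sign (toℕ k) * detTerm A (τ ∘ₚ ρ k)
    step τ = trans (*-congʳ sgn-τ) (*-assoc _ _ _)
      where
      sgn-τ : sgn τ ≈ sign (toℕ k) * sgn (τ ∘ₚ ρ k)
      sgn-τ = begin
        sgn τ                                   ≈⟨ *-identityˡ _ ⟨
        1# * sgn τ                              ≈⟨ *-congʳ (sign² (toℕ k)) ⟨
        sign (toℕ k) * sign (toℕ k) * sgn τ     ≈⟨ *-assoc _ _ _ ⟩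
        sign (toℕ k) * (sign (toℕ k) * sgn τ)   ≈⟨ *-congˡ (sgn-ρ k τ) ⟨
        sign (toℕ k) * sgn (τ ∘ₚ ρ k)           ∎

  -- Each Leibniz product has exactly one factor in column `k`, the one in row σ⁻¹ k, and the
  -- remaining factors agree in all three matrices.
  det-linear : ∀ {n} k w {A B C : Matrix n} →
               (∀ i j → j ≢ k → A i j ≈ B i j) → (∀ i j → j ≢ k → A i j ≈ C i j) →
               (∀ i → A i k ≈ B i k + w * C i k) → det A ≈ det B + w * det C
  det-linear {suc n} k w {A} {B} {C} A≈B A≈C eq = begin
    det A                                                       ≈⟨ ∑S-cong (suc n) step ⟩
    ∑S (suc n) (λ σ → detTerm B σ + w * detTerm C σ)            ≈⟨ ∑L-+ (Defs.permutations (suc n)) (detTerm B) (λ σ → w * detTerm C σ) ⟩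
    det B + ∑S (suc n) (λ σ → w * detTerm C σ)                  ≈⟨ +-congˡ (*-distribˡ-∑L w (Defs.permutations (suc n)) (detTerm C)) ⟨
    det B + w * det C ∎
    where
    step : ∀ σ → detTerm A σ ≈ detTerm B σ + w * detTerm C σ
    step σ = begin
      sgn σ * product (entry A)                       ≈⟨ *-congˡ (split A) ⟩
      sgn σ * (A x k * rest A)                        ≈⟨ *-congˡ (*-congʳ (eq x)) ⟩
      sgn σ * ((B x k + w * C x k) * rest A)          ≈⟨ *-congˡ (distribʳ _ _ _) ⟩
      sgn σ * (B x k * rest A + w * C x k * rest A)   ≈⟨ distribˡ _ _ _ ⟩
      sgn σ * (B x k * rest A) + sgn σ * (w * C x k * rest A)
        ≈⟨ +-cong (*-congˡ (*-congˡ (rest-cong A≈B))) (*-congˡ (trans (*-assoc _ _ _) (*-congˡ (*-congˡ (rest-cong A≈C))))) ⟩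
      sgn σ * (B x k * rest B) + sgn σ * (w * (C x k * rest C))
        ≈⟨ +-cong (*-congˡ (sym (split B))) (trans (x∙yz≈y∙xz _ _ _) (*-congˡ (*-congˡ (sym (split C))))) ⟩
      detTerm B σ + w * detTerm C σ ∎
      where
      x = σ ⟨$⟩ˡ k
      entry : Matrix (suc n) → Fin (suc n) → Carrier
      entry M i = M i (σ ⟨$⟩ʳ i)
      rest : Matrix (suc n) → Carrier
      rest M = product (λ i → entry M (punchIn x i))
      split : ∀ M → product (entry M) ≈ M x k * rest M
      split M = trans (∏.sum-remove {i = x} (entry M)) (*-congʳ (reflexive (≡.cong (M x) (Perm.inverseʳ σ))))
      rest-cong : ∀ {M N : Matrix (suc n)} → (∀ i j → j ≢ k → M i j ≈ N i j) → rest M ≈ rest N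
      rest-cong eq = ∏.sum-cong-≋ (λ i → eq _ _ (λ σi≡k →
        Fin.punchInᵢ≢i x i (≡.trans (≡.sym (Perm.inverseˡ σ)) (≡.cong (σ ⟨$⟩ˡ_) σi≡k))))

-- The determinant of 1 - W M_σ when the point 0 is deleted.

module WeightedPermutationMatrix {c ℓ} (R : CommutativeRing c ℓ) where
  open CommutativeRing R hiding (zero)
  open Defs.Determinant rawRing
  open import Algebra.Properties.Semiring.Sum semiring
  open import Algebra.Properties.Ring ring
  open import Algebra.Properties.CommutativeSemigroup *-commutativeSemigroup using (interchange)
  open import Relation.Binary.Reasoning.Setoid setoid
  open DeterminantProperties R

  δ : ∀ {n} → Fin n → Fin n → Carrier
  δ i j = if does (i Fin.≟ j) then 1# else 0#

  δ-≢ : ∀ {n} {i j : Fin n} → i ≢ j → δ i j ≡ 0#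
  δ-≢ {i = i} {j} i≢j = ≡.cong (if_then 1# else 0#) (dec-false (i Fin.≟ j) i≢j)

  1-_M_ : ∀ {n} → (Fin n → Carrier) → Permutation′ n → Matrix n
  (1- w M σ) i k = identity _ i k - w i * permMatrix σ i k

  x-w0≈x : ∀ x w → x - w * 0# ≈ x
  x-w0≈x x w = trans (+-congˡ (trans (-‿cong (zeroʳ w)) -0#≈0#)) (+-identityʳ x)

  sum-zero : ∀ {n} {f : Fin n → Carrier} → (∀ i → f i ≈ 0#) → sum f ≈ 0#
  sum-zero {n} eq = trans (sum-cong-≋ eq) (sum-replicate-zero n)

  sum-single : ∀ {n} k {f : Fin n → Carrier} → (∀ i → i ≢ k → f i ≈ 0#) → sum f ≈ f k
  sum-single {suc n} k {f} eq =
    trans (sum-remove {i = k} f) (trans (+-congˡ (sum-zero (λ i → eq _ (Fin.punchInᵢ≢i k i)))) (+-identityʳ _))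

  laplace-zero : ∀ {x a y} → a ≈ 0# → x * a * y ≈ 0#
  laplace-zero {x} {a} {y} a≈0 = trans (*-congʳ (trans (*-congˡ a≈0) (zeroʳ x))) (zeroˡ y)

  -- When 0 is fixed, the diagonal entry is the only one in row 0 that can be nonzero, so the
  -- Laplace expansion has one term.
  det-fixedPoint : ∀ {n} (w : Fin (suc n) → Carrier) (π : Permutation′ n) →
                   det (1- w M insert zero zero π) ≈ (1# - w zero) * det (1- (w ∘ suc) M π)
  det-fixedPoint {n} w π = begin
    det A                                     ≈⟨ laplace A ⟩
    _                                         ≈⟨ sum-single zero row ⟩
    1# * A zero zero * det (minor zero A)     ≈⟨ *-congʳ (trans (*-identityˡ _) (+-congˡ (-‿cong (*-identityʳ _)))) ⟩
    (1# - w zero) * det (1- (w ∘ suc) M π)    ∎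
    where
    A = 1- w M insert zero zero π
    row : ∀ j → j ≢ zero → sign (toℕ j) * A zero j * det (minor j A) ≈ 0#
    row zero    ne = contradiction ≡.refl ne
    row (suc j) ne = laplace-zero (x-w0≈x 0# (w zero))

  -- Adding w times column 0 to column k + 1 of A clears row 0 except for its first entry.
  det-eliminate : ∀ {n} w (k : Fin (suc n)) (A : Matrix (suc (suc n))) (B : Matrix (suc n)) →
                  A zero zero ≈ 1# → A zero (suc k) ≈ - w → (∀ j → j ≢ k → A zero (suc j) ≈ 0#) →
                  (∀ i j → j ≢ k → B i j ≈ A (suc i) (suc j)) →
                  (∀ i → B i k ≈ A (suc i) (suc k) + w * A (suc i) zero) →
                  det A ≈ det B
  det-eliminate {n} w k A B A₀₀ A₀ₖ A₀ⱼ B≈A Bₖ = begin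
    det A                                                            ≈⟨ laplace A ⟩
    1# * A zero zero * det (minor zero A) + sum rest                 ≈⟨ +-cong (*-congʳ (trans (*-identityˡ _) A₀₀)) (sum-single k row) ⟩
    1# * det (minor zero A) + sign (suc (toℕ k)) * A zero (suc k) * det (minor (suc k) A)
      ≈⟨ +-cong (*-identityˡ _) (*-cong (trans (*-cong (-1*x≈-x _) A₀ₖ) -s*-w) minor-C) ⟩
    det (minor zero A) + sign (toℕ k) * w * (sign (toℕ k) * det C)   ≈⟨ +-congˡ (interchange _ _ _ _) ⟩
    det (minor zero A) + sign (toℕ k) * sign (toℕ k) * (w * det C)   ≈⟨ +-congˡ (trans (*-congʳ (sign² (toℕ k))) (*-identityˡ _)) ⟩
    det (minor zero A) + w * det C                                   ≈⟨ det-linear k w B≈A B≈C BC ⟨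
    det B                                                            ∎
    where
    rest : Fin (suc n) → Carrier
    rest j = sign (suc (toℕ j)) * A zero (suc j) * det (minor (suc j) A)

    row : ∀ j → j ≢ k → rest j ≈ 0#
    row j j≢k = laplace-zero (A₀ⱼ j j≢k)

    -s*-w : - sign (toℕ k) * - w ≈ sign (toℕ k) * w
    -s*-w = trans (sym (-‿distribˡ-* _ _)) (trans (-‿cong (sym (-‿distribʳ-* _ _))) (-‿involutive _))

    -- `C` is `minor zero A` with its column `k` replaced by column 0 of `A`. In `minor (suc k) A`
    -- that column stands in front, and moving it into place costs `sign (toℕ k)`, which cancels
    -- against the sign in the Laplace expansion.
    C : Matrix (suc n)
    C i j = minor (suc k) A i (ρ k ⟨$⟩ˡ j)

    minor-C : det (minor (suc k) A) ≈ sign (toℕ k) * det C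
    minor-C = trans (det-cong (λ i j → reflexive (≡.cong (minor (suc k) A i) (≡.sym (Perm.inverseˡ (ρ k) {j}))))) (det-ρ k C)

    Cₖ : ∀ i → C i k ≡ A (suc i) zero
    Cₖ i = ≡.cong (minor (suc k) A i) (Perm.inverseˡ (ρ k) {zero})

    Cⱼ : ∀ i j → j ≢ k → C i j ≡ A (suc i) (suc j)
    Cⱼ i j j≢k = ≡.trans (≡.cong (minor (suc k) A i) (≡.trans (≡.cong (ρ k ⟨$⟩ˡ_) (≡.sym p)) (Perm.inverseˡ (ρ k) {suc (punchOut k≢j)})))
                         (≡.cong (λ z → A (suc i) (suc z)) p)
      where
      k≢j = j≢k ∘ ≡.sym
      p = Fin.punchIn-punchOut k≢j

    B≈C : ∀ i j → j ≢ k → B i j ≈ C i j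
    B≈C i j j≢k = trans (B≈A i j j≢k) (reflexive (≡.sym (Cⱼ i j j≢k)))

    BC : ∀ i → B i k ≈ minor zero A i k + w * C i k
    BC i = trans (Bₖ i) (+-congˡ (*-congˡ (reflexive (≡.sym (Cₖ i)))))

  -- With k = π⁻¹ 0, the permutation sends k + 1 to 0 and 0 to j + 1. Eliminating the entry - w 0 at
  -- column k + 1 of row 0 contributes - w 0 · w (j + 1) at position (j, k). This is the weighted
  -- entry of the permutation in which 0 is skipped and `k` goes straight to `j`, which is
  -- `π ∘ₚ ρ j`.
  det-contract : ∀ {n} (w : Fin (suc (suc n)) → Carrier) (w′ : Fin (suc n) → Carrier) j (π : Permutation′ (suc n)) →
                 w′ j ≈ w zero * w (suc j) → (∀ i → i ≢ j → w′ i ≈ w (suc i)) →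
                 det (1- w M insert zero (suc j) π) ≈ det (1- w′ M (π ∘ₚ ρ j))
  det-contract {n} w w′ j π w′ⱼ w′ᵢ =
    det-eliminate (w zero) k A B (x-w0≈x 1# (w zero)) A₀ₖ A₀ⱼ B≈A Bₖ
    where
    A = 1- w M insert zero (suc j) π
    B = 1- w′ M (π ∘ₚ ρ j)
    k = π ⟨$⟩ˡ zero

    image-k : π ⟨$⟩ʳ k ≡ zero
    image-k = Perm.inverseʳ π

    0≢image : ∀ {x} → x ≢ k → zero ≢ π ⟨$⟩ʳ x
    0≢image x≢k eq = x≢k (≡.trans (≡.sym (Perm.inverseˡ π)) (≡.cong (π ⟨$⟩ˡ_) (≡.sym eq)))

    A₀ₖ : A zero (suc k) ≈ - w zero
    A₀ₖ = begin
      0# - w zero * δ zero (punchIn (suc j) (π ⟨$⟩ʳ k)) ≡⟨ ≡.cong (λ z → 0# - w zero * δ zero (punchIn (suc j) z)) image-k ⟩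
      0# - w zero * 1#                                  ≈⟨ trans (+-identityˡ _) (-‿cong (*-identityʳ _)) ⟩
      - w zero                                          ∎

    A₀ⱼ : ∀ x → x ≢ k → A zero (suc x) ≈ 0#
    A₀ⱼ x x≢k with π ⟨$⟩ʳ x | 0≢image x≢k
    ... | zero  | ne = contradiction ≡.refl ne
    ... | suc z | ne = x-w0≈x 0# (w zero)

    B≈A : ∀ i x → x ≢ k → B i x ≈ A (suc i) (suc x)
    B≈A i x x≢k with π ⟨$⟩ʳ x | 0≢image x≢k
    ... | zero  | ne = contradiction ≡.refl ne
    ... | suc z | ne with i Fin.≟ j
    ...   | no  i≢j    = +-congˡ (-‿cong (*-congʳ (w′ᵢ i i≢j)))
    -- The weights `w′ i` and `w (suc i)` differ here, but both multiply 0: `punchIn i z` misses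
    -- `i`.
    ...   | yes ≡.refl = +-congˡ (-‿cong (trans (vanish (w′ i)) (sym (vanish (w (suc i))))))
      where
      vanish : ∀ v → v * δ i (punchIn i z) ≈ 0#
      vanish v = trans (*-congˡ (reflexive (δ-≢ (Fin.punchInᵢ≢i i z ∘ ≡.sym)))) (zeroʳ v)

    Bₖ : ∀ i → B i k ≈ A (suc i) (suc k) + w zero * A (suc i) zero
    Bₖ i = begin
      δ i k - w′ i * δ i (ρ j ⟨$⟩ʳ (π ⟨$⟩ʳ k))             ≡⟨ ≡.cong (λ z → δ i k - w′ i * δ i (ρ j ⟨$⟩ʳ z)) image-k ⟩
      δ i k - w′ i * δ i j                                  ≈⟨ +-cong (sym (x-w0≈x (δ i k) (w (suc i)))) (-‿cong wδ) ⟩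
      δ i k - w (suc i) * 0# - w zero * (w (suc i) * δ i j) ≈⟨ +-congˡ (trans (-‿distribʳ-* _ _) (*-congˡ (sym (+-identityˡ _)))) ⟩
      δ i k - w (suc i) * 0# + w zero * (0# - w (suc i) * δ i j)
        ≡⟨ ≡.cong (λ z → δ i k - w (suc i) * δ (suc i) (punchIn (suc j) z) + w zero * (0# - w (suc i) * δ i j)) image-k ⟨
      A (suc i) (suc k) + w zero * A (suc i) zero           ∎
      where
      wδ : w′ i * δ i j ≈ w zero * (w (suc i) * δ i j)
      wδ with i Fin.≟ j
      ... | yes ≡.refl = trans (*-identityʳ _) (trans w′ⱼ (*-congˡ (sym (*-identityʳ _))))
      ... | no  i≢j    = trans (zeroʳ _) (sym (trans (*-congˡ (zeroʳ _)) (zeroʳ _)))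

-- Convolution of sequences and the Euler derivation.

module Convolution {c ℓ} (R : CommutativeRing c ℓ) where
  open CommutativeRing R hiding (zero)
  open import Algebra.Properties.Semiring.Sum semiring
  open import Algebra.Properties.Semiring.Mult semiring using (×-congʳ; ×-homo-+; ×-assoc-*; ×-comm-*)
  open import Algebra.Definitions.RawSemiring (Semiring.rawSemiring semiring) using (_×_)
  open import Relation.Binary.Reasoning.Setoid setoid

  sum-cong : ∀ {n} (f g : Fin n → Carrier) → (∀ i → f i ≈ g i) → sum f ≈ sum g
  sum-cong f g eq = sum-cong-≋ eq

  sum-zero : ∀ {n} (f : Fin n → Carrier) → (∀ i → f i ≈ 0#) → sum f ≈ 0#
  sum-zero {n} f eq = trans (sum-cong-≋ eq) (sum-replicate-zero n)

  sum-snoc : ∀ n (f : ℕ → Carrier) → sum {suc n} (f ∘ toℕ) ≈ sum {n} (f ∘ toℕ) + f n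
  sum-snoc zero    f = +-comm _ _
  sum-snoc (suc n) f = trans (+-congˡ (sum-snoc n (f ∘ suc))) (sym (+-assoc _ _ _))

  ×-sum : ∀ k {n} (f : Fin n → Carrier) → k × sum f ≈ sum (λ i → k × f i)
  ×-sum k f = begin
    k × sum f                   ≈⟨ ×-as-* k _ ⟩
    (k × 1#) * sum f            ≈⟨ *-distribˡ-sum (k × 1#) f ⟩
    sum (λ i → (k × 1#) * f i)  ≈⟨ sum-cong-≋ (λ i → ×-as-* k (f i)) ⟨
    sum (λ i → k × f i)         ∎
    where
    ×-as-* : ∀ k x → k × x ≈ (k × 1#) * x
    ×-as-* k x = sym (trans (×-assoc-* k 1# x) (×-congʳ k (*-identityˡ x)))

  term : (ℕ → Carrier) → (ℕ → Carrier) → ∀ n → Fin (suc n) → Carrier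
  term f g n i = f (toℕ i) * g (n ∸ toℕ i)

  infixl 7 _⋆_
  -- This is used at two levels: over ℚ it is multiplication of series in x, and over ℚ[[x]] it is
  -- multiplication of series in y.
  _⋆_ : (ℕ → Carrier) → (ℕ → Carrier) → ℕ → Carrier
  (f ⋆ g) n = sum (term f g n)

  ⋆-cong-≤ : ∀ {f f′ g g′} n → (∀ i → i ≤ n → f i ≈ f′ i) → (∀ i → i ≤ n → g i ≈ g′ i) → (f ⋆ g) n ≈ (f′ ⋆ g′) n
  ⋆-cong-≤ {f} {f′} {g} {g′} n f≈ g≈ = sum-cong (term f g n) (term f′ g′ n) (λ i → *-cong (f≈ _ (Fin.toℕ≤pred[n] i)) (g≈ _ (ℕ.m∸n≤m n (toℕ i))))

  ⋆-cong : ∀ {f f′ g g′} → (∀ i → f i ≈ f′ i) → (∀ i → g i ≈ g′ i) → ∀ n → (f ⋆ g) n ≈ (f′ ⋆ g′) n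
  ⋆-cong f≈ g≈ n = ⋆-cong-≤ n (λ i _ → f≈ i) (λ i _ → g≈ i)

  ⋆-distribʳ : ∀ h f g n → ((λ i → f i + g i) ⋆ h) n ≈ (f ⋆ h) n + (g ⋆ h) n
  ⋆-distribʳ h f g n = trans (sum-cong (term (λ i → f i + g i) h n) (λ i → term f h n i + term g h n i)
    (λ i → distribʳ (h (n ∸ toℕ i)) (f (toℕ i)) (g (toℕ i)))) (∑-distrib-+ (term f h n) (term g h n))

  ⋆-scaleˡ : ∀ a f g n → ((λ i → a * f i) ⋆ g) n ≈ a * (f ⋆ g) n
  ⋆-scaleˡ a f g n = trans (sum-cong (term (λ i → a * f i) g n) (λ i → a * term f g n i)
    (λ i → *-assoc a (f (toℕ i)) (g (n ∸ toℕ i)))) (sym (*-distribˡ-sum a (term f g n)))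

  -- The definition peels off the first summand, this lemma the last one; setting the two recursions
  -- against each other gives commutativity.
  ⋆-suc : ∀ f g n → (f ⋆ g) (suc n) ≈ (f ⋆ (g ∘ suc)) n + f (suc n) * g 0
  ⋆-suc f g zero = begin
    f 0 * g 1 + (f 1 * g 0 + 0#)   ≈⟨ +-congˡ (+-identityʳ _) ⟩
    f 0 * g 1 + f 1 * g 0          ≈⟨ +-congʳ (+-identityʳ _) ⟨
    f 0 * g 1 + 0# + f 1 * g 0     ∎
  ⋆-suc f g (suc n) = trans (+-congˡ (⋆-suc (f ∘ suc) g n)) (sym (+-assoc _ _ _))

  ⋆-comm : ∀ f g n → (f ⋆ g) n ≈ (g ⋆ f) n
  ⋆-comm f g zero    = +-congʳ (*-comm _ _)
  ⋆-comm f g (suc n) = begin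
    f 0 * g (suc n) + ((f ∘ suc) ⋆ g) n ≈⟨ +-cong (*-comm _ _) (⋆-comm (f ∘ suc) g n) ⟩
    g (suc n) * f 0 + (g ⋆ (f ∘ suc)) n ≈⟨ +-comm _ _ ⟩
    (g ⋆ (f ∘ suc)) n + g (suc n) * f 0 ≈⟨ ⋆-suc g f n ⟨
    (g ⋆ f) (suc n)                     ∎

  ⋆-assoc : ∀ f g h n → ((f ⋆ g) ⋆ h) n ≈ (f ⋆ (g ⋆ h)) n
  ⋆-assoc f g h zero = +-congʳ (begin
    (f 0 * g 0 + 0#) * h 0  ≈⟨ *-congʳ (+-identityʳ _) ⟩
    f 0 * g 0 * h 0         ≈⟨ *-assoc _ _ _ ⟩
    f 0 * (g 0 * h 0)       ≈⟨ *-congˡ (+-identityʳ _) ⟨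
    f 0 * (g 0 * h 0 + 0#)  ∎)
  ⋆-assoc f g h (suc n) = begin
    (f 0 * g 0 + 0#) * h (suc n) + (((λ i → f 0 * g (suc i) + ((f ∘ suc) ⋆ g) i)) ⋆ h) n
      ≈⟨ +-cong (trans (*-congʳ (+-identityʳ _)) (*-assoc _ _ _))
                (trans (⋆-distribʳ h (λ i → f 0 * g (suc i)) ((f ∘ suc) ⋆ g) n)
                       (+-cong (⋆-scaleˡ (f 0) (g ∘ suc) h n) (⋆-assoc (f ∘ suc) g h n))) ⟩
    f 0 * (g 0 * h (suc n)) + (f 0 * ((g ∘ suc) ⋆ h) n + ((f ∘ suc) ⋆ (g ⋆ h)) n)
      ≈⟨ +-assoc _ _ _ ⟨
    f 0 * (g 0 * h (suc n)) + f 0 * ((g ∘ suc) ⋆ h) n + ((f ∘ suc) ⋆ (g ⋆ h)) n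
      ≈⟨ +-congʳ (distribˡ _ _ _) ⟨
    f 0 * (g ⋆ h) (suc n) + ((f ∘ suc) ⋆ (g ⋆ h)) n ∎

  ⋆-zeroˡ : ∀ {f} → (∀ i → f i ≈ 0#) → ∀ g n → (f ⋆ g) n ≈ 0#
  ⋆-zeroˡ {f} f≈0 g n = sum-zero (term f g n) (λ i → trans (*-congʳ (f≈0 (toℕ i))) (zeroˡ (g (n ∸ toℕ i))))

  ⋆-identityˡ : ∀ {e} → e 0 ≈ 1# → (∀ i → e (suc i) ≈ 0#) → ∀ f n → (e ⋆ f) n ≈ f n
  ⋆-identityˡ e₀ eₛ f zero    = trans (+-identityʳ _) (trans (*-congʳ e₀) (*-identityˡ _))
  ⋆-identityˡ {e} e₀ eₛ f (suc n) =
    trans (+-cong (trans (*-congʳ e₀) (*-identityˡ _)) (⋆-zeroˡ eₛ f n)) (+-identityʳ _)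

  -- The derivation f ↦ x f′.
  θ : (ℕ → Carrier) → ℕ → Carrier
  θ f n = n × f n

  θ-⋆ : ∀ f g n → θ (f ⋆ g) n ≈ (θ f ⋆ g) n + (f ⋆ θ g) n
  θ-⋆ f g n = begin
    n × sum (term f g n)                                   ≈⟨ ×-sum n (term f g n) ⟩
    sum (λ i → n × term f g n i)
      ≈⟨ sum-cong _ (λ i → term (θ f) g n i + term f (θ g) n i) (λ i → split (toℕ i) (Fin.toℕ≤pred[n] i)) ⟩
    sum (λ i → term (θ f) g n i + term f (θ g) n i)        ≈⟨ ∑-distrib-+ (term (θ f) g n) (term f (θ g) n) ⟩
    (θ f ⋆ g) n + (f ⋆ θ g) n ∎
    where
    split : ∀ i → i ≤ n → n × (f i * g (n ∸ i)) ≈ (i × f i) * g (n ∸ i) + f i * ((n ∸ i) × g (n ∸ i))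
    split i i≤n = begin
      n × (f i * g (n ∸ i))                                     ≡⟨ ≡.cong (_× (f i * g (n ∸ i))) (ℕ.m+[n∸m]≡n i≤n) ⟨
      (i ℕ.+ (n ∸ i)) × (f i * g (n ∸ i))                       ≈⟨ ×-homo-+ _ i (n ∸ i) ⟩
      i × (f i * g (n ∸ i)) + (n ∸ i) × (f i * g (n ∸ i))       ≈⟨ +-cong (×-assoc-* i _ _) (×-comm-* (n ∸ i) _ _) ⟨
      (i × f i) * g (n ∸ i) + f i * ((n ∸ i) × g (n ∸ i))       ∎

  module _ (×-cancel : ∀ n {a b} → suc n × a ≈ suc n × b → a ≈ b) where

    -- Since `Q 0` vanishes, the right side at n + 1 involves only values at indices up to n. The
    -- equation therefore determines the sequence from its value at 0, once the factor n + 1 is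
    -- cancelled.
    θ-unique : ∀ (a Q : ℕ → Carrier) {u v : ℕ → Carrier} → Q 0 ≈ 0# → u 0 ≈ v 0 →
               (∀ n → θ u n ≈ a n + (Q ⋆ u) n) → (∀ n → θ v n ≈ a n + (Q ⋆ v) n) → ∀ n → u n ≈ v n
    θ-unique a Q {u} {v} Q₀ u₀≈v₀ θu θv = <-rec _ step
      where
      drop₀ : ∀ w n → (Q ⋆ w) (suc n) ≈ ((Q ∘ suc) ⋆ w) n
      drop₀ w n = trans (+-congʳ (trans (*-congʳ Q₀) (zeroˡ _))) (+-identityˡ _)

      step : ∀ n → (∀ {m} → m < n → u m ≈ v m) → u n ≈ v n
      step zero    _  = u₀≈v₀
      step (suc n) ih = ×-cancel n (begin
        suc n × u (suc n)                  ≈⟨ θu (suc n) ⟩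
        a (suc n) + (Q ⋆ u) (suc n)        ≈⟨ +-congˡ (drop₀ u n) ⟩
        a (suc n) + ((Q ∘ suc) ⋆ u) n      ≈⟨ +-congˡ (⋆-cong-≤ {Q ∘ suc} {Q ∘ suc} {u} {v} n (λ _ _ → refl) (λ i i≤n → ih (s≤s i≤n))) ⟩
        a (suc n) + ((Q ∘ suc) ⋆ v) n      ≈⟨ +-congˡ (drop₀ v n) ⟨
        a (suc n) + (Q ⋆ v) (suc n)        ≈⟨ θv (suc n) ⟨
        suc n × v (suc n)                  ∎)

-- The integers inside the rationals.

module RationalIntegers where
  open import Algebra.Definitions.RawSemiring ℚ.+-*-rawSemiring using () renaming (_×_ to _×ℚ_)
  fromℤ : ℤ → ℚ
  fromℤ i = i ℚ./ 1

  -- The quotient `i ℚ./ 1` is normalised through a gcd and does not compute on a variable, so its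
  -- arithmetic laws are checked on unnormalised fractions.
  toℚᵘ-fromℤ : ∀ i → ℚ.toℚᵘ (fromℤ i) ℚᵘ.≃ ℚᵘ.mkℚᵘ i 0
  toℚᵘ-fromℤ i = ℚ.toℚᵘ-fromℚᵘ (ℚᵘ.mkℚᵘ i 0)

  module _ where
    open import Relation.Binary.Reasoning.Setoid ℚᵘ.≃-setoid

    fromℤ-+ : ∀ i j → fromℤ (i ℤ.+ j) ≡ fromℤ i ℚ.+ fromℤ j
    fromℤ-+ i j = ℚ.toℚᵘ-injective (begin
      ℚ.toℚᵘ (fromℤ (i ℤ.+ j))                  ≈⟨ toℚᵘ-fromℤ (i ℤ.+ j) ⟩
      ℚᵘ.mkℚᵘ (i ℤ.+ j) 0                        ≈⟨ ℚᵘ.*≡* (≡.cong (ℤ._* ℤ.1ℤ) (≡.cong₂ ℤ._+_ (≡.sym (ℤ.*-identityʳ i)) (≡.sym (ℤ.*-identityʳ j)))) ⟩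
      ℚᵘ.mkℚᵘ i 0 ℚᵘ.+ ℚᵘ.mkℚᵘ j 0               ≈⟨ ℚᵘ.+-cong (toℚᵘ-fromℤ i) (toℚᵘ-fromℤ j) ⟨
      ℚ.toℚᵘ (fromℤ i) ℚᵘ.+ ℚ.toℚᵘ (fromℤ j)     ≈⟨ ℚ.toℚᵘ-homo-+ (fromℤ i) (fromℤ j) ⟨
      ℚ.toℚᵘ (fromℤ i ℚ.+ fromℤ j)               ∎)

    fromℤ-* : ∀ i j → fromℤ (i ℤ.* j) ≡ fromℤ i ℚ.* fromℤ j
    fromℤ-* i j = ℚ.toℚᵘ-injective (begin
      ℚ.toℚᵘ (fromℤ (i ℤ.* j))                  ≈⟨ toℚᵘ-fromℤ (i ℤ.* j) ⟩
      ℚᵘ.mkℚᵘ i 0 ℚᵘ.* ℚᵘ.mkℚᵘ j 0               ≈⟨ ℚᵘ.*-cong (toℚᵘ-fromℤ i) (toℚᵘ-fromℤ j) ⟨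
      ℚ.toℚᵘ (fromℤ i) ℚᵘ.* ℚ.toℚᵘ (fromℤ j)     ≈⟨ ℚ.toℚᵘ-homo-* (fromℤ i) (fromℤ j) ⟨
      ℚ.toℚᵘ (fromℤ i ℚ.* fromℤ j)               ∎)

    fromℤ-neg : ∀ i → fromℤ (ℤ.- i) ≡ ℚ.- fromℤ i
    fromℤ-neg i = ℚ.toℚᵘ-injective (begin
      ℚ.toℚᵘ (fromℤ (ℤ.- i))                    ≈⟨ toℚᵘ-fromℤ (ℤ.- i) ⟩
      ℚᵘ.- ℚᵘ.mkℚᵘ i 0                           ≈⟨ ℚᵘ.-‿cong (toℚᵘ-fromℤ i) ⟨
      ℚᵘ.- ℚ.toℚᵘ (fromℤ i)                      ≈⟨ ℚ.toℚᵘ-homo‿- (fromℤ i) ⟨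
      ℚ.toℚᵘ (ℚ.- fromℤ i)                       ∎)

  fromℤ-*-inverse : ∀ d .{{_ : ℕ.NonZero d}} → fromℤ (+ d) ℚ.* ((+ 1) ℚ./ d) ≡ 1ℚ
  fromℤ-*-inverse (suc d) = ℚ.toℚᵘ-injective (ℚᵘ.≃-trans (ℚ.toℚᵘ-homo-* (fromℤ (+ suc d)) ((+ 1) ℚ./ suc d))
    (ℚᵘ.≃-trans (ℚᵘ.*-cong (toℚᵘ-fromℤ (+ suc d)) (ℚ.toℚᵘ-fromℚᵘ (ℚᵘ.mkℚᵘ (+ 1) d)))
      (ℚᵘ.*≡* (≡.trans (ℤ.*-identityʳ _) (≡.trans (ℤ.*-identityʳ (+ suc d))
        (≡.sym (≡.trans (ℤ.*-identityˡ _) (≡.cong (λ n → + suc n) (ℕ.+-identityʳ d)))))))))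

  fromℤ-injective : ∀ {i j} → fromℤ i ≡ fromℤ j → i ≡ j
  fromℤ-injective {i} {j} eq with ℚᵘ.≃-trans (ℚᵘ.≃-sym (toℚᵘ-fromℤ i)) (ℚᵘ.≃-trans (ℚᵘ.≃-reflexive (≡.cong ℚ.toℚᵘ eq)) (toℚᵘ-fromℤ j))
  ... | ℚᵘ.*≡* p = ≡.trans (≡.sym (ℤ.*-identityʳ i)) (≡.trans p (ℤ.*-identityʳ j))

  open ≡.≡-Reasoning

  ×-fromℤ : ∀ n q → n ×ℚ q ≡ fromℤ (+ n) ℚ.* q
  ×-fromℤ zero    q = ≡.sym (ℚ.*-zeroˡ q)
  ×-fromℤ (suc n) q = begin
    q ℚ.+ n ×ℚ q                         ≡⟨ ≡.cong₂ ℚ._+_ (≡.sym (ℚ.*-identityˡ q)) (×-fromℤ n q) ⟩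
    1ℚ ℚ.* q ℚ.+ fromℤ (+ n) ℚ.* q       ≡⟨ ℚ.*-distribʳ-+ q 1ℚ (fromℤ (+ n)) ⟨
    (1ℚ ℚ.+ fromℤ (+ n)) ℚ.* q           ≡⟨ ≡.cong (ℚ._* q) (fromℤ-+ (+ 1) (+ n)) ⟨
    fromℤ (+ suc n) ℚ.* q                ∎

  fromℤ-suc≢0 : ∀ n → fromℤ (+ suc n) ≢ 0ℚ
  fromℤ-suc≢0 n eq with () ← fromℤ-injective {+ suc n} {+ 0} eq

  *-cancelˡ : ∀ p {q r} → p ≢ 0ℚ → p ℚ.* q ≡ p ℚ.* r → q ≡ r
  *-cancelˡ p {q} {r} p≢0 eq = begin
    q                       ≡⟨ inv q ⟨
    1/p ℚ.* (p ℚ.* q)       ≡⟨ ≡.cong (1/p ℚ.*_) eq ⟩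
    1/p ℚ.* (p ℚ.* r)       ≡⟨ inv r ⟩
    r                       ∎
    where
    instance
      nz : ℚ.NonZero p
      nz = ℚ.≢-nonZero p≢0
    1/p = ℚ.1/ p
    inv : ∀ s → 1/p ℚ.* (p ℚ.* s) ≡ s
    inv s = ≡.trans (≡.sym (ℚ.*-assoc 1/p p s)) (≡.trans (≡.cong (ℚ._* s) (ℚ.*-inverseˡ p)) (ℚ.*-identityˡ s))

  ×-cancel : ∀ n {q r} → suc n ×ℚ q ≡ suc n ×ℚ r → q ≡ r
  ×-cancel n {q} {r} eq = *-cancelˡ (fromℤ (+ suc n)) (fromℤ-suc≢0 n)
    (≡.trans (≡.sym (×-fromℤ (suc n) q)) (≡.trans eq (×-fromℤ (suc n) r)))

-- The ring of formal power series.

-- An abstract presentation of ℚ[[x]], in which series are not unfolded to functions.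
record PowerSeriesRing : Set₁ where
  field
    commutativeRing : CommutativeRing 0ℓ 0ℓ
  open CommutativeRing commutativeRing
  open Convolution ℚ.+-*-commutativeRing
  field
    coeff      : Carrier → ℕ → ℚ
    mk         : (ℕ → ℚ) → Carrier
    coeff-mk   : ∀ s n → coeff (mk s) n ≡ s n
    coeff-cong : ∀ {f g} → f ≈ g → ∀ n → coeff f n ≡ coeff g n
    coeff-ext  : ∀ {f g} → (∀ n → coeff f n ≡ coeff g n) → f ≈ g
    coeff-+    : ∀ f g n → coeff (f + g) n ≡ coeff f n ℚ.+ coeff g n
    coeff-*    : ∀ f g n → coeff (f * g) n ≡ (coeff f ⋆ coeff g) n
    coeff-neg  : ∀ f n → coeff (- f) n ≡ ℚ.- coeff f n
    coeff-0#   : ∀ n → coeff 0# n ≡ 0ℚ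
    coeff-1#-0 : coeff 1# 0 ≡ 1ℚ
    coeff-1#-suc : ∀ n → coeff 1# (suc n) ≡ 0ℚ
    x          : Carrier
    coeff-x-0  : coeff x 0 ≡ 0ℚ
    coeff-x-1  : coeff x 1 ≡ 1ℚ
    coeff-x-2+ : ∀ n → coeff x (suc (suc n)) ≡ 0ℚ

ℚ[[X]] : PowerSeriesRing
ℚ[[X]] = record
  { commutativeRing = record
    { Carrier = Defs.FPS ; _≈_ = Defs._≈_ ; _+_ = Defs._+_ ; _*_ = Defs._*_ ; -_ = Defs.-_ ; 0# = Defs.0# ; 1# = Defs.1#
    ; isCommutativeRing = record
      { isRing = record
        { +-isAbelianGroup = record
          { isGroup = record
            { isMonoid = record
              { isSemigroup = record
                { isMagma = record
                  { isEquivalence = record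
                    { refl  = λ n → ≡.refl
                    ; sym   = λ p n → ≡.sym (p n)
                    ; trans = λ p q n → ≡.trans (p n) (q n)
                    }
                  ; ∙-cong = λ p q n → ≡.cong₂ ℚ._+_ (p n) (q n)
                  }
                ; assoc = λ f g h n → ℚ.+-assoc (f n) (g n) (h n)
                }
              ; identity = (λ f n → ℚ.+-identityˡ (f n)) , (λ f n → ℚ.+-identityʳ (f n))
              }
            ; inverse = (λ f n → ℚ.+-inverseˡ (f n)) , (λ f n → ℚ.+-inverseʳ (f n))
            ; ⁻¹-cong = λ p n → ≡.cong ℚ.-_ (p n)
            }
          ; comm = λ f g n → ℚ.+-comm (f n) (g n)
          }
        ; *-cong     = λ {f} {f′} {g} {g′} p q n → ⋆-cong {f} {f′} {g} {g′} p q n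
        ; *-assoc    = ⋆-assoc
        ; *-identity = 1⋆ , λ f n → ≡.trans (⋆-comm f Defs.1# n) (1⋆ f n)
        ; distrib    =
          (λ f g h n → ≡.trans (⋆-comm f (g Defs.+ h) n)
            (≡.trans (⋆-distribʳ f g h n) (≡.cong₂ ℚ._+_ (⋆-comm g f n) (⋆-comm h f n))))
          , ⋆-distribʳ
        }
      ; *-comm = ⋆-comm
      }
    }
  ; coeff = λ f → f ; mk = λ f → f ; coeff-mk = λ s n → ≡.refl ; coeff-cong = λ p → p ; coeff-ext = λ p → p
  ; coeff-+ = λ f g n → ≡.refl ; coeff-* = λ f g n → ≡.refl ; coeff-neg = λ f n → ≡.refl
  ; coeff-0# = λ n → ≡.refl ; coeff-1#-0 = ≡.refl ; coeff-1#-suc = λ n → ≡.refl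
  ; x = Defs.X ; coeff-x-0 = ≡.refl ; coeff-x-1 = ≡.refl ; coeff-x-2+ = λ n → ≡.refl
  }
  where
  open Convolution ℚ.+-*-commutativeRing
  1⋆ : ∀ f n → (Defs.1# ⋆ f) n ≡ f n
  1⋆ = ⋆-identityˡ {Defs.1#} ≡.refl (λ i → ≡.refl)

-- Congruences, inverses, integer powers and logarithmic derivatives of series.

module PowerSeries (𝓡 : PowerSeriesRing) where
  open PowerSeriesRing 𝓡
  open CommutativeRing commutativeRing hiding (zero)
  open import Algebra.Definitions.RawSemiring (Semiring.rawSemiring semiring) using (_^_; _×_)
  open import Algebra.Properties.Semiring.Sum semiring
  open import Algebra.Properties.Semiring.Exp semiring using (^-congˡ)
  open import Algebra.Properties.CommutativeSemiring.Exp commutativeSemiring using (^-distrib-*)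
  open import Algebra.Properties.Ring ring
  open import Algebra.Solver.Ring.NaturalCoefficients.Default commutativeSemiring using (solve; _:*_; _:+_; _:=_; con)
  open import Relation.Binary.Reasoning.Setoid setoid
  open Convolution commutativeRing using (sum-snoc)
  open RationalIntegers
  private
    module Q where
      open Convolution ℚ.+-*-commutativeRing public
      open import Algebra.Properties.Semiring.Sum (CommutativeRing.semiring ℚ.+-*-commutativeRing) public
      open import Algebra.Definitions.RawSemiring ℚ.+-*-rawSemiring using (_×_) public
      open import Algebra.Properties.Semiring.Mult (CommutativeRing.semiring ℚ.+-*-commutativeRing) using (×-comm-*) public
      open import Algebra.Properties.CommutativeMonoid.Mult (CommutativeRing.+-commutativeMonoid ℚ.+-*-commutativeRing) using (×-distrib-+) public
      open import Algebra.Properties.Ring (CommutativeRing.ring ℚ.+-*-commutativeRing) public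

  coeff-sum : ∀ {n} (f : Fin n → Carrier) i → coeff (sum f) i ≡ Q.sum (λ k → coeff (f k) i)
  coeff-sum {zero}  f i = coeff-0# i
  coeff-sum {suc n} f i = ≡.trans (coeff-+ _ _ i) (≡.cong (coeff (f zero) i ℚ.+_) (coeff-sum (f ∘ suc) i))

  infix 4 _≈[_]_
  -- Congruence modulo x^N. Limits of sums and products enter the proof only through it.
  _≈[_]_ : Carrier → ℕ → Carrier → Set
  f ≈[ N ] g = ∀ n → n < N → coeff f n ≡ coeff g n

  ≈⇒≈[] : ∀ {N f g} → f ≈ g → f ≈[ N ] g
  ≈⇒≈[] f≈g n _ = coeff-cong f≈g n

  ≈[]-sym : ∀ {N f g} → f ≈[ N ] g → g ≈[ N ] f
  ≈[]-sym p n n<N = ≡.sym (p n n<N)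

  ≈[]-trans : ∀ {N f g h} → f ≈[ N ] g → g ≈[ N ] h → f ≈[ N ] h
  ≈[]-trans p q n n<N = ≡.trans (p n n<N) (q n n<N)

  +-≈[] : ∀ {N f f′ g g′} → f ≈[ N ] f′ → g ≈[ N ] g′ → f + g ≈[ N ] f′ + g′
  +-≈[] {f = f} {f′} {g} {g′} p q n n<N =
    ≡.trans (coeff-+ f g n) (≡.trans (≡.cong₂ ℚ._+_ (p n n<N) (q n n<N)) (≡.sym (coeff-+ f′ g′ n)))

  -‿≈[] : ∀ {N f f′} → f ≈[ N ] f′ → - f ≈[ N ] - f′
  -‿≈[] {f = f} {f′} p n n<N =
    ≡.trans (coeff-neg f n) (≡.trans (≡.cong ℚ.-_ (p n n<N)) (≡.sym (coeff-neg f′ n)))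

  *-≈[] : ∀ {N f f′ g g′} → f ≈[ N ] f′ → g ≈[ N ] g′ → f * g ≈[ N ] f′ * g′
  *-≈[] {f = f} {f′} {g} {g′} p q n n<N =
    ≡.trans (coeff-* f g n) (≡.trans
      (Q.⋆-cong-≤ {coeff f} {coeff f′} {coeff g} {coeff g′} n
        (λ i i≤n → p i (ℕ.≤-<-trans i≤n n<N)) (λ i i≤n → q i (ℕ.≤-<-trans i≤n n<N)))
      (≡.sym (coeff-* f′ g′ n)))

  -- A factor divisible by x raises the order by one: every summand contains either coefficient 0 of
  -- `f` or a coefficient of `g` of index below N.
  *-≈[]0 : ∀ {N f g} → coeff f 0 ≡ 0ℚ → g ≈[ N ] 0# → f * g ≈[ suc N ] 0#
  *-≈[]0 {N} {f} {g} f₀ p n (s≤s n≤N) = ≡.trans (coeff-* f g n) (≡.trans (vanish n n≤N) (≡.sym (coeff-0# n)))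
    where
    vanish : ∀ n → n ≤ N → (coeff f Q.⋆ coeff g) n ≡ 0ℚ
    vanish zero    _   = ≡.trans (ℚ.+-identityʳ _) (≡.trans (≡.cong (ℚ._* coeff g 0) f₀) (ℚ.*-zeroˡ (coeff g 0)))
    vanish (suc n) n<N = ≡.cong₂ ℚ._+_
      (≡.trans (≡.cong (ℚ._* coeff g (suc n)) f₀) (ℚ.*-zeroˡ (coeff g (suc n))))
      (Q.sum-zero (Q.term (coeff f ∘ suc) (coeff g) n) (λ i →
        ≡.trans (≡.cong (coeff f (suc (toℕ i)) ℚ.*_)
                  (≡.trans (p (n ∸ toℕ i) (ℕ.≤-<-trans (ℕ.m∸n≤m n (toℕ i)) n<N)) (coeff-0# _)))
                (ℚ.*-zeroʳ (coeff f (suc (toℕ i))))))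

  ^-≈[]0 : ∀ {f} → coeff f 0 ≡ 0ℚ → ∀ n → f ^ n ≈[ n ] 0#
  ^-≈[]0 f₀ zero    n ()
  ^-≈[]0 f₀ (suc n) = *-≈[]0 f₀ (^-≈[]0 f₀ n)

  coeff₀-* : ∀ f g → coeff (f * g) 0 ≡ coeff f 0 ℚ.* coeff g 0
  coeff₀-* f g = ≡.trans (coeff-* f g 0) (ℚ.+-identityʳ _)

  Unital : Carrier → Set
  Unital f = coeff f 0 ≡ 1ℚ

  *-unital : ∀ {f g} → Unital f → Unital g → Unital (f * g)
  *-unital {f} {g} f₀ g₀ = ≡.trans (coeff₀-* f g) (≡.cong₂ ℚ._*_ f₀ g₀)

  ^-unital : ∀ {f} → Unital f → ∀ n → Unital (f ^ n)
  ^-unital f₀ zero    = coeff-1#-0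
  ^-unital f₀ (suc n) = *-unital f₀ (^-unital f₀ n)

  1-f₀ : ∀ {f q} → coeff f 0 ≡ q → coeff (1# - f) 0 ≡ 1ℚ ℚ.- q
  1-f₀ {f} f₀ = ≡.trans (coeff-+ 1# (- f) 0) (≡.cong₂ ℚ._+_ coeff-1#-0 (≡.trans (coeff-neg f 0) (≡.cong ℚ.-_ f₀)))

  geometric : Carrier → ℕ → Carrier
  geometric u N = sum {N} (λ k → u ^ toℕ k)

  inverse : Carrier → Carrier
  inverse f = mk (λ n → coeff (geometric (1# - f) (suc n)) n)

  geometric-stable : ∀ {u} → coeff u 0 ≡ 0ℚ → ∀ N → geometric u (suc N) ≈[ N ] geometric u N
  geometric-stable {u} u₀ N = ≈[]-trans (≈⇒≈[] (sum-snoc N (u ^_)))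
    (≈[]-trans (+-≈[] {f = geometric u N} (λ n _ → ≡.refl) (^-≈[]0 u₀ N)) (≈⇒≈[] (+-identityʳ _)))

  inverse-≈[]-geometric : ∀ {f} → Unital f → ∀ N → inverse f ≈[ N ] geometric (1# - f) N
  inverse-≈[]-geometric {f} f₀ N i i<N = ≡.trans (coeff-mk _ i)
    (≡.trans (≡.sym (stable (N ∸ suc i))) (≡.cong (λ M → coeff (geometric u M) i) (ℕ.m∸n+n≡m i<N)))
    where
    u = 1# - f
    stable : ∀ d → coeff (geometric u (d ℕ.+ suc i)) i ≡ coeff (geometric u (suc i)) i
    stable zero    = ≡.refl
    stable (suc d) = ≡.trans (geometric-stable (1-f₀ f₀) (d ℕ.+ suc i) i (ℕ.m≤n+m (suc i) d)) (stable d)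

  *-inverseʳ : ∀ {f} → Unital f → f * inverse f ≈ 1#
  *-inverseʳ {f} f₀ = coeff-ext (λ n → ≡.trans
    (*-≈[] {f = f} (λ _ _ → ≡.refl) (inverse-≈[]-geometric f₀ (suc n)) n (ℕ.n<1+n n))
    (product≈[] (suc n) n (ℕ.n<1+n n)))
    where
    u = 1# - f

    -- From `geometric u (suc N)` = 1 + u · `geometric u N` and u + f = 1. Stated without
    -- subtraction, it is within reach of the semiring solver; modulo x^N the two partial sums
    -- cancel and leave f · `geometric u N` = 1.
    recurrence : ∀ N → f * geometric u N + geometric u (suc N) ≈ 1# + geometric u N
    recurrence N = begin
      f * geometric u N + (1# + sum {N} (λ k → u * u ^ toℕ k))
        ≈⟨ +-congˡ (+-congˡ (*-distribˡ-sum {N} u (λ k → u ^ toℕ k))) ⟨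
      f * geometric u N + (1# + u * geometric u N)
        ≈⟨ solve 3 (λ f u g → f :* g :+ (con 1 :+ u :* g) := con 1 :+ (u :+ f) :* g) refl f u (geometric u N) ⟩
      1# + (1# - f + f) * geometric u N
        ≈⟨ +-congˡ (trans (*-congʳ (trans (+-assoc _ _ _) (trans (+-congˡ (-‿inverseˡ f)) (+-identityʳ 1#)))) (*-identityˡ _)) ⟩
      1# + geometric u N ∎

    product≈[] : ∀ N → f * geometric u N ≈[ N ] 1#
    product≈[] N = ≈[]-trans (≈⇒≈[] (x+y≈z⇒x≈z-y (recurrence N)))
      (≈[]-trans (+-≈[] {f = 1# + geometric u N} (λ _ _ → ≡.refl) (-‿≈[] (geometric-stable (1-f₀ f₀) N)))
        (≈⇒≈[] (trans (+-assoc _ _ _) (trans (+-congˡ (-‿inverseʳ _)) (+-identityʳ 1#)))))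
      where
      x+y≈z⇒x≈z-y : ∀ {x y z} → x + y ≈ z → x ≈ z - y
      x+y≈z⇒x≈z-y {x} {y} {z} eq = begin
        x             ≈⟨ +-identityʳ x ⟨
        x + 0#        ≈⟨ +-congˡ (-‿inverseʳ y) ⟨
        x + (y - y)   ≈⟨ +-assoc _ _ _ ⟨
        x + y - y     ≈⟨ +-congʳ eq ⟩
        z - y         ∎

  inverse-unique : ∀ {f g} → Unital f → f * g ≈ 1# → g ≈ inverse f
  inverse-unique {f} {g} f₀ fg≈1 = begin
    g                     ≈⟨ *-identityˡ g ⟨
    1# * g                ≈⟨ *-congʳ (*-inverseʳ f₀) ⟨
    f * inverse f * g     ≈⟨ solve 3 (λ f i g → f :* i :* g := i :* (f :* g)) refl f (inverse f) g ⟩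
    inverse f * (f * g)   ≈⟨ trans (*-congˡ fg≈1) (*-identityʳ _) ⟩
    inverse f             ∎

  unital-cong : ∀ {f g} → f ≈ g → Unital f → Unital g
  unital-cong f≈g f₀ = ≡.trans (≡.sym (coeff-cong f≈g 0)) f₀

  inverse-unital : ∀ {f} → Unital f → Unital (inverse f)
  inverse-unital {f} f₀ = ≡.trans (≡.sym (ℚ.*-identityˡ _))
    (≡.trans (≡.cong (ℚ._* coeff (inverse f) 0) (≡.sym f₀))
      (≡.trans (≡.sym (coeff₀-* f (inverse f))) (≡.trans (coeff-cong (*-inverseʳ f₀) 0) coeff-1#-0)))

  *-cancelˡ-unital : ∀ {f g h} → Unital f → f * g ≈ f * h → g ≈ h
  *-cancelˡ-unital {f} {g} {h} f₀ eq = begin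
    g                     ≈⟨ inv g ⟨
    inverse f * (f * g)   ≈⟨ *-congˡ eq ⟩
    inverse f * (f * h)   ≈⟨ inv h ⟩
    h                     ∎
    where
    inv : ∀ g → inverse f * (f * g) ≈ g
    inv g = trans (solve 3 (λ i f g → i :* (f :* g) := f :* i :* g) refl (inverse f) f g)
                  (trans (*-congʳ (*-inverseʳ f₀)) (*-identityˡ g))

  infixr 8 _^ℤ_
  _^ℤ_ : Carrier → ℤ → Carrier
  f ^ℤ (+ n)    = f ^ n
  f ^ℤ -[1+ n ] = inverse f ^ suc n

  ^ℤ-unital : ∀ {f} → Unital f → ∀ r → Unital (f ^ℤ r)
  ^ℤ-unital f₀ (+ n)    = ^-unital f₀ n
  ^ℤ-unital f₀ -[1+ n ] = ^-unital (inverse-unital f₀) (suc n)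

  ^ℤ-cong : ∀ {f g} → Unital f → f ≈ g → ∀ r → f ^ℤ r ≈ g ^ℤ r
  ^ℤ-cong f₀ f≈g (+ n)    = ^-congˡ n f≈g
  ^ℤ-cong f₀ f≈g -[1+ n ] = ^-congˡ (suc n)
    (inverse-unique (unital-cong f≈g f₀) (trans (*-congʳ (sym f≈g)) (*-inverseʳ f₀)))

  ^ℤ-distrib-* : ∀ {f g} → Unital f → Unital g → ∀ r → (f * g) ^ℤ r ≈ f ^ℤ r * g ^ℤ r
  ^ℤ-distrib-* {f} {g} f₀ g₀ (+ n)    = ^-distrib-* f g n
  ^ℤ-distrib-* {f} {g} f₀ g₀ -[1+ n ] =
    trans (^-congˡ (suc n) (sym (inverse-unique (*-unital f₀ g₀) (begin
      f * g * (inverse f * inverse g)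
        ≈⟨ solve 4 (λ f g i j → f :* g :* (i :* j) := f :* i :* (g :* j)) refl f g (inverse f) (inverse g) ⟩
      f * inverse f * (g * inverse g)   ≈⟨ *-cong (*-inverseʳ f₀) (*-inverseʳ g₀) ⟩
      1# * 1#                           ≈⟨ *-identityˡ 1# ⟩
      1#                                ∎)))) (^-distrib-* (inverse f) (inverse g) (suc n))

  1^ℤ : ∀ r → 1# ^ℤ r ≈ 1#
  1^ℤ (+ n)    = 1^n n
    where
    1^n : ∀ n → 1# ^ n ≈ 1#
    1^n zero    = refl
    1^n (suc n) = trans (*-identityˡ _) (1^n n)
  1^ℤ -[1+ n ] = trans (^-congˡ (suc n) (sym (inverse-unique coeff-1#-0 (*-identityˡ 1#)))) (1^ℤ (+ suc n))

  constants : ℚ → ℕ → ℚ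
  constants q zero    = q
  constants q (suc n) = 0ℚ

  const : ℚ → Carrier
  const q = mk (constants q)

  coeff-const-* : ∀ q f n → coeff (const q * f) n ≡ q ℚ.* coeff f n
  coeff-const-* q f n = ≡.trans (coeff-* (const q) f n) (const-⋆ n)
    where
    const-⋆ : ∀ n → (coeff (const q) Q.⋆ coeff f) n ≡ q ℚ.* coeff f n
    const-⋆ zero    = ≡.trans (ℚ.+-identityʳ _) (≡.cong (ℚ._* coeff f 0) (coeff-mk _ 0))
    const-⋆ (suc n) = ≡.trans (≡.cong₂ ℚ._+_ (≡.cong (ℚ._* coeff f (suc n)) (coeff-mk _ 0))
      (Q.⋆-zeroˡ {coeff (const q) ∘ suc} (λ i → coeff-mk _ (suc i)) (coeff f) n)) (ℚ.+-identityʳ _)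

  const-+ : ∀ p q f → const (p ℚ.+ q) * f ≈ const p * f + const q * f
  const-+ p q f = coeff-ext (λ n → ≡.trans (coeff-const-* (p ℚ.+ q) f n) (≡.trans (ℚ.*-distribʳ-+ (coeff f n) p q)
    (≡.sym (≡.trans (coeff-+ _ _ n) (≡.cong₂ ℚ._+_ (coeff-const-* p f n) (coeff-const-* q f n))))))

  const-* : ∀ p q f → const (p ℚ.* q) * f ≈ const p * (const q * f)
  const-* p q f = coeff-ext (λ n → ≡.trans (coeff-const-* (p ℚ.* q) f n) (≡.trans (ℚ.*-assoc p q _)
    (≡.sym (≡.trans (coeff-const-* p _ n) (≡.cong (p ℚ.*_) (coeff-const-* q f n))))))

  const-1 : ∀ f → const 1ℚ * f ≈ f
  const-1 f = coeff-ext (λ n → ≡.trans (coeff-const-* 1ℚ f n) (ℚ.*-identityˡ _))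

  const-neg : ∀ q f → const (ℚ.- q) * f ≈ - (const q * f)
  const-neg q f = coeff-ext (λ n → ≡.trans (coeff-const-* (ℚ.- q) f n) (≡.trans (≡.sym (Q.-‿distribˡ-* q (coeff f n)))
    (≡.sym (≡.trans (coeff-neg _ n) (≡.cong ℚ.-_ (coeff-const-* q f n))))))

  ×-const : ∀ n f → n × f ≈ const (fromℤ (+ n)) * f
  ×-const zero    f = coeff-ext (λ n → ≡.trans (coeff-0# n) (≡.sym (≡.trans (coeff-const-* (fromℤ (+ 0)) f n) (ℚ.*-zeroˡ (coeff f n)))))
  ×-const (suc n) f = trans (+-cong (sym (const-1 f)) (×-const n f))
    (trans (sym (const-+ 1ℚ (fromℤ (+ n)) f)) (*-congʳ (reflexive (≡.cong const (≡.sym (fromℤ-+ (+ 1) (+ n)))))))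

  coeff-× : ∀ n f i → coeff (n × f) i ≡ n Q.× coeff f i
  coeff-× zero    f i = coeff-0# i
  coeff-× (suc n) f i = ≡.trans (coeff-+ f (n × f) i) (≡.cong (coeff f i ℚ.+_) (coeff-× n f i))

  ×-cancelˡ : ∀ n {f g} → suc n × f ≈ suc n × g → f ≈ g
  ×-cancelˡ n {f} {g} eq = coeff-ext (λ i → ×-cancel n
    (≡.trans (≡.sym (coeff-× (suc n) f i)) (≡.trans (coeff-cong eq i) (coeff-× (suc n) g i))))

  θ : Carrier → Carrier
  θ f = mk (Q.θ (coeff f))

  coeff-θ : ∀ f n → coeff (θ f) n ≡ n Q.× coeff f n
  coeff-θ f n = coeff-mk _ n

  θ-≈[] : ∀ {N f g} → f ≈[ N ] g → θ f ≈[ N ] θ g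
  θ-≈[] {f = f} {g} p n n<N = ≡.trans (coeff-θ f n) (≡.trans (≡.cong (n Q.×_) (p n n<N)) (≡.sym (coeff-θ g n)))

  θ-cong : ∀ {f g} → f ≈ g → θ f ≈ θ g
  θ-cong f≈g = coeff-ext (λ n → θ-≈[] {suc n} (≈⇒≈[] f≈g) n (ℕ.n<1+n n))

  θ-+ : ∀ f g → θ (f + g) ≈ θ f + θ g
  θ-+ f g = coeff-ext (λ n → ≡.trans (coeff-θ (f + g) n) (≡.trans (≡.cong (n Q.×_) (coeff-+ f g n))
    (≡.trans (Q.×-distrib-+ (coeff f n) (coeff g n) n)
      (≡.sym (≡.trans (coeff-+ _ _ n) (≡.cong₂ ℚ._+_ (coeff-θ f n) (coeff-θ g n)))))))

  θ-const-* : ∀ q f → θ (const q * f) ≈ const q * θ f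
  θ-const-* q f = coeff-ext (λ n → ≡.trans (coeff-θ _ n) (≡.trans (≡.cong (n Q.×_) (coeff-const-* q f n))
    (≡.trans (≡.sym (Q.×-comm-* n q (coeff f n)))
      (≡.sym (≡.trans (coeff-const-* q (θ f) n) (≡.cong (q ℚ.*_) (coeff-θ f n)))))))

  θ-0 : θ 0# ≈ 0#
  θ-0 = +-cancelˡ′ (trans (sym (θ-+ 0# 0#)) (trans (θ-cong (+-identityˡ 0#)) (sym (+-identityʳ _))))
    where
    open import Algebra.Properties.Group +-group using () renaming (∙-cancelˡ to cancel)
    +-cancelˡ′ : θ 0# + θ 0# ≈ θ 0# + 0# → θ 0# ≈ 0#
    +-cancelˡ′ = cancel (θ 0#) _ _

  θ-neg : ∀ f → θ (- f) ≈ - θ f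
  θ-neg f = sym (inverseˡ-unique (θ f) (θ (- f)) (trans (sym (θ-+ f (- f))) (trans (θ-cong (-‿inverseʳ f)) θ-0)))
    where
    inverseˡ-unique : ∀ a b → a + b ≈ 0# → - a ≈ b
    inverseˡ-unique a b eq = begin
      - a             ≈⟨ +-identityʳ _ ⟨
      - a + 0#        ≈⟨ +-congˡ eq ⟨
      - a + (a + b)   ≈⟨ +-assoc _ _ _ ⟨
      - a + a + b     ≈⟨ trans (+-congʳ (-‿inverseˡ a)) (+-identityˡ b) ⟩
      b               ∎

  θ-* : ∀ f g → θ (f * g) ≈ θ f * g + f * θ g
  θ-* f g = coeff-ext (λ n → ≡.trans (coeff-θ (f * g) n) (≡.trans (≡.cong (n Q.×_) (coeff-* f g n))
    (≡.trans (Q.θ-⋆ (coeff f) (coeff g) n)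
      (≡.sym (≡.trans (coeff-+ _ _ n) (≡.cong₂ ℚ._+_
        (≡.trans (coeff-* (θ f) g n) (Q.⋆-cong {coeff (θ f)} {Q.θ (coeff f)} {coeff g} (coeff-θ f) (λ _ → ≡.refl) n))
        (≡.trans (coeff-* f (θ g) n) (Q.⋆-cong {coeff f} {coeff f} {coeff (θ g)} (λ _ → ≡.refl) (coeff-θ g) n))))))))

  θ-1 : θ 1# ≈ 0#
  θ-1 = coeff-ext (λ { zero    → ≡.trans (coeff-θ 1# 0) (≡.sym (coeff-0# 0))
                     ; (suc n) → ≡.trans (coeff-θ 1# (suc n)) (≡.trans (≡.cong (suc n Q.×_) (coeff-1#-suc n))
                         (≡.trans (×-fromℤ (suc n) 0ℚ) (≡.trans (ℚ.*-zeroʳ (fromℤ (+ suc n))) (≡.sym (coeff-0# (suc n)))))) })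

  -- L is the logarithmic derivative x f′ / f.
  θ-^ : ∀ {f L} → f * L ≈ θ f → ∀ n → θ (f ^ n) ≈ const (fromℤ (+ n)) * (L * f ^ n)
  θ-^ {f} {L} eq zero = trans θ-1 (×-const 0 (L * 1#))
  θ-^ {f} {L} eq (suc n) = begin
    θ (f * f ^ n)                                              ≈⟨ θ-* f (f ^ n) ⟩
    θ f * f ^ n + f * θ (f ^ n)                                ≈⟨ +-cong (*-congʳ (sym eq)) (*-congˡ (θ-^ eq n)) ⟩
    f * L * f ^ n + f * (const (fromℤ (+ n)) * (L * f ^ n))
      ≈⟨ solve 4 (λ f l p a → f :* l :* p :+ f :* (a :* (l :* p)) := l :* (f :* p) :+ a :* (l :* (f :* p))) refl f L (f ^ n) (const (fromℤ (+ n))) ⟩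
    L * f ^ suc n + const (fromℤ (+ n)) * (L * f ^ suc n)      ≈⟨ +-congˡ (×-const n _) ⟨
    suc n × (L * f ^ suc n)                                    ≈⟨ ×-const (suc n) _ ⟩
    const (fromℤ (+ suc n)) * (L * f ^ suc n)                  ∎

  -- Apply θ to f · f⁻¹ = 1: passing to the inverse negates the logarithmic derivative.
  θ-inverse : ∀ {f L} → Unital f → f * L ≈ θ f → inverse f * - L ≈ θ (inverse f)
  θ-inverse {f} {L} f₀ eq = *-cancelˡ-unital f₀ (begin
    f * (inverse f * - L)          ≈⟨ solve 3 (λ f i l → f :* (i :* l) := i :* (f :* l)) refl f (inverse f) (- L) ⟩
    inverse f * (f * - L)          ≈⟨ *-congˡ (trans (sym (-‿distribʳ-* f L)) (-‿cong eq)) ⟩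
    inverse f * - θ f              ≈⟨ trans (sym (-‿distribʳ-* _ _)) (-‿cong (*-comm _ _)) ⟩
    - (θ f * inverse f)            ≈⟨ move ⟩
    f * θ (inverse f)              ∎)
    where
    move : - (θ f * inverse f) ≈ f * θ (inverse f)
    move = begin
      - a             ≈⟨ +-identityʳ _ ⟨
      - a + 0#        ≈⟨ +-congˡ (trans (sym (θ-* f (inverse f))) (trans (θ-cong (*-inverseʳ f₀)) θ-1)) ⟨
      - a + (a + b)   ≈⟨ +-assoc _ _ _ ⟨
      - a + a + b     ≈⟨ trans (+-congʳ (-‿inverseˡ a)) (+-identityˡ b) ⟩
      b               ∎
      where a = θ f * inverse f
            b = f * θ (inverse f)

  θ-^ℤ : ∀ {f L} → Unital f → f * L ≈ θ f → ∀ r → θ (f ^ℤ r) ≈ const (fromℤ r) * (L * f ^ℤ r)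
  θ-^ℤ f₀ eq (+ n) = θ-^ eq n
  θ-^ℤ {f} {L} f₀ eq -[1+ n ] = begin
    θ (inverse f ^ suc n)                                   ≈⟨ θ-^ (θ-inverse f₀ eq) (suc n) ⟩
    const (fromℤ (+ suc n)) * (- L * inverse f ^ suc n)     ≈⟨ trans (*-congˡ (sym (-‿distribˡ-* L _))) (sym (-‿distribʳ-* _ _)) ⟩
    - (const (fromℤ (+ suc n)) * (L * inverse f ^ suc n))   ≈⟨ const-neg (fromℤ (+ suc n)) _ ⟨
    const (ℚ.- fromℤ (+ suc n)) * (L * inverse f ^ suc n)   ≡⟨ ≡.cong (λ q → const q * (L * inverse f ^ suc n)) (fromℤ-neg (+ suc n)) ⟨
    const (fromℤ -[1+ n ]) * (L * inverse f ^ suc n)        ∎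

-- Substituting a series without constant term into powers of 1 - x.

module Dilation (𝓡 : PowerSeriesRing) where
  open PowerSeriesRing 𝓡
  open PowerSeries 𝓡
  open CommutativeRing commutativeRing hiding (zero)
  open import Algebra.Definitions.RawSemiring (Semiring.rawSemiring semiring) using (_^_)
  open import Algebra.Properties.Semiring.Sum semiring
  open import Algebra.Properties.Semiring.Exp semiring using (^-congˡ)
  open import Algebra.Properties.Ring ring
  open import Algebra.Solver.Ring.NaturalCoefficients.Default commutativeSemiring using (solve; _:*_; _:+_; _:=_)
  open import Relation.Binary.Reasoning.Setoid setoid
  open Convolution commutativeRing using (sum-snoc; sum-cong)
  open RationalIntegers
  private module Q = Convolution ℚ.+-*-commutativeRing

  ≈[]-refl : ∀ {N f} → f ≈[ N ] f
  ≈[]-refl n _ = ≡.refl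

  sum-≈[] : ∀ {N n} (f g : Fin n → Carrier) → (∀ i → f i ≈[ N ] g i) → sum f ≈[ N ] sum g
  sum-≈[] {n = zero}  f g eq = ≈[]-refl {f = 0#}
  sum-≈[] {n = suc n} f g eq = +-≈[] {f = f zero} {g zero} (eq zero) (sum-≈[] (f ∘ suc) (g ∘ suc) (eq ∘ suc))

  -- Write y f as y g + y (f - g): multiplication by a series without constant term gains one order
  -- of precision.
  *-≈[]-suc : ∀ {N y f g} → coeff y 0 ≡ 0ℚ → f ≈[ N ] g → y * f ≈[ suc N ] y * g
  *-≈[]-suc {N} {y} {f} {g} y₀ f≈g = ≈[]-trans (≈⇒≈[] y*f) (≈[]-trans
    (+-≈[] {f = y * g} ≈[]-refl (*-≈[]0 y₀ f-g≈0)) (≈⇒≈[] (+-identityʳ (y * g))))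
    where
    f-g≈0 : f - g ≈[ N ] 0#
    f-g≈0 = ≈[]-trans (+-≈[] {f = f} {g} { - g} f≈g ≈[]-refl) (≈⇒≈[] (-‿inverseʳ g))
    y*f : y * f ≈ y * g + y * (f - g)
    y*f = begin
      y * f                  ≈⟨ *-congˡ (+-identityʳ f) ⟨
      y * (f + 0#)           ≈⟨ *-congˡ (+-congˡ (-‿inverseʳ g)) ⟨
      y * (f + (g - g))      ≈⟨ solve 4 (λ y f g h → y :* (f :+ (g :+ h)) := y :* g :+ y :* (f :+ h)) refl y f g (- g) ⟩
      y * g + y * (f - g)    ∎

  coeff-x*-suc : ∀ f n → coeff (x * f) (suc n) ≡ coeff f n
  coeff-x*-suc f n = ≡.trans (coeff-* x f (suc n)) (≡.trans
    (≡.cong₂ ℚ._+_ (≡.trans (≡.cong (ℚ._* coeff f (suc n)) coeff-x-0) (ℚ.*-zeroˡ (coeff f (suc n))))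
      (Q.⋆-identityˡ {coeff x ∘ suc} coeff-x-1 coeff-x-2+ (coeff f) n))
    (ℚ.+-identityˡ _))

  coeff-x^-0 : ∀ k → coeff (x ^ suc k) 0 ≡ 0ℚ
  coeff-x^-0 k = ≡.trans (coeff₀-* x (x ^ k)) (≡.trans (≡.cong (ℚ._* coeff (x ^ k) 0) coeff-x-0) (ℚ.*-zeroˡ (coeff (x ^ k) 0)))

  1-y-unital : ∀ {y} → coeff y 0 ≡ 0ℚ → Unital (1# - y)
  1-y-unital y₀ = 1-f₀ y₀

  1-[1-y]≈y : ∀ y → 1# - (1# - y) ≈ y
  1-[1-y]≈y y = begin
    1# - (1# - y)          ≈⟨ +-congˡ (sym (-‿+-comm 1# (- y))) ⟩
    1# + (- 1# + - - y)    ≈⟨ +-assoc _ _ _ ⟨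
    1# - 1# + - - y        ≈⟨ +-cong (-‿inverseʳ 1#) (-‿involutive y) ⟩
    0# + y                 ≈⟨ +-identityˡ y ⟩
    y                      ∎

  inverse-1-y : ∀ {y} → coeff y 0 ≡ 0ℚ → ∀ N → inverse (1# - y) ≈[ N ] geometric y N
  inverse-1-y {y} y₀ N = ≈[]-trans (inverse-≈[]-geometric (1-y-unital y₀) N)
    (≈⇒≈[] (sum-cong {N} (λ k → (1# - (1# - y)) ^ toℕ k) (λ k → y ^ toℕ k) (λ k → ^-congˡ (toℕ k) (1-[1-y]≈y y))))

  coeff-[1-x]*-0 : ∀ f → coeff ((1# - x) * f) 0 ≡ coeff f 0
  coeff-[1-x]*-0 f = ≡.trans (coeff₀-* (1# - x) f) (≡.trans (≡.cong (ℚ._* coeff f 0) (1-y-unital coeff-x-0)) (ℚ.*-identityˡ _))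

  coeff-[1-x]*-suc : ∀ f n → coeff ((1# - x) * f) (suc n) ≡ coeff f (suc n) ℚ.- coeff f n
  coeff-[1-x]*-suc f n = ≡.trans (coeff-cong (trans (distribʳ f 1# (- x)) (+-cong (*-identityˡ f) (sym (-‿distribˡ-* x f)))) (suc n))
    (≡.trans (coeff-+ f (- (x * f)) (suc n)) (≡.cong (coeff f (suc n) ℚ.+_)
      (≡.trans (coeff-neg (x * f) (suc n)) (≡.cong ℚ.-_ (coeff-x*-suc f n)))))

  -- The first N terms of the composite f(y). They determine it modulo x^N when `y` has no constant
  -- term, which is how the coefficients of (1 - x)ʳ are carried over to (1 - xᵏ)ʳ.
  substitute : Carrier → Carrier → ℕ → Carrier
  substitute y f N = sum {N} (λ j → const (coeff f (toℕ j)) * y ^ toℕ j)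

  module _ {y} (y₀ : coeff y 0 ≡ 0ℚ) where

    substitute-cong : ∀ {f g} N → (∀ n → coeff f n ≡ coeff g n) → substitute y f N ≈ substitute y g N
    substitute-cong {f} {g} N eq = sum-cong {N} (λ j → const (coeff f (toℕ j)) * y ^ toℕ j) (λ j → const (coeff g (toℕ j)) * y ^ toℕ j)
      (λ j → *-congʳ (reflexive (≡.cong const (eq (toℕ j)))))

    substitute-1 : ∀ N → substitute y 1# N ≈[ N ] 1#
    substitute-1 zero    n ()
    substitute-1 (suc N) = ≈⇒≈[] (begin
      const (coeff 1# 0) * 1# + sum {N} (λ j → const (coeff 1# (suc (toℕ j))) * (y * y ^ toℕ j))
        ≈⟨ +-cong (trans (*-congʳ (reflexive (≡.cong const coeff-1#-0))) (const-1 1#))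
                  (trans (sum-cong {N} _ (λ _ → 0#) (λ j →
                     trans (*-congʳ (reflexive (≡.cong const (coeff-1#-suc (toℕ j))))) (sym (×-const 0 (y * y ^ toℕ j)))))
                   (sum-replicate-zero N)) ⟩
      1# + 0# ≈⟨ +-identityʳ 1# ⟩
      1# ∎)

    -- Multiplicativity is proved for the factor 1 - x; positive powers follow by induction,
    -- negative ones by cancelling 1 - y.
    substitute-[1-x]* : ∀ f N → substitute y ((1# - x) * f) N ≈[ N ] (1# - y) * substitute y f N
    substitute-[1-x]* f zero    n ()
    substitute-[1-x]* f (suc N) = ≈[]-trans (≈⇒≈[] exact)
      (≈[]-trans (+-≈[] {f = substitute y f (suc N)} ≈[]-refl (-‿≈[] (*-≈[]-suc y₀ truncate))) (≈⇒≈[] (begin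
        S + - (y * S)        ≈⟨ +-cong (sym (*-identityˡ S)) (-‿distribˡ-* y S) ⟩
        1# * S + - y * S     ≈⟨ distribʳ S 1# (- y) ⟨
        (1# - y) * S         ∎)))
      where
      S = substitute y f (suc N)

      truncate : substitute y f N ≈[ N ] S
      truncate = ≈[]-sym (≈[]-trans (≈⇒≈[] (sum-snoc N (λ j → const (coeff f j) * y ^ j)))
        (≈[]-trans (+-≈[] {f = substitute y f N} ≈[]-refl (*-≈[] {f = const (coeff f N)} ≈[]-refl (^-≈[]0 y₀ N)))
          (≈⇒≈[] (trans (+-congˡ (zeroʳ _)) (+-identityʳ _)))))

      -- Multiplication by x shifts the coefficients, so the truncation of x f takes one term fewer
      -- of `f`. The missing term is restored modulo x^(N + 1) by the factor y.
      exact : substitute y ((1# - x) * f) (suc N) ≈ S - y * substitute y f N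
      exact = begin
        const (coeff ((1# - x) * f) 0) * 1# + sum {N} (λ j → const (coeff ((1# - x) * f) (suc (toℕ j))) * (y * y ^ toℕ j))
          ≈⟨ +-cong (*-congʳ (reflexive (≡.cong const (coeff-[1-x]*-0 f)))) (sum-cong {N} _ (λ j → a j + - b j) (λ j → term (toℕ j))) ⟩
        const (coeff f 0) * 1# + sum {N} (λ j → a j + - b j)
          ≈⟨ +-congˡ (∑-distrib-+ {N} a (λ j → - b j)) ⟩
        const (coeff f 0) * 1# + (sum {N} a + sum {N} (λ j → - b j))
          ≈⟨ +-assoc _ _ _ ⟨
        S + sum {N} (λ j → - b j)
          ≈⟨ +-congˡ (trans (sum-cong {N} _ (λ j → - y * (const (coeff f (toℕ j)) * y ^ toℕ j)) (λ j → move (const (coeff f (toℕ j))) (y ^ toℕ j)))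
                            (trans (sym (*-distribˡ-sum {N} (- y) _)) (sym (-‿distribˡ-* y _)))) ⟩
        S - y * substitute y f N ∎
        where
        a b : Fin N → Carrier
        a j = const (coeff f (suc (toℕ j))) * (y * y ^ toℕ j)
        b j = const (coeff f (toℕ j)) * (y * y ^ toℕ j)
        term : ∀ j → const (coeff ((1# - x) * f) (suc j)) * (y * y ^ j)
                     ≈ const (coeff f (suc j)) * (y * y ^ j) + - (const (coeff f j) * (y * y ^ j))
        term j = trans (*-congʳ (reflexive (≡.cong const (coeff-[1-x]*-suc f j))))
          (trans (const-+ _ _ _) (+-congˡ (const-neg _ _)))
        move : ∀ c p → - (c * (y * p)) ≈ - y * (c * p)
        move c p = trans (-‿cong (solve 3 (λ c y p → c :* (y :* p) := y :* (c :* p)) refl c y p)) (-‿distribˡ-* y (c * p))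

    substitute-^ : ∀ n N → substitute y ((1# - x) ^ n) N ≈[ N ] (1# - y) ^ n
    substitute-^ zero    N = substitute-1 N
    substitute-^ (suc n) N = ≈[]-trans (substitute-[1-x]* ((1# - x) ^ n) N) (*-≈[] {f = 1# - y} ≈[]-refl (substitute-^ n N))

    -- After multiplication by 1 - y, the preceding lemma lowers the exponent by one; the factor `w`
    -- then undoes that multiplication.
    substitute-inverse^ : ∀ n N → substitute y (inverse (1# - x) ^ n) N ≈[ N ] inverse (1# - y) ^ n
    substitute-inverse^ zero    N = substitute-1 N
    substitute-inverse^ (suc n) N = ≈[]-trans (≈⇒≈[] cancel) (*-≈[] {f = w} ≈[]-refl
      (≈[]-trans (≈[]-sym (substitute-[1-x]* (v ^ suc n) N)) (≈[]-trans (≈⇒≈[] (substitute-cong N (coeff-cong v^))) (substitute-inverse^ n N))))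
      where
      v = inverse (1# - x)
      w = inverse (1# - y)
      v^ : (1# - x) * (v * v ^ n) ≈ v ^ n
      v^ = trans (sym (*-assoc _ _ _)) (trans (*-congʳ (*-inverseʳ (1-y-unital coeff-x-0))) (*-identityˡ _))
      cancel : substitute y (v ^ suc n) N ≈ w * ((1# - y) * substitute y (v ^ suc n) N)
      cancel = sym (trans (sym (*-assoc _ _ _)) (trans (*-congʳ (trans (*-comm _ _) (*-inverseʳ (1-y-unital y₀)))) (*-identityˡ _)))

    substitute-^ℤ : ∀ r N → substitute y ((1# - x) ^ℤ r) N ≈[ N ] (1# - y) ^ℤ r
    substitute-^ℤ (+ n)    = substitute-^ n
    substitute-^ℤ -[1+ n ] = substitute-inverse^ (suc n)

-- The exponential formula and the stable coefficients.

module Stabilisation (𝓡 : PowerSeriesRing) where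
  open PowerSeriesRing 𝓡
  open PowerSeries 𝓡
  open Dilation 𝓡
  open CommutativeRing commutativeRing hiding (zero)
  open import Algebra.Definitions.RawSemiring (Semiring.rawSemiring semiring) using (_^_; _×_; product)
  open import Algebra.Properties.Semiring.Sum semiring
  open import Algebra.Properties.Semiring.Exp semiring using (^-assocʳ)
  open import Algebra.Properties.Ring ring
  open import Algebra.Solver.Ring.NaturalCoefficients.Default commutativeSemiring using (solve; _:*_; _:+_; _:=_)
  open import Relation.Binary.Reasoning.Setoid setoid
  open RationalIntegers
  private
    module Q where
      open Convolution ℚ.+-*-commutativeRing public
      open import Algebra.Properties.Semiring.Sum (CommutativeRing.semiring ℚ.+-*-commutativeRing) public
      open import Algebra.Definitions.RawSemiring ℚ.+-*-rawSemiring using (_×_) public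
    module Y = Convolution commutativeRing
  open Y using (sum-cong; _⋆_)

  θ-sum : ∀ {n} (f : Fin n → Carrier) → θ (sum f) ≈ sum (θ ∘ f)
  θ-sum {zero}  f = θ-0
  θ-sum {suc n} f = trans (θ-+ _ _) (+-congˡ (θ-sum (f ∘ suc)))

  θ-× : ∀ n f → θ (n × f) ≈ n × θ f
  θ-× n f = trans (θ-cong (×-const n f)) (trans (θ-const-* _ f) (sym (×-const n (θ f))))

  θ-⋆ : ∀ f g n → θ ((f ⋆ g) n) ≈ ((θ ∘ f) ⋆ g) n + (f ⋆ (θ ∘ g)) n
  θ-⋆ f g n = begin
    θ (sum (Y.term f g n))                                        ≈⟨ θ-sum (Y.term f g n) ⟩
    sum (λ i → θ (Y.term f g n i))
      ≈⟨ sum-cong (λ i → θ (Y.term f g n i)) (λ i → Y.term (θ ∘ f) g n i + Y.term f (θ ∘ g) n i) (λ i → θ-* (f (toℕ i)) (g (n ∸ toℕ i))) ⟩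
    sum (λ i → Y.term (θ ∘ f) g n i + Y.term f (θ ∘ g) n i)       ≈⟨ ∑-distrib-+ (Y.term (θ ∘ f) g n) (Y.term f (θ ∘ g) n) ⟩
    ((θ ∘ f) ⋆ g) n + (f ⋆ (θ ∘ g)) n                             ∎

  -- For generating functions in y: if T = exp F with P = y ∂F/∂y, then x ∂T/∂x = E T with
  -- E = x ∂F/∂x, and E is characterised by y ∂E/∂y = x ∂P/∂x.
  θ-exp : ∀ (P E t : ℕ → Carrier) → P 0 ≈ 0# → E 0 ≈ 0# → t 0 ≈ 1# →
          (∀ n → n × t n ≈ (P ⋆ t) n) → (∀ n → n × E n ≈ θ (P n)) → ∀ n → θ (t n) ≈ (E ⋆ t) n
  θ-exp P E t P₀ E₀ t₀ Dt DE =
    -- With D = y ∂/∂y, both sides solve D u = (θ P) T + P u, so they agree once their initial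
    -- values do.
    Y.θ-unique ×-cancelˡ ((θ ∘ P) ⋆ t) P P₀ initial
      (λ n → begin
        n × θ (t n)                                 ≈⟨ θ-× n (t n) ⟨
        θ (n × t n)                                 ≈⟨ θ-cong (Dt n) ⟩
        θ ((P ⋆ t) n)                               ≈⟨ θ-⋆ P t n ⟩
        ((θ ∘ P) ⋆ t) n + (P ⋆ (θ ∘ t)) n           ∎)
      (λ n → begin
        n × (E ⋆ t) n                               ≈⟨ Y.θ-⋆ E t n ⟩
        (Y.θ E ⋆ t) n + (E ⋆ Y.θ t) n               ≈⟨ +-cong (Y.⋆-cong {Y.θ E} {θ ∘ P} {t} DE (λ _ → refl) n) (Y.⋆-cong {E} {E} {Y.θ t} {P ⋆ t} (λ _ → refl) Dt n) ⟩
        ((θ ∘ P) ⋆ t) n + (E ⋆ (P ⋆ t)) n           ≈⟨ +-congˡ (Y.⋆-assoc E P t n) ⟨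
        ((θ ∘ P) ⋆ t) n + ((E ⋆ P) ⋆ t) n           ≈⟨ +-congˡ (Y.⋆-cong {E ⋆ P} {P ⋆ E} {t} (Y.⋆-comm E P) (λ _ → refl) n) ⟩
        ((θ ∘ P) ⋆ t) n + ((P ⋆ E) ⋆ t) n           ≈⟨ +-congˡ (Y.⋆-assoc P E t n) ⟩
        ((θ ∘ P) ⋆ t) n + (P ⋆ (E ⋆ t)) n           ∎)
    where
    initial : θ (t 0) ≈ (E ⋆ t) 0
    initial = trans (trans (θ-cong t₀) θ-1) (sym (trans (+-identityʳ _) (trans (*-congʳ E₀) (zeroˡ _))))

  θ-product : ∀ {n} (l f : Fin n → Carrier) → (∀ i → θ (f i) ≈ l i * f i) → θ (product f) ≈ sum l * product f
  θ-product {zero}  l f eq = trans θ-1 (sym (zeroˡ _))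
  θ-product {suc n} l f eq = begin
    θ (f zero * p)                                      ≈⟨ θ-* (f zero) p ⟩
    θ (f zero) * p + f zero * θ p                       ≈⟨ +-cong (*-congʳ (eq zero)) (*-congˡ (θ-product (l ∘ suc) (f ∘ suc) (eq ∘ suc))) ⟩
    l zero * f zero * p + f zero * (sum (l ∘ suc) * p)
      ≈⟨ solve 4 (λ a f p s → a :* f :* p :+ f :* (s :* p) := (a :+ s) :* (f :* p)) refl (l zero) (f zero) p (sum (l ∘ suc)) ⟩
    (l zero + sum (l ∘ suc)) * (f zero * p)             ∎
    where p = product (f ∘ suc)

  product-unital : ∀ {n} (f : Fin n → Carrier) → (∀ i → Unital (f i)) → Unital (product f)
  product-unital {zero}  f f₀ = coeff-1#-0
  product-unital {suc n} f f₀ = *-unital (f₀ zero) (product-unital (f ∘ suc) (f₀ ∘ suc))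

  θ-x : θ x ≈ x
  θ-x = coeff-ext λ where
    zero          → ≡.trans (coeff-θ x 0) (≡.sym coeff-x-0)
    (suc zero)    → ≡.trans (coeff-θ x 1) (ℚ.+-identityʳ _)
    (suc (suc n)) → ≡.trans (coeff-θ x (2 ℕ.+ n)) (≡.trans (≡.cong ((2 ℕ.+ n) Q.×_) (coeff-x-2+ n))
      (≡.trans (×-fromℤ (2 ℕ.+ n) 0ℚ) (≡.trans (ℚ.*-zeroʳ (fromℤ (+ (2 ℕ.+ n)))) (≡.sym (coeff-x-2+ n)))))

  θ-x^ : ∀ n → θ (x ^ n) ≈ const (fromℤ (+ n)) * x ^ n
  θ-x^ n = trans (θ-^ (trans (*-identityʳ x) (sym θ-x)) n) (*-congˡ (*-identityˡ _))

  θ-[1-x^] : ∀ k → (1# - x ^ suc k) * - (const (fromℤ (+ suc k)) * (x ^ suc k * inverse (1# - x ^ suc k))) ≈ θ (1# - x ^ suc k)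
  θ-[1-x^] k = begin
    u * - (c * (y * inverse u))   ≈⟨ -‿distribʳ-* u _ ⟨
    - (u * (c * (y * inverse u))) ≈⟨ -‿cong (solve 4 (λ u c y i → u :* (c :* (y :* i)) := c :* y :* (u :* i)) refl u c y (inverse u)) ⟩
    - (c * y * (u * inverse u))   ≈⟨ -‿cong (trans (*-congˡ (*-inverseʳ (1-y-unital (coeff-x^-0 k)))) (*-identityʳ _)) ⟩
    - (c * y)                     ≈⟨ -‿cong (θ-x^ (suc k)) ⟨
    - θ y                         ≈⟨ trans (+-cong θ-1 (θ-neg y)) (+-identityˡ _) ⟨
    θ 1# + θ (- y)                ≈⟨ θ-+ 1# (- y) ⟨
    θ u                           ∎
    where
    y = x ^ suc k
    u = 1# - y
    c = const (fromℤ (+ suc k))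

  module _ (r : ℤ) (b : ℕ → ℤ) (coeff-b : ∀ k → coeff ((1# - x) ^ℤ r) k ≡ fromℤ (b k))
           (t : ℕ → Carrier) (t₀ : t 0 ≈ 1#)
           (t-suc : ∀ n → suc n × t (suc n) ≈ ((λ k → (1# - x ^ suc k) ^ℤ r) ⋆ t) n) where

    private
      p : ℕ → Carrier
      p k = (1# - x ^ suc k) ^ℤ r

      β : ℕ → ℚ
      β j = coeff ((1# - x) ^ℤ r) j

      reciprocal : ℕ → ℚ
      reciprocal k = ℚ.1/_ (fromℤ (+ suc k)) {{ℚ.≢-nonZero (fromℤ-suc≢0 k)}}

      -- If exp F is the series in y with coefficients `t`, these are the coefficients of y ∂F/∂y
      -- and x ∂F/∂x.
      P E : ℕ → Carrier
      P zero    = 0#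
      P (suc k) = p k
      E zero    = 0#
      E (suc k) = const (reciprocal k) * θ (p k)

      -- The exponent is Σ β j (xᵏ)ʲ yᵏ / k, and term j k is x ∂/∂x of its (j, k) summand at y = 1.
      term : ℕ → ℕ → Carrier
      term j k = const (β j) * (const (fromℤ (+ j)) * (x ^ k) ^ j)

      G : ℕ → Carrier
      G K = product {K} (λ i → (1# - x ^ suc (toℕ i)) ^ℤ (ℤ.- b (suc (toℕ i))))

    reciprocal-* : ∀ k f → const (reciprocal k) * (const (fromℤ (+ suc k)) * f) ≈ f
    reciprocal-* k f = trans (sym (const-* _ _ f)) (trans
      (*-congʳ (reflexive (≡.cong const (ℚ.*-inverseˡ (fromℤ (+ suc k)) {{ℚ.≢-nonZero (fromℤ-suc≢0 k)}})))) (const-1 f))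

    E-P : ∀ n → n × E n ≈ θ (P n)
    E-P zero    = sym θ-0
    E-P (suc k) = trans (×-const (suc k) _) (trans
      (solve 3 (λ a b f → a :* (b :* f) := b :* (a :* f)) refl _ _ _) (reciprocal-* k (θ (p k))))

    P-t : ∀ n → n × t n ≈ (P ⋆ t) n
    P-t zero    = sym (trans (+-identityʳ _) (zeroˡ (t 0)))
    P-t (suc n) = trans (t-suc n) (sym (trans (+-congʳ (zeroˡ (t (suc n)))) (+-identityˡ _)))

    θ-t : ∀ n → θ (t n) ≈ (E ⋆ t) n
    θ-t = θ-exp P E t refl refl t₀ P-t E-P

    -- Substituting x^(k + 1) into (1 - x)ʳ expands `p k`; θ multiplies the j-th term by j (k + 1),
    -- and the reciprocal removes k + 1.
    E-≈[] : ∀ k K → E (suc k) ≈[ suc K ] sum {K} (λ j → term (suc (toℕ j)) (suc k))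
    E-≈[] k K = ≈[]-trans (*-≈[] {f = const (reciprocal k)} ≈[]-refl
        (θ-≈[] (≈[]-sym (substitute-^ℤ (coeff-x^-0 k) r (suc K))))) (≈⇒≈[] (begin
      ρ * θ (substitute y ((1# - x) ^ℤ r) (suc K))
        ≈⟨ *-congˡ (θ-sum {suc K} (λ j → const (β (toℕ j)) * y ^ toℕ j)) ⟩
      ρ * sum {suc K} (λ j → θ (const (β (toℕ j)) * y ^ toℕ j))
        ≈⟨ *-distribˡ-sum {suc K} ρ (λ j → θ (const (β (toℕ j)) * y ^ toℕ j)) ⟩
      sum {suc K} (λ j → ρ * θ (const (β (toℕ j)) * y ^ toℕ j))
        ≈⟨ sum-cong {suc K} (λ j → ρ * θ (const (β (toℕ j)) * y ^ toℕ j)) (λ j → term (toℕ j) (suc k)) (λ j → each (toℕ j)) ⟩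
      term 0 (suc k) + sum {K} (λ j → term (suc (toℕ j)) (suc k))
        -- The term j = 0, which produces the pole at y = 1, is annihilated by ∂/∂x.
        ≈⟨ +-congʳ (trans (*-congˡ (sym (×-const 0 1#))) (zeroʳ _)) ⟩
      0# + sum {K} (λ j → term (suc (toℕ j)) (suc k))
        ≈⟨ +-identityˡ _ ⟩
      sum {K} (λ j → term (suc (toℕ j)) (suc k)) ∎))
      where
      y = x ^ suc k
      ρ = const (reciprocal k)
      c = const (fromℤ (+ suc k))

      each : ∀ j → ρ * θ (const (β j) * y ^ j) ≈ term j (suc k)
      each j = begin
        ρ * θ (const (β j) * y ^ j)
          ≈⟨ *-congˡ (trans (θ-const-* (β j) (y ^ j)) (*-congˡ (θ-^ (trans (*-comm y c) (sym (θ-x^ (suc k)))) j))) ⟩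
        ρ * (const (β j) * (const (fromℤ (+ j)) * (c * y ^ j)))
          ≈⟨ solve 5 (λ ρ b n c z → ρ :* (b :* (n :* (c :* z))) := ρ :* (c :* (b :* (n :* z)))) refl ρ (const (β j)) (const (fromℤ (+ j))) c (y ^ j) ⟩
        ρ * (c * (const (β j) * (const (fromℤ (+ j)) * y ^ j)))
          ≈⟨ reciprocal-* k _ ⟩
        term j (suc k) ∎

    -- Every remaining term has j at least 1, hence is divisible by xᵏ. So only finitely many `E k`
    -- reach a given coefficient, which is why the coefficients of `t n` become constant.
    E-≈[]0 : ∀ k → E k ≈[ k ] 0#
    E-≈[]0 zero    n ()
    E-≈[]0 (suc k) = ≈[]-trans (E-≈[] k k) (≈[]-trans
      (sum-≈[] {n = k} (λ j → term (suc (toℕ j)) (suc k)) (λ _ → 0#) (λ j → ≈[]-trans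
        (*-≈[] {f = const (β (suc (toℕ j)))} ≈[]-refl (*-≈[] {f = const (fromℤ (+ suc (toℕ j)))} ≈[]-refl
          (*-≈[] {g = y ^ toℕ j} (^-≈[]0 coeff-x-0 (suc k)) ≈[]-refl)))
        (≈⇒≈[] (trans (*-congˡ (trans (*-congˡ (zeroˡ _)) (zeroʳ _))) (zeroʳ _)))))
      (≈⇒≈[] (sum-replicate-zero k)))
      where y = x ^ suc k

    g : ℕ → Carrier
    g j = x ^ suc j * inverse (1# - x ^ suc j)

    -- The logarithmic derivative of the factor of index j + 1 in `G`: the sign from 1 - x^(j + 1)
    -- and that of the exponent cancel.
    Λ : ℕ → Carrier
    Λ j = const (β (suc j)) * (const (fromℤ (+ suc j)) * g j)

    θ-factor : ∀ j → θ ((1# - x ^ suc j) ^ℤ (ℤ.- b (suc j))) ≈ Λ j * (1# - x ^ suc j) ^ℤ (ℤ.- b (suc j))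
    θ-factor j = begin
      θ F                                                     ≈⟨ θ-^ℤ (1-y-unital (coeff-x^-0 j)) (θ-[1-x^] j) (ℤ.- b (suc j)) ⟩
      const (fromℤ (ℤ.- b (suc j))) * (- (c * g j) * F)       ≡⟨ ≡.cong (λ q → const q * (- (c * g j) * F)) (≡.trans (fromℤ-neg (b (suc j))) (≡.cong ℚ.-_ (≡.sym (coeff-b (suc j))))) ⟩
      const (ℚ.- β (suc j)) * (- (c * g j) * F)               ≈⟨ const-neg (β (suc j)) _ ⟩
      - (const (β (suc j)) * (- (c * g j) * F))               ≈⟨ -‿cong (trans (*-congˡ (sym (-‿distribˡ-* _ F))) (sym (-‿distribʳ-* _ _))) ⟩
      - - (const (β (suc j)) * ((c * g j) * F))               ≈⟨ -‿involutive _ ⟩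
      const (β (suc j)) * ((c * g j) * F)                     ≈⟨ *-assoc _ _ _ ⟨
      Λ j * F                                                 ∎
      where
      F = (1# - x ^ suc j) ^ℤ (ℤ.- b (suc j))
      c = const (fromℤ (+ suc j))

    Λ-≈[] : ∀ j n → Λ j ≈[ suc n ] sum {n} (λ k → term (suc j) (suc (toℕ k)))
    Λ-≈[] j n = ≈[]-trans (*-≈[] {f = const (β (suc j))} ≈[]-refl (*-≈[] {f = c} ≈[]-refl
        (*-≈[]-suc (coeff-x^-0 j) (inverse-1-y (coeff-x^-0 j) n)))) (≈⇒≈[] (begin
      const (β (suc j)) * (c * (y * geometric y n))
        ≈⟨ solve 4 (λ b c y g → b :* (c :* (y :* g)) := b :* c :* y :* g) refl (const (β (suc j))) c y (geometric y n) ⟩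
      const (β (suc j)) * c * y * geometric y n
        ≈⟨ *-distribˡ-sum {n} (const (β (suc j)) * c * y) (λ k → y ^ toℕ k) ⟩
      sum {n} (λ k → const (β (suc j)) * c * y * y ^ toℕ k)
        ≈⟨ sum-cong {n} (λ k → const (β (suc j)) * c * y * y ^ toℕ k) (λ k → term (suc j) (suc (toℕ k))) (λ k → each (toℕ k)) ⟩
      sum {n} (λ k → term (suc j) (suc (toℕ k))) ∎))
      where
      y = x ^ suc j
      c = const (fromℤ (+ suc j))
      each : ∀ k → const (β (suc j)) * c * y * y ^ k ≈ term (suc j) (suc k)
      each k = trans (solve 4 (λ b c y z → b :* c :* y :* z := b :* (c :* (y :* z))) refl (const (β (suc j))) c y (y ^ k))
        (*-congˡ (*-congˡ (begin
          (x ^ suc j) ^ suc k     ≈⟨ ^-assocʳ x (suc j) (suc k) ⟩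
          x ^ (suc j ℕ.* suc k)   ≡⟨ ≡.cong (x ^_) (ℕ.*-comm (suc j) (suc k)) ⟩
          x ^ (suc k ℕ.* suc j)   ≈⟨ ^-assocʳ x (suc k) (suc j) ⟨
          (x ^ suc k) ^ suc j     ∎)))

    -- Both sides truncate the double sum of `term j k` over positive j and k, one summing over j
    -- inside and the other over k; terms with an index beyond m have order beyond m.
    ∑E-≈[]-∑Λ : ∀ m n K → m ≤ n → m ≤ K → sum {n} (λ k → E (suc (toℕ k))) ≈[ suc m ] sum {K} (λ j → Λ (toℕ j))
    ∑E-≈[]-∑Λ m n K m≤n m≤K = ≈[]-trans
      (sum-≈[] {n = n} (λ k → E (suc (toℕ k))) (λ k → sum {K} (λ j → term (suc (toℕ j)) (suc (toℕ k))))
        (λ k i i≤m → E-≈[] (toℕ k) K i (ℕ.<-≤-trans i≤m (s≤s m≤K))))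
      (≈[]-trans (≈⇒≈[] (∑-comm {n} {K} (λ k j → term (suc (toℕ j)) (suc (toℕ k)))))
      (≈[]-sym (sum-≈[] {n = K} (λ j → Λ (toℕ j)) (λ j → sum {n} (λ k → term (suc (toℕ j)) (suc (toℕ k))))
        (λ j i i≤m → Λ-≈[] (toℕ j) n i (ℕ.<-≤-trans i≤m (s≤s m≤n))))))

    -- At x = 0 the recurrence reads (n + 1) t (n + 1) = t 0 + ... + t n, whose solution with
    -- initial value 1 is constant. This is the base case of `t≡G`.
    t-unital : ∀ n → Unital (t n)
    t-unital = <-rec _ step
      where
      step : ∀ n → (∀ {m} → m < n → Unital (t m)) → Unital (t n)
      step zero    _  = unital-cong (sym t₀) coeff-1#-0
      step (suc n) ih = ×-cancel n (
        ≡.trans (≡.sym (coeff-× (suc n) (t (suc n)) 0))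
        (≡.trans (coeff-cong (t-suc n) 0)
        (≡.trans (coeff-sum (Y.term p t n) 0)
        (≡.trans (Q.sum-cong-≗ {suc n} (λ i → *-unital {p (toℕ i)} {t (n ∸ toℕ i)}
                   (^ℤ-unital (1-y-unital (coeff-x^-0 (toℕ i))) r) (ih (s≤s (ℕ.m∸n≤m n (toℕ i))))))
        (Q.sum-replicate (suc n) {1ℚ})))))

    -- Compare θ (t n) = (E ⋆ t) n with θ (G K) = (sum of Λ) · G K at index m. By induction every t
    -- (n - k) in the convolution may be replaced by G K, which leaves the sum of the E k as a
    -- factor, and this agrees with the sum of the Λ j to the required order.
    t≡G : ∀ m n K → m ≤ n → m ≤ K → coeff (t n) m ≡ coeff (G K) m
    t≡G = <-rec _ step
      where
      step : ∀ m → (∀ {m′} → m′ < m → ∀ n K → m′ ≤ n → m′ ≤ K → coeff (t n) m′ ≡ coeff (G K) m′) →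
             ∀ n K → m ≤ n → m ≤ K → coeff (t n) m ≡ coeff (G K) m
      step zero    _  n K _ _ = ≡.trans (t-unital n) (≡.sym (product-unital {K} _
        (λ i → ^ℤ-unital (1-y-unital (coeff-x^-0 (toℕ i))) (ℤ.- b (suc (toℕ i))))))
      step (suc m) ih n K m≤n m≤K = ×-cancel m (
        ≡.trans (≡.sym (coeff-θ (t n) (suc m)))
        (≡.trans (coeff-cong (θ-t n) (suc m))
        (≡.trans (coeff-sum (Y.term E t n) (suc m))
        (≡.trans (Q.sum-cong-≗ {suc n} (λ k → E*t (toℕ k)))
        (≡.trans (≡.sym (coeff-sum (λ (k : Fin (suc n)) → E (toℕ k) * G K) (suc m)))
        (≡.trans (coeff-cong (trans (sym (*-distribʳ-sum {suc n} (G K) (E ∘ toℕ))) (*-congʳ (+-identityˡ _))) (suc m))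
        (≡.trans (*-≈[] {g = G K} (∑E-≈[]-∑Λ (suc m) n K m≤n m≤K) ≈[]-refl (suc m) (ℕ.n<1+n (suc m)))
        (≡.trans (coeff-cong (sym (θ-product {K} (λ j → Λ (toℕ j)) _ (λ j → θ-factor (toℕ j)))) (suc m))
        (coeff-θ (G K) (suc m))))))))))
        where
        E*t : ∀ k → coeff (E k * t (n ∸ k)) (suc m) ≡ coeff (E k * G K) (suc m)
        E*t k = ≡.trans (coeff-* (E k) (t (n ∸ k)) (suc m)) (≡.trans
          (Q.sum-cong (Q.term (coeff (E k)) (coeff (t (n ∸ k))) (suc m)) (Q.term (coeff (E k)) (coeff (G K)) (suc m))
            (λ i → each (toℕ i)))
          (≡.sym (coeff-* (E k) (G K) (suc m))))
          where
          vanish : ∀ {a} → a ≡ 0ℚ → ∀ u v → a ℚ.* u ≡ a ℚ.* v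
          vanish ≡.refl u v = ≡.trans (ℚ.*-zeroˡ u) (≡.sym (ℚ.*-zeroˡ v))

          -- Since i ≥ k ≥ 1, the index m + 1 - i is at most m, so the induction hypothesis applies,
          -- and it is at most n - k, so t (n - k) is already stable there.
          aligned : ∀ k i → k ≤ i → coeff (E k) i ℚ.* coeff (t (n ∸ k)) (suc m ∸ i) ≡ coeff (E k) i ℚ.* coeff (G K) (suc m ∸ i)
          aligned zero    i       _   = vanish (coeff-0# i) _ _
          aligned (suc k) (suc i) k≤i = ≡.cong (coeff (E (suc k)) (suc i) ℚ.*_) (ih (s≤s (ℕ.m∸n≤m m i)) (n ∸ suc k) K
            (ℕ.∸-mono m≤n k≤i) (ℕ.≤-trans (ℕ.m∸n≤m m i) (ℕ.≤-trans (ℕ.n≤1+n m) m≤K)))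

          each : ∀ i → coeff (E k) i ℚ.* coeff (t (n ∸ k)) (suc m ∸ i) ≡ coeff (E k) i ℚ.* coeff (G K) (suc m ∸ i)
          each i with i ℕ.<? k
          ... | yes i<k = vanish (≡.trans (E-≈[]0 k i i<k) (coeff-0# i)) _ _
          ... | no  i≮k = aligned k i (ℕ.≮⇒≥ i≮k)

-- Weighted sums over permutations and the recurrence for their averages.

module CycleWeights (𝓡 : PowerSeriesRing) (r : ℤ) where
  open PowerSeriesRing 𝓡
  open PowerSeries 𝓡
  open Dilation 𝓡
  open CommutativeRing commutativeRing hiding (zero)
  open Defs.Determinant rawRing
  open import Algebra.Definitions.RawSemiring (Semiring.rawSemiring semiring) using (_^_; _×_)
  open import Algebra.Properties.Semiring.Sum semiring
  open import Algebra.Properties.Semiring.Exp semiring using (^-homo-*)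
  open import Algebra.Properties.Semiring.Mult semiring using (×-congʳ; ×-assocˡ; ×-comm-*)
  open import Algebra.Properties.CommutativeMonoid.Mult +-commutativeMonoid using (×-distrib-+)
  open import Algebra.Properties.CommutativeSemigroup +-commutativeSemigroup using (x∙yz≈y∙xz)
  open import Algebra.Solver.Ring.NaturalCoefficients.Default commutativeSemiring using (solve; _:*_; _:+_; _:=_)
  open import Relation.Binary.Reasoning.Setoid setoid
  open ListSum semiring
  open SymmetricGroup commutativeRing
  open DeterminantProperties commutativeRing
  open WeightedPermutationMatrix commutativeRing using (1-_M_; δ; det-fixedPoint; det-contract)
  open Convolution commutativeRing using (_⋆_; ⋆-cong)

  -- Exponents are stored less one, so that every weight has zero constant term; merging the stored
  -- values a and b therefore yields a + b + 1.
  weight : ∀ {n} → Vec ℕ n → Fin n → Carrier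
  weight v i = x ^ suc (lookup v i)

  merge : ∀ {n} → Fin n → ℕ → Vec ℕ n → Vec ℕ n
  merge j a v = updateAt v j (λ b → suc (a ℕ.+ b))

  D : ∀ {n} → Vec ℕ n → Permutation′ n → Carrier
  D v σ = det (1- weight v M σ)

  D-cong : ∀ {n} (v : Vec ℕ n) σ τ → σ Perm.≈ τ → D v σ ≈ D v τ
  D-cong v σ τ eq = det-cong (λ i k → reflexive (≡.cong (λ z → δ i k - weight v i * δ i z) (eq k)))

  D-fixedPoint : ∀ {n} a (v : Vec ℕ n) π → D (a ∷ v) (insert zero zero π) ≈ (1# - x ^ suc a) * D v π
  D-fixedPoint a v π = det-fixedPoint (weight (a ∷ v)) π

  D-merge : ∀ {n} a (v : Vec ℕ (suc n)) j π → D (a ∷ v) (insert zero (suc j) π) ≈ D (merge j a v) (π ∘ₚ ρ j)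
  D-merge a v j π = det-contract (weight (a ∷ v)) (weight (merge j a v)) j π
    (trans (reflexive (≡.cong (λ m → x ^ suc m) (≡.trans (Vec.lookup∘updateAt j v) (≡.sym (ℕ.+-suc a (lookup v j))))))
           (^-homo-* x (suc a) (suc (lookup v j))))
    (λ i i≢j → reflexive (≡.cong (λ m → x ^ suc m) (Vec.lookup∘updateAt′ i j i≢j v)))

  D-[] : ∀ σ → D [] σ ≈ 1#
  D-[] σ = trans (+-identityʳ _) (*-identityˡ 1#)

  -- Powers with negative exponent behave well only for constant term 1. This is obtained by
  -- deleting zero, in the fixed and the contracted case alike, down to the empty determinant.
  D-unital : ∀ {n} (v : Vec ℕ n) σ → Unital (D v σ)
  D-insert-unital : ∀ {n} a (v : Vec ℕ n) j π → Unital (D (a ∷ v) (insert zero j π))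

  D-unital []      σ = unital-cong (sym (D-[] σ)) coeff-1#-0
  D-unital (a ∷ v) σ = unital-cong (D-cong (a ∷ v) (insert zero (σ ⟨$⟩ʳ zero) (remove zero σ)) σ (Perm.insert-remove zero σ))
    (D-insert-unital a v (σ ⟨$⟩ʳ zero) (remove zero σ))

  D-insert-unital a v zero π = unital-cong (sym (D-fixedPoint a v π))
    (*-unital (1-y-unital (coeff-x^-0 a)) (D-unital v π))
  D-insert-unital {suc n} a v (suc j) π = unital-cong (sym (D-merge a v j π)) (D-unital (merge j a v) (π ∘ₚ ρ j))

  T : ∀ {n} → Vec ℕ n → Carrier
  T {n} v = ∑S n (λ σ → D v σ ^ℤ r)

  q : ℕ → Carrier
  q a = (1# - x ^ suc a) ^ℤ r

  mergeSum : ∀ {n} → (Vec ℕ n → Carrier) → ℕ → Vec ℕ n → Carrier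
  mergeSum {n} F a v = ∑[ j < n ] F (merge j a v)

  T-extensional : ∀ {n} (v : Vec ℕ n) → Extensional (λ σ → D v σ ^ℤ r)
  T-extensional v σ τ eq = ^ℤ-cong (D-unital v σ) (D-cong v σ τ eq) r

  -- The sum is split by the image of zero. If zero is fixed, its factor leaves; if it is sent to
  -- `suc j`, contraction merges the weights, and the extra cycle `ρ j` is absorbed by translating
  -- the sum.
  T-∷ : ∀ {n} a (v : Vec ℕ n) → T (a ∷ v) ≈ q a * T v + mergeSum T a v
  T-∷ {n} a v = begin
    T (a ∷ v)
      ≈⟨ ∑S-suc n (λ σ → D (a ∷ v) σ ^ℤ r) ⟩
    ∑S n (λ π → D (a ∷ v) (insert zero zero π) ^ℤ r) + ∑[ j < n ] ∑S n (λ π → D (a ∷ v) (insert zero (suc j) π) ^ℤ r)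
      ≈⟨ +-cong fixedPoint (sum-cong-≋ {n} (contract v)) ⟩
    q a * T v + mergeSum T a v ∎
    where
    fixedPoint : ∑S n (λ π → D (a ∷ v) (insert zero zero π) ^ℤ r) ≈ q a * T v
    fixedPoint = trans
      (∑S-cong n (λ π → trans (^ℤ-cong (D-insert-unital a v zero π) (D-fixedPoint a v π) r)
                              (^ℤ-distrib-* (1-y-unital (coeff-x^-0 a)) (D-unital v π) r)))
      (sym (*-distribˡ-∑L (q a) (Defs.permutations n) (λ σ → D v σ ^ℤ r)))

    contract : ∀ {n} (v : Vec ℕ n) j → ∑S n (λ π → D (a ∷ v) (insert zero (suc j) π) ^ℤ r) ≈ T (merge j a v)
    contract {suc n} v j = trans
      (∑S-cong (suc n) (λ π → ^ℤ-cong (D-insert-unital a v (suc j) π) (D-merge a v j π) r))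
      (∑S-translate (suc n) (ρ j) {λ σ → D (merge j a v) σ ^ℤ r} (T-extensional (merge j a v)))

  -- Interchanges of adjacent entries. They generate all rearrangements, so invariance under them is
  -- symmetry.
  data _∼_ : ∀ {n} → Vec ℕ n → Vec ℕ n → Set where
    swap : ∀ {n} a b (v : Vec ℕ n) → (a ∷ b ∷ v) ∼ (b ∷ a ∷ v)
    prep : ∀ {n} a {v w : Vec ℕ n} → v ∼ w → (a ∷ v) ∼ (a ∷ w)

  Symmetric : ∀ {n} → (Vec ℕ n → Carrier) → Set
  Symmetric F = ∀ {v w} → v ∼ w → F v ≈ F w

  -- Interchanging two entries of the vector exchanges the two summands that merge into them and
  -- rearranges the vector in each of the others.
  mergeSum-symmetric : ∀ {n} {F : Vec ℕ n → Carrier} a → Symmetric F → Symmetric (mergeSum F a)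
  mergeSum-symmetric {F = F} a F-sym (swap {n} b c v) = begin
    F (suc (a ℕ.+ b) ∷ c ∷ v) + (F (b ∷ suc (a ℕ.+ c) ∷ v) + ∑[ j < n ] F (b ∷ c ∷ merge j a v))
      ≈⟨ +-cong (F-sym (swap _ c v)) (+-cong (F-sym (swap b _ v)) (sum-cong-≋ {n} (λ j → F-sym (swap b c (merge j a v))))) ⟩
    F (c ∷ suc (a ℕ.+ b) ∷ v) + (F (suc (a ℕ.+ c) ∷ b ∷ v) + ∑[ j < n ] F (c ∷ b ∷ merge j a v))
      ≈⟨ x∙yz≈y∙xz _ _ _ ⟩
    F (suc (a ℕ.+ c) ∷ b ∷ v) + (F (c ∷ suc (a ℕ.+ b) ∷ v) + ∑[ j < n ] F (c ∷ b ∷ merge j a v)) ∎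
  mergeSum-symmetric {F = F} a F-sym (prep b p) =
    +-cong (F-sym (prep _ p)) (mergeSum-symmetric {F = F ∘ (b ∷_)} a (λ p → F-sym (prep b p)) p)

  merge-comm : ∀ {n} i j a b (v : Vec ℕ n) → merge i a (merge j b v) ≡ merge j b (merge i a v)
  merge-comm zero    zero    a b (c ∷ v) = ≡.cong (λ d → suc d ∷ v)
    (≡.trans (ℕ.+-suc a (b ℕ.+ c)) (≡.trans (≡.cong suc (x∙yz≡y∙xz a b c)) (≡.sym (ℕ.+-suc b (a ℕ.+ c)))))
    where open import Algebra.Properties.CommutativeSemigroup ℕ.+-commutativeSemigroup renaming (x∙yz≈y∙xz to x∙yz≡y∙xz)
  merge-comm zero    (suc j) a b (c ∷ v) = ≡.refl
  merge-comm (suc i) zero    a b (c ∷ v) = ≡.refl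
  merge-comm (suc i) (suc j) a b (c ∷ v) = ≡.cong (c ∷_) (merge-comm i j a b v)

  -- Expanding twice gives a form visibly symmetric in `a` and `b`: both are fixed, one is fixed and
  -- the other merged into `v`, the two are merged together, or both are merged into `v`.
  T-∷∷ : ∀ {n} a b (v : Vec ℕ n) → T (a ∷ b ∷ v) ≈
         q a * q b * T v + (q a * mergeSum T b v + q b * mergeSum T a v) + T (suc (a ℕ.+ b) ∷ v) +
         ∑[ j < n ] ∑[ i < n ] T (merge i b (merge j a v))
  T-∷∷ {n} a b v = begin
    T (a ∷ b ∷ v)
      ≈⟨ T-∷ a (b ∷ v) ⟩
    q a * T (b ∷ v) + (M + ∑[ j < n ] T (b ∷ merge j a v))
      ≈⟨ +-cong (*-congˡ (T-∷ b v)) (+-congˡ (sum-cong-≋ {n} (λ j → T-∷ b (merge j a v)))) ⟩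
    q a * (q b * T v + mergeSum T b v) + (M + ∑[ j < n ] (q b * T (merge j a v) + mergeSum T b (merge j a v)))
      ≈⟨ +-congˡ (+-congˡ (trans (∑-distrib-+ {n} (λ j → q b * T (merge j a v)) (λ j → mergeSum T b (merge j a v)))
                                 (+-congʳ (sym (*-distribˡ-sum {n} (q b) (λ j → T (merge j a v))))))) ⟩
    q a * (q b * T v + mergeSum T b v) + (M + (q b * mergeSum T a v + S))
      ≈⟨ solve 7 (λ qa qb t sb sa m s → qa :* (qb :* t :+ sb) :+ (m :+ (qb :* sa :+ s)) :=
                   qa :* qb :* t :+ (qa :* sb :+ qb :* sa) :+ m :+ s)
           refl (q a) (q b) (T v) (mergeSum T b v) (mergeSum T a v) M S ⟩
    q a * q b * T v + (q a * mergeSum T b v + q b * mergeSum T a v) + M + S ∎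
    where
    M = T (suc (a ℕ.+ b) ∷ v)
    S = ∑[ j < n ] ∑[ i < n ] T (merge i b (merge j a v))

  T-symmetric : ∀ {n} → Symmetric (T {n})
  T-symmetric {suc n} (prep a {v} {w} p) = begin
    T (a ∷ v)                    ≈⟨ T-∷ a v ⟩
    q a * T v + mergeSum T a v   ≈⟨ +-cong (*-congˡ (T-symmetric p)) (mergeSum-symmetric {F = T} a T-symmetric p) ⟩
    q a * T w + mergeSum T a w   ≈⟨ T-∷ a w ⟨
    T (a ∷ w)                    ∎
  T-symmetric (swap {n} a b v) = begin
    T (a ∷ b ∷ v)
      ≈⟨ T-∷∷ a b v ⟩
    _ ≈⟨ +-cong (+-cong (+-cong (*-congʳ (*-comm (q a) (q b))) (+-comm (q a * mergeSum T b v) (q b * mergeSum T a v)))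
                        (reflexive (≡.cong (λ c → T (suc c ∷ v)) (ℕ.+-comm a b))))
                (trans (∑-comm {n} {n} (λ j i → T (merge i b (merge j a v))))
                       (sum-cong-≋ {n} (λ i → sum-cong-≋ {n} (λ j → reflexive (≡.cong T (merge-comm i j b a v)))))) ⟩
    _ ≈⟨ T-∷∷ b a v ⟨
    T (b ∷ a ∷ v) ∎

  -- By symmetry the merged entry can always be moved to the front, so all n + 1 summands coincide.
  mergeSum-replicate : ∀ n {F : Vec ℕ (suc n) → Carrier} a → Symmetric F →
                       mergeSum F a (replicate (suc n) 0) ≈ suc n × F (suc a ∷ replicate n 0)
  mergeSum-replicate zero    {F} a F-sym = +-congʳ (reflexive (≡.cong (λ b → F (suc b ∷ [])) (ℕ.+-identityʳ a)))
  mergeSum-replicate (suc n) {F} a F-sym = +-cong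
    (reflexive (≡.cong (λ b → F (suc b ∷ replicate (suc n) 0)) (ℕ.+-identityʳ a)))
    (trans (mergeSum-replicate n {F ∘ (0 ∷_)} a (λ p → F-sym (prep 0 p))) (×-congʳ (suc n) (F-sym (swap 0 (suc a) (replicate n 0)))))

  module _ (t : ℕ → Carrier) (n!t : ∀ n → (n !) × t n ≈ T (replicate n 0)) where

    -- The first element absorbs others of weight x one at a time until it becomes a fixed point.
    -- After i absorptions its factor is q (k + i), and the n - i elements left over contribute t (n
    -- - i). The factors n + 1 from `mergeSum-replicate` build up the factorial.
    T-convolution : ∀ n k → T (k ∷ replicate n 0) ≈ (n !) × ((λ i → q (k ℕ.+ i)) ⋆ t) n
    T-convolution zero k = begin
      T (k ∷ [])                          ≈⟨ trans (T-∷ k []) (+-identityʳ _) ⟩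
      q k * T []                          ≈⟨ *-congˡ (n!t 0) ⟨
      q k * (t 0 + 0#)                    ≈⟨ *-cong (reflexive (≡.cong q (≡.sym (ℕ.+-identityʳ k)))) (+-identityʳ (t 0)) ⟩
      q (k ℕ.+ 0) * t 0                   ≈⟨ trans (+-identityʳ _) (+-identityʳ _) ⟨
      q (k ℕ.+ 0) * t 0 + 0# + 0#         ∎
    T-convolution (suc n) k = begin
      T (k ∷ replicate (suc n) 0)
        ≈⟨ T-∷ k (replicate (suc n) 0) ⟩
      q k * T (replicate (suc n) 0) + mergeSum T k (replicate (suc n) 0)
        ≈⟨ +-cong (*-congˡ (sym (n!t (suc n)))) (mergeSum-replicate n {T} k T-symmetric) ⟩
      q k * (((suc n) !) × t (suc n)) + suc n × T (suc k ∷ replicate n 0)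
        ≈⟨ +-cong (×-comm-* ((suc n) !) (q k) (t (suc n))) (×-congʳ (suc n) (T-convolution n (suc k))) ⟩
      ((suc n) !) × (q k * t (suc n)) + suc n × ((n !) × ((λ i → q (suc k ℕ.+ i)) ⋆ t) n)
        ≈⟨ +-congˡ (×-assocˡ _ (suc n) (n !)) ⟩
      ((suc n) !) × (q k * t (suc n)) + ((suc n) !) × ((λ i → q (suc k ℕ.+ i)) ⋆ t) n
        ≈⟨ ×-distrib-+ _ _ ((suc n) !) ⟨
      ((suc n) !) × (q k * t (suc n) + ((λ i → q (suc k ℕ.+ i)) ⋆ t) n)
        ≈⟨ ×-congʳ ((suc n) !) (+-cong (*-congʳ (reflexive (≡.cong q (≡.sym (ℕ.+-identityʳ k)))))
             (⋆-cong {λ i → q (suc k ℕ.+ i)} {λ i → q (k ℕ.+ suc i)} {t} (λ i → reflexive (≡.cong q (≡.sym (ℕ.+-suc k i)))) (λ _ → refl) n)) ⟩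
      ((suc n) !) × ((λ i → q (k ℕ.+ i)) ⋆ t) (suc n) ∎

    t-recurrence : ∀ n → suc n × t (suc n) ≈ (q ⋆ t) n
    t-recurrence n = cancel (n !) {{n ℕ.!≢0}} (begin
      (n !) × (suc n × t (suc n))   ≈⟨ ×-assocˡ _ (n !) (suc n) ⟩
      (n ! ℕ.* suc n) × t (suc n) ≡⟨ ≡.cong (_× t (suc n)) (ℕ.*-comm (n !) (suc n)) ⟩
      ((suc n) !) × t (suc n)         ≈⟨ n!t (suc n) ⟩
      T (0 ∷ replicate n 0)       ≈⟨ T-convolution n 0 ⟩
      (n !) × (q ⋆ t) n             ∎)
      where
      cancel : ∀ m .{{_ : ℕ.NonZero m}} {f g} → m × f ≈ m × g → f ≈ g
      cancel (suc m) = ×-cancelˡ m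

-- Binomial numbers as coefficients of (1 - x)ʳ.

module IntegerLemmas where
  open Data.Integer.Solver.+-*-Solver

  -- The definition of `falling` appends the smallest factor; here the largest is split off, which
  -- is what increasing both arguments of `binomial` requires.
  falling-suc : ∀ a k → Defs.falling (a ℤ.+ + 1) (suc k) ≡ (a ℤ.+ + 1) ℤ.* Defs.falling a k
  falling-suc a zero    = identity a
    where
    identity : ∀ a → + 1 ℤ.* (a ℤ.+ + 1 ℤ.- + 0) ≡ (a ℤ.+ + 1) ℤ.* + 1
    identity = solve 1 (λ a → con (+ 1) :* (a :+ con (+ 1) :- con (+ 0)) := (a :+ con (+ 1)) :* con (+ 1)) ≡.refl
  falling-suc a (suc k) = ≡.trans (≡.cong (ℤ._* (a ℤ.+ + 1 ℤ.- + suc k)) (falling-suc a k)) (identity a (Defs.falling a k) (+ k))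
    where
    identity : ∀ a F k → (a ℤ.+ + 1) ℤ.* F ℤ.* (a ℤ.+ + 1 ℤ.- (+ 1 ℤ.+ k)) ≡ (a ℤ.+ + 1) ℤ.* (F ℤ.* (a ℤ.- k))
    identity = solve 3 (λ a F k → (a :+ con (+ 1)) :* F :* (a :+ con (+ 1) :- (con (+ 1) :+ k)) := (a :+ con (+ 1)) :* (F :* (a :- k))) ≡.refl

  1+k-r-1 : ∀ k r → + 1 ℤ.+ k ℤ.- r ℤ.- + 1 ≡ k ℤ.- r ℤ.- + 1 ℤ.+ + 1
  1+k-r-1 = solve 2 (λ k r → con (+ 1) :+ k :- r :- con (+ 1) := k :- r :- con (+ 1) :+ con (+ 1)) ≡.refl

  k-r-1+1 : ∀ k r → k ℤ.- r ℤ.- + 1 ℤ.+ + 1 ≡ k ℤ.- r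
  k-r-1+1 = solve 2 (λ k r → k :- r :- con (+ 1) :+ con (+ 1) := k :- r) ≡.refl

  *-/ℕ : ∀ z d .{{_ : ℕ.NonZero d}} → (z ℤ.* + d) ℤ./ℕ d ≡ z
  *-/ℕ (+ n)    d = ≡.trans (≡.cong (ℤ._/ℕ d) (≡.sym (ℤ.pos-* n d))) (≡.cong +_ (ℕ.m*n/n≡m n d))
  -- For a negative dividend the division branches on the remainder, which is 0 here.
  *-/ℕ -[1+ n ] (suc d) with (suc n ℕ.* suc d) ℕ.% suc d | ℕ.m*n%n≡0 (suc n) (suc d)
  ... | zero | _ = ≡.cong (λ m → ℤ.- (+ m)) (ℕ.m*n/n≡m (suc n) (suc d))

module Integrality (𝓡 : PowerSeriesRing) where
  open PowerSeriesRing 𝓡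
  open PowerSeries 𝓡
  open Dilation 𝓡
  open Stabilisation 𝓡 using (θ-x)
  open CommutativeRing commutativeRing hiding (zero)
  open import Algebra.Definitions.RawSemiring (Semiring.rawSemiring semiring) using (_^_)
  open import Algebra.Properties.Semiring.Sum semiring
  open import Algebra.Properties.Ring ring
  open import Algebra.Solver.Ring.NaturalCoefficients.Default commutativeSemiring using (solve; _:*_; _:=_)
  open import Relation.Binary.Reasoning.Setoid setoid
  open RationalIntegers
  open IntegerLemmas
  private
    module Q where
      open Convolution ℚ.+-*-commutativeRing public
      open import Algebra.Properties.Semiring.Sum (CommutativeRing.semiring ℚ.+-*-commutativeRing) public

  IsInteger : ℚ → Set
  IsInteger p = ∃ λ i → p ≡ fromℤ i

  +-isInteger : ∀ {p s} → IsInteger p → IsInteger s → IsInteger (p ℚ.+ s)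
  +-isInteger (i , ≡.refl) (j , ≡.refl) = i ℤ.+ j , ≡.sym (fromℤ-+ i j)

  *-isInteger : ∀ {p s} → IsInteger p → IsInteger s → IsInteger (p ℚ.* s)
  *-isInteger (i , ≡.refl) (j , ≡.refl) = i ℤ.* j , ≡.sym (fromℤ-* i j)

  sum-isInteger : ∀ {n} (f : Fin n → ℚ) → (∀ i → IsInteger (f i)) → IsInteger (Q.sum f)
  sum-isInteger {zero}  f int = + 0 , ≡.refl
  sum-isInteger {suc n} f int = +-isInteger (int zero) (sum-isInteger (f ∘ suc) (int ∘ suc))

  Integral : Carrier → Set
  Integral f = ∀ n → IsInteger (coeff f n)

  1-integral : Integral 1#
  1-integral zero    = + 1 , coeff-1#-0
  1-integral (suc n) = + 0 , coeff-1#-suc n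

  *-integral : ∀ {f g} → Integral f → Integral g → Integral (f * g)
  *-integral {f} {g} int-f int-g n = ≡.subst IsInteger (≡.sym (coeff-* f g n))
    (sum-isInteger (Q.term (coeff f) (coeff g) n) (λ i → *-isInteger (int-f (toℕ i)) (int-g (n ∸ toℕ i))))

  ^-integral : ∀ {f} → Integral f → ∀ n → Integral (f ^ n)
  ^-integral int zero    = 1-integral
  ^-integral int (suc n) = *-integral int (^-integral int n)

  1-f-integral : ∀ {f} → Integral f → Integral (1# - f)
  1-f-integral {f} int n with 1-integral n | int n
  ... | i , eq | j , eq′ = i ℤ.+ ℤ.- j , ≡.trans (coeff-+ 1# (- f) n)
    (≡.trans (≡.cong₂ ℚ._+_ eq (≡.trans (coeff-neg f n) (≡.trans (≡.cong ℚ.-_ eq′) (≡.sym (fromℤ-neg j)))))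
      (≡.sym (fromℤ-+ i (ℤ.- j))))

  inverse-integral : ∀ {f} → Integral f → Integral (inverse f)
  inverse-integral {f} int n = ≡.subst IsInteger (≡.sym (≡.trans (coeff-mk _ n) (coeff-sum {suc n} (λ k → (1# - f) ^ toℕ k) n)))
    (sum-isInteger {suc n} (λ k → coeff ((1# - f) ^ toℕ k) n) (λ k → ^-integral (1-f-integral int) (toℕ k) n))

  ^ℤ-integral : ∀ {f} → Integral f → ∀ r → Integral (f ^ℤ r)
  ^ℤ-integral int (+ n)    = ^-integral int n
  ^ℤ-integral int -[1+ n ] = ^-integral (inverse-integral int) (suc n)

  x-integral : Integral x
  x-integral zero          = + 0 , coeff-x-0
  x-integral (suc zero)    = + 1 , coeff-x-1
  x-integral (suc (suc n)) = + 0 , coeff-x-2+ n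

  module _ (r : ℤ) where
    private
      u = 1# - x
      f = u ^ℤ r

    β : ℕ → ℚ
    β = coeff f

    β-0 : β 0 ≡ 1ℚ
    β-0 = ^ℤ-unital (1-y-unital coeff-x-0) r

    -- The coefficient of x^(k+1) in (1 - x) θ f = - r x f.
    β-suc : ∀ k → fromℤ (+ suc k) ℚ.* β (suc k) ≡ fromℤ (+ k ℤ.- r) ℚ.* β k
    β-suc k = ≡.trans (add-sub (fromℤ (+ suc k) ℚ.* β (suc k)) (fromℤ (+ k) ℚ.* β k))
      (≡.trans (≡.cong (fromℤ (+ k) ℚ.* β k ℚ.+_) coefficient)
      (≡.trans (≡.sym (ℚ.*-distribʳ-+ (β k) (fromℤ (+ k)) (fromℤ (ℤ.- r))))
      (≡.cong (ℚ._* β k) (≡.sym (fromℤ-+ (+ k) (ℤ.- r))))))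
      where
      add-sub : ∀ a b → a ≡ b ℚ.+ (a ℚ.- b)
      add-sub a b = ≡.trans (≡.sym (ℚ.+-identityˡ a)) (≡.trans (≡.cong (ℚ._+ a) (≡.sym (ℚ.+-inverseʳ b)))
        (≡.trans (ℚ.+-assoc b (ℚ.- b) a) (≡.cong (b ℚ.+_) (ℚ.+-comm (ℚ.- b) a))))

      L = - (x * inverse u)

      uL : u * L ≈ - x
      uL = trans (sym (-‿distribʳ-* u _)) (-‿cong (trans (solve 3 (λ u y i → u :* (y :* i) := y :* (u :* i)) refl u x (inverse u))
        (trans (*-congˡ (*-inverseʳ (1-y-unital coeff-x-0))) (*-identityʳ x))))

      θ-u : θ u ≈ - x
      θ-u = trans (θ-+ 1# (- x)) (trans (+-cong θ-1 (trans (θ-neg x) (-‿cong θ-x))) (+-identityˡ _))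

      u*θf : u * θ f ≈ const (fromℤ (ℤ.- r)) * (x * f)
      u*θf = begin
        u * θ f                                ≈⟨ *-congˡ (θ-^ℤ (1-y-unital coeff-x-0) (trans uL (sym θ-u)) r) ⟩
        u * (const (fromℤ r) * (L * f))        ≈⟨ solve 4 (λ u c l f → u :* (c :* (l :* f)) := c :* ((u :* l) :* f)) refl u (const (fromℤ r)) L f ⟩
        const (fromℤ r) * ((u * L) * f)        ≈⟨ *-congˡ (trans (*-congʳ uL) (sym (-‿distribˡ-* x f))) ⟩
        const (fromℤ r) * - (x * f)            ≈⟨ -‿distribʳ-* _ _ ⟨
        - (const (fromℤ r) * (x * f))          ≈⟨ const-neg (fromℤ r) (x * f) ⟨
        const (ℚ.- fromℤ r) * (x * f)          ≡⟨ ≡.cong (λ p → const p * (x * f)) (fromℤ-neg r) ⟨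
        const (fromℤ (ℤ.- r)) * (x * f)        ∎

      θf : ∀ n → coeff (θ f) n ≡ fromℤ (+ n) ℚ.* β n
      θf n = ≡.trans (coeff-θ f n) (×-fromℤ n (β n))

      coefficient : fromℤ (+ suc k) ℚ.* β (suc k) ℚ.- fromℤ (+ k) ℚ.* β k ≡ fromℤ (ℤ.- r) ℚ.* β k
      coefficient = ≡.trans (≡.sym (≡.cong₂ ℚ._-_ (θf (suc k)) (θf k)))
        (≡.trans (≡.sym (coeff-[1-x]*-suc (θ f) k)) (≡.trans (coeff-cong u*θf (suc k))
          (≡.trans (coeff-const-* _ (x * f) (suc k)) (≡.cong (fromℤ (ℤ.- r) ℚ.*_) (coeff-x*-suc f k)))))

    -- Passing from k to k + 1 multiplies the falling factorial by k - r, and `β-suc` says the same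
    -- of k! β k.
    falling-β : ∀ k → fromℤ (Defs.falling (+ k ℤ.- r ℤ.- + 1) k) ≡ fromℤ (+ (k !)) ℚ.* β k
    falling-β zero    = ≡.sym (≡.trans (ℚ.*-identityˡ (β 0)) β-0)
    falling-β (suc k) = ≡.trans (≡.cong fromℤ step) (≡.trans (fromℤ-* (+ k ℤ.- r) _)
      (≡.trans (≡.cong (fromℤ (+ k ℤ.- r) ℚ.*_) (falling-β k)) (≡.trans (move (fromℤ (+ k ℤ.- r)) (fromℤ (+ (k !))) (β k))
      (≡.trans (≡.cong (fromℤ (+ (k !)) ℚ.*_) (≡.sym (β-suc k))) (≡.trans (regroup (fromℤ (+ (k !))) (fromℤ (+ suc k)) (β (suc k)))
      (≡.cong (ℚ._* β (suc k)) (≡.trans (≡.sym (fromℤ-* (+ suc k) (+ (k !)))) (≡.cong fromℤ (≡.sym (ℤ.pos-* (suc k) (k !)))))))))))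
      where
      step : Defs.falling (+ suc k ℤ.- r ℤ.- + 1) (suc k) ≡ (+ k ℤ.- r) ℤ.* Defs.falling (+ k ℤ.- r ℤ.- + 1) k
      step = ≡.trans (≡.cong (λ a → Defs.falling a (suc k)) (1+k-r-1 (+ k) r))
        (≡.trans (falling-suc (+ k ℤ.- r ℤ.- + 1) k) (≡.cong (ℤ._* Defs.falling (+ k ℤ.- r ℤ.- + 1) k) (k-r-1+1 (+ k) r)))
      move : ∀ a b c → a ℚ.* (b ℚ.* c) ≡ b ℚ.* (a ℚ.* c)
      move a b c = ≡.trans (≡.sym (ℚ.*-assoc a b c)) (≡.trans (≡.cong (ℚ._* c) (ℚ.*-comm a b)) (ℚ.*-assoc b a c))
      regroup : ∀ a b c → a ℚ.* (b ℚ.* c) ≡ b ℚ.* a ℚ.* c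
      regroup a b c = ≡.trans (≡.sym (ℚ.*-assoc a b c)) (≡.cong (ℚ._* c) (ℚ.*-comm a b))

    -- The coefficient is an integer `z` because 1 - x, its inverse and their powers have integer
    -- coefficients. Hence the falling factorial equals z · k!, and the integer division in
    -- `binomial` is exact.
    binomial-β : ∀ k → β k ≡ fromℤ (Defs.binomial (+ k ℤ.- r ℤ.- + 1) k)
    binomial-β k with ^ℤ-integral (1-f-integral x-integral) r k
    ... | z , eq = ≡.trans eq (≡.cong fromℤ (≡.sym (≡.trans (≡.cong (λ a → (a ℤ./ℕ (k !)) {{k ℕ.!≢0}}) falling≡) (*-/ℕ z (k !) {{k ℕ.!≢0}}))))
      where
      falling≡ : Defs.falling (+ k ℤ.- r ℤ.- + 1) k ≡ z ℤ.* + (k !)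
      falling≡ = fromℤ-injective (≡.trans (falling-β k) (≡.trans (≡.cong (fromℤ (+ (k !)) ℚ.*_) eq)
        (≡.trans (≡.sym (fromℤ-* (+ (k !)) z)) (≡.cong fromℤ (ℤ.*-comm (+ (k !)) z)))))

-- Enumeration of finite multisets.

module Enumeration (S : Setoid 0ℓ 0ℓ) where
  open Setoid S

  Distinct : List Carrier → Set
  Distinct = AllPairs (λ a b → ¬ a ≈ b)

  lookup-injective : ∀ {xs} → Distinct xs → ∀ i j → List.lookup xs i ≈ List.lookup xs j → i ≡ j
  lookup-injective (px ∷ pxs) zero    zero    eq = ≡.refl
  lookup-injective (px ∷ pxs) zero    (suc j) eq = contradiction eq (All.lookup px (∈ₚ.∈-lookup j))
  lookup-injective (px ∷ pxs) (suc i) zero    eq = contradiction (sym eq) (All.lookup px (∈ₚ.∈-lookup i))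
  lookup-injective (px ∷ pxs) (suc i) (suc j) eq = ≡.cong suc (lookup-injective pxs i j eq)

  -- Equality on the target ignores the proofs of `P`, so completeness supplies a position for each
  -- element, and distinctness makes it unique.
  enumerate : ∀ {P : Carrier → Set} xs → All P xs → Distinct xs → (∀ a → P a → Any (a ≈_) xs) →
              Inverse (≡.setoid (Fin (length xs))) (On.setoid S (proj₁ {A = Carrier} {B = P}))
  enumerate {P} xs all distinct complete = record
    { to        = λ i → List.lookup xs i , All.lookup all (∈ₚ.∈-lookup i)
    ; from      = λ (a , p) → Any.index (complete a p)
    ; to-cong   = λ { ≡.refl → refl }
    ; from-cong = λ {(a , p)} {(b , q)} a≈b → lookup-injective distinct _ _
        (trans (sym (Any.lookup-index (complete a p))) (trans a≈b (Any.lookup-index (complete b q))))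
    ; inverse   = (λ { {a , p} ≡.refl → sym (Any.lookup-index (complete a p)) })
                , (λ {i} {(a , p)} a≈ → lookup-injective distinct _ i (trans (sym (Any.lookup-index (complete a p))) a≈))
    }

module Multisets (S : Setoid 0ℓ 0ℓ) (weight : Setoid.Carrier S → ℕ)
                 (weight-cong : ∀ {a b} → Setoid._≈_ S a b → weight a ≡ weight b)
                 (weight-positive : ∀ a → 1 ≤ weight a) where
  open Setoid S using (Carrier; _≈_)
  open Membership S using (_∈_)
  open PermutationSetoid S

  total : List Carrier → ℕ
  total xs = ℕ.sum (List.map weight xs)

  total-↭ : ∀ {xs ys} → xs ↭ ys → total xs ≡ total ys
  total-↭ (refl [])       = ≡.refl
  total-↭ (refl (p ∷ ps)) = ≡.cong₂ ℕ._+_ (weight-cong p) (total-↭ (refl ps))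
  total-↭ (prep p ps)     = ≡.cong₂ ℕ._+_ (weight-cong p) (total-↭ ps)
  total-↭ (swap {xs} {ys} {x} {y} p q ps) = ≡.trans (x∙yz≈y∙xz (weight x) (weight y) (total xs))
    (≡.cong₂ ℕ._+_ (weight-cong q) (≡.cong₂ ℕ._+_ (weight-cong p) (total-↭ ps)))
    where open import Algebra.Properties.CommutativeSemigroup ℕ.+-commutativeSemigroup
  total-↭ (trans p q)     = ≡.trans (total-↭ p) (total-↭ q)

  -- The lists of total n formed by copies of a followed by a list from F;
  -- the second argument bounds the recursion.
  extend : Carrier → (ℕ → List (List Carrier)) → ℕ → ℕ → List (List Carrier)
  extend a F zero       n = []
  extend a F (suc fuel) n with weight a ℕ.≤? n
  ... | yes _ = F n ++ List.map (a ∷_) (extend a F fuel (n ∸ weight a))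
  ... | no  _ = F n

  -- Copies of an element precede everything later in `as`. This canonical order represents each
  -- multiset once when the elements of `as` are distinct.
  multisets : List Carrier → ℕ → List (List Carrier)
  multisets []       zero    = [] ∷ []
  multisets []       (suc n) = []
  multisets (a ∷ as) n       = extend a (multisets as) (suc n) n

  n∸weight<n : ∀ a {n} → weight a ≤ n → n ∸ weight a < n
  n∸weight<n a {n} w≤n = ℕ.∸-monoʳ-< {n} {weight a} {0} (weight-positive a) w≤n

  extend-fuel : ∀ a F fuel fuel′ n → n < fuel → n < fuel′ → extend a F fuel n ≡ extend a F fuel′ n
  extend-fuel a F (suc fuel) (suc fuel′) n (s≤s n≤) (s≤s n≤′) with weight a ℕ.≤? n
  ... | no  _   = ≡.refl
  ... | yes w≤n = ≡.cong (λ xss → F n ++ List.map (a ∷_) xss)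
    (extend-fuel a F fuel fuel′ (n ∸ weight a) (ℕ.<-≤-trans (n∸weight<n a w≤n) n≤) (ℕ.<-≤-trans (n∸weight<n a w≤n) n≤′))

  -- A multiset avoids `a`, or contains it and one copy can be removed: the coefficientwise form of
  -- the factor 1 / (1 - x^(weight a)) in an Euler product.
  length-multisets-≤ : ∀ a as n → weight a ≤ n →
    length (multisets (a ∷ as) n) ≡ length (multisets as n) ℕ.+ length (multisets (a ∷ as) (n ∸ weight a))
  length-multisets-≤ a as n w≤n with weight a ℕ.≤? n
  ... | no  w≰n = contradiction w≤n w≰n
  ... | yes _   = ≡.trans (List.length-++ (multisets as n)) (≡.cong (length (multisets as n) ℕ.+_)
    (≡.trans (List.length-map (a ∷_) (extend a (multisets as) n (n ∸ weight a))) (≡.cong length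
      (extend-fuel a (multisets as) n (suc (n ∸ weight a)) (n ∸ weight a) (n∸weight<n a w≤n) (ℕ.n<1+n _)))))

  length-multisets-> : ∀ a as n → n < weight a → length (multisets (a ∷ as) n) ≡ length (multisets as n)
  length-multisets-> a as n n<w with weight a ℕ.≤? n
  ... | no  _   = ≡.refl
  ... | yes w≤n = contradiction w≤n (ℕ.<⇒≱ n<w)

  module _ {P : List Carrier → ℕ → Set} where

    extend-all : ∀ a F → (∀ n → All (λ xs → P xs n) (F n)) → (∀ {xs n} → weight a ≤ n → P xs (n ∸ weight a) → P (a ∷ xs) n) →
                 ∀ fuel n → All (λ xs → P xs n) (extend a F fuel n)
    extend-all a F all step zero       n = []
    extend-all a F all step (suc fuel) n with weight a ℕ.≤? n
    ... | no  _   = all n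
    ... | yes w≤n = All.++⁺ (all n) (All.map⁺ (All.map (step w≤n) (extend-all a F all step fuel (n ∸ weight a))))

  multisets-total : ∀ as n → All (λ xs → total xs ≡ n) (multisets as n)
  multisets-total []       zero    = ≡.refl ∷ []
  multisets-total []       (suc n) = []
  multisets-total (a ∷ as) n       = extend-all {λ xs n → total xs ≡ n} a (multisets as) (multisets-total as)
    (λ w≤n eq → ≡.trans (≡.cong (weight a ℕ.+_) eq) (ℕ.m+[n∸m]≡n w≤n)) (suc n) n

  multisets-∈ : ∀ as n → All (All (_∈ as)) (multisets as n)
  multisets-∈ []       zero    = [] ∷ []
  multisets-∈ []       (suc n) = []
  multisets-∈ (a ∷ as) n       = extend-all {λ xs _ → All (_∈ a ∷ as) xs} a (multisets as)
    (λ n → All.map (All.map there) (multisets-∈ as n)) (λ _ all → here (Setoid.refl S) ∷ all) (suc n) n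

  -- It decides whether `a` occurs and, if so, brings a copy to the front up to reordering. This is
  -- how an arbitrary list is matched with the canonical order of `extend`.
  remove-head : ∀ {a as} xs → All (_∈ a ∷ as) xs →
                All (_∈ as) xs ⊎ (∃ λ ys → xs ↭ a ∷ ys Product.× All (_∈ a ∷ as) ys)
  remove-head []       []             = inj₁ []
  remove-head (x ∷ xs) (here p ∷ ps)  = inj₂ (xs , prep p ↭-refl , ps)
  remove-head (x ∷ xs) (there p ∷ ps) with remove-head xs ps
  ... | inj₁ all           = inj₁ (p ∷ all)
  ... | inj₂ (ys , q , qs) = inj₂ (x ∷ ys , ↭-trans (↭-prep x q) (↭-swap x _ ↭-refl) , there p ∷ qs)

  multisets-complete : ∀ as xs n → All (_∈ as) xs → total xs ≡ n → Any (xs ↭_) (multisets as n)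
  extend-complete : ∀ a as fuel xs n → n < fuel → All (_∈ a ∷ as) xs → total xs ≡ n →
                    Any (xs ↭_) (extend a (multisets as) fuel n)

  multisets-complete []       []       n []        ≡.refl = here ↭-refl
  multisets-complete []       (x ∷ xs) n (() ∷ _)  eq
  multisets-complete (a ∷ as) xs       n all       eq     = extend-complete a as (suc n) xs n (ℕ.n<1+n n) all eq

  extend-complete a as (suc fuel) xs n (s≤s n≤fuel) all eq with weight a ℕ.≤? n | remove-head xs all
  ... | no  _   | inj₁ xs∈as          = multisets-complete as xs n xs∈as eq
  ... | yes _   | inj₁ xs∈as          = Any.++⁺ˡ (multisets-complete as xs n xs∈as eq)
  ... | no  w≰n | inj₂ (ys , p , _)   = contradiction (ℕ.≤-trans (ℕ.m≤m+n (weight a) (total ys))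
                                          (ℕ.≤-reflexive (≡.trans (≡.sym (total-↭ p)) eq))) w≰n
  ... | yes w≤n | inj₂ (ys , p , ys∈) = Any.++⁺ʳ (multisets as n) (Any.map⁺ (Any.map (λ q → ↭-trans p (↭-prep a q))
    (extend-complete a as fuel ys (n ∸ weight a) (ℕ.<-≤-trans (n∸weight<n a w≤n) n≤fuel) ys∈
      (≡.trans (≡.sym (ℕ.m+n∸m≡n (weight a) (total ys))) (≡.cong (_∸ weight a) (≡.trans (≡.sym (total-↭ p)) eq))))))

  -- Lists without `a` are told apart from lists with `a` by membership, which reordering preserves;
  -- between two lists that begin with `a` the head cancels.
  multisets-distinct : ∀ {as} n → AllPairs (λ a b → ¬ a ≈ b) as → AllPairs (λ xs ys → ¬ (xs ↭ ys)) (multisets as n)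
  multisets-distinct {[]}     zero    []           = [] ∷ []
  multisets-distinct {[]}     (suc n) []           = []
  multisets-distinct {a ∷ as} n       (a∉as ∷ pas) = go (suc n) n
    where
    open PermutationSetoid′ S using (∈-resp-↭; drop-∷)

    a≉ : ¬ a ∈ as
    a≉ a∈as = All.lookupWith (λ a≉b a≈b → a≉b a≈b) a∉as a∈as

    separate : ∀ {xs ys} → All (_∈ as) xs → ¬ (xs ↭ a ∷ ys)
    separate xs∈as p = a≉ (All.lookupWith (λ x∈as a≈x → Membershipₚ.∈-resp-≈ S (Setoid.sym S a≈x) x∈as) xs∈as (∈-resp-↭ (↭-sym p) (here (Setoid.refl S))))

    go : ∀ fuel n → AllPairs (λ xs ys → ¬ (xs ↭ ys)) (extend a (multisets as) fuel n)
    go zero       n = []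
    go (suc fuel) n with weight a ℕ.≤? n
    ... | no  _   = multisets-distinct n pas
    ... | yes w≤n = AllPairs.++⁺ (multisets-distinct n pas)
      (AllPairs.map⁺ (AllPairs.map (λ ne p → ne (drop-∷ p)) (go fuel (n ∸ weight a))))
      (All.map (λ xs∈as → All.map⁺ (All.universal (λ ys → separate xs∈as) _)) (multisets-∈ as n))

-- Euler products for multiset counts.

module CountingSeries (𝓡 : PowerSeriesRing) where
  open PowerSeriesRing 𝓡
  open PowerSeries 𝓡
  open Dilation 𝓡
  open CommutativeRing commutativeRing hiding (zero)
  open import Algebra.Definitions.RawSemiring (Semiring.rawSemiring semiring) using (_^_; product)
  open import Algebra.Properties.CommutativeSemiring.Exp commutativeSemiring using (^-distrib-*)
  open import Algebra.Properties.CommutativeSemigroup *-commutativeSemigroup using (interchange; x∙yz≈y∙xz)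
  open import Algebra.Properties.Ring ring
  open import Relation.Binary.Reasoning.Setoid setoid
  open RationalIntegers

  coeff-x^*-+ : ∀ w f n → coeff (x ^ w * f) (w ℕ.+ n) ≡ coeff f n
  coeff-x^*-+ zero    f n = coeff-cong (*-identityˡ f) n
  coeff-x^*-+ (suc w) f n = ≡.trans (coeff-cong (*-assoc x (x ^ w) f) (suc (w ℕ.+ n)))
    (≡.trans (coeff-x*-suc (x ^ w * f) (w ℕ.+ n)) (coeff-x^*-+ w f n))

  coeff-x^*-> : ∀ w f n → n < w → coeff (x ^ w * f) n ≡ 0ℚ
  coeff-x^*-> w f n n<w = ≡.trans (*-≈[] {g = f} (^-≈[]0 coeff-x-0 w) ≈[]-refl n n<w)
    (≡.trans (coeff-cong (zeroˡ f) n) (coeff-0# n))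

  -- The hypotheses are the coefficients of g = f + x^w g, distinguished by whether the shifted
  -- series reaches index n.
  euler-step : ∀ w f g → (∀ n → w ≤ n → coeff g n ≡ coeff f n ℚ.+ coeff g (n ∸ w)) →
               (∀ n → n < w → coeff g n ≡ coeff f n) → (1# - x ^ w) * g ≈ f
  euler-step w f g g≤ g> = begin
    (1# - x ^ w) * g               ≈⟨ distribʳ g 1# (- x ^ w) ⟩
    1# * g + - x ^ w * g           ≈⟨ +-cong (trans (*-identityˡ g) g≈) (sym (-‿distribˡ-* (x ^ w) g)) ⟩
    f + x ^ w * g - x ^ w * g      ≈⟨ +-assoc _ _ _ ⟩
    f + (x ^ w * g - x ^ w * g)    ≈⟨ trans (+-congˡ (-‿inverseʳ _)) (+-identityʳ f) ⟩
    f                              ∎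
    where
    g≈ : g ≈ f + x ^ w * g
    g≈ = coeff-ext (λ n → ≡.sym (≡.trans (coeff-+ f (x ^ w * g) n) (at n)))
      where
      at : ∀ n → coeff f n ℚ.+ coeff (x ^ w * g) n ≡ coeff g n
      at n with w ℕ.≤? n
      ... | yes w≤n = ≡.sym (≡.trans (g≤ n w≤n) (≡.cong (coeff f n ℚ.+_) (≡.sym
        (≡.trans (≡.cong (coeff (x ^ w * g)) (≡.sym (ℕ.m+[n∸m]≡n w≤n))) (coeff-x^*-+ w g (n ∸ w))))))
      ... | no  w≰n = ≡.trans (≡.cong (coeff f n ℚ.+_) (coeff-x^*-> w g n (ℕ.≰⇒> w≰n)))
        (≡.trans (ℚ.+-identityʳ _) (≡.sym (g> n (ℕ.≰⇒> w≰n))))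

  -- The reciprocal of the generating function of multisets. Series are identified as inverses of
  -- this product through `*≈1-unique`, so no quotient has to be expanded.
  denominator : ∀ {A : Set} → (A → ℕ) → List A → Carrier
  denominator weight = List.foldr (λ a d → (1# - x ^ weight a) * d) 1#

  denominator-++ : ∀ {A : Set} (weight : A → ℕ) as bs →
                   denominator weight (as ++ bs) ≈ denominator weight as * denominator weight bs
  denominator-++ weight []       bs = sym (*-identityˡ _)
  denominator-++ weight (a ∷ as) bs = trans (*-congˡ (denominator-++ weight as bs)) (sym (*-assoc _ _ _))

  denominator-constant : ∀ {A : Set} (weight : A → ℕ) w {as} → All (λ a → weight a ≡ w) as →
                         denominator weight as ≈ (1# - x ^ w) ^ length as
  denominator-constant weight w []            = refl
  denominator-constant weight w (≡.refl ∷ ps) = *-congˡ (denominator-constant weight w ps)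

  ^-*-^ℤ-neg : ∀ {f} → Unital f → ∀ n → f ^ n * f ^ℤ (ℤ.- + n) ≈ 1#
  ^-*-^ℤ-neg f₀ zero        = *-identityˡ 1#
  ^-*-^ℤ-neg {f} f₀ (suc n) = trans (sym (^-distrib-* f (inverse f) (suc n)))
    (trans (^ℤ-cong {f * inverse f} (*-unital f₀ (inverse-unital f₀)) (*-inverseʳ f₀) (+ suc n)) (1^ℤ (+ suc n)))

  product-snoc : ∀ n (f : ℕ → Carrier) → product {suc n} (f ∘ toℕ) ≈ product {n} (f ∘ toℕ) * f n
  product-snoc zero    f = *-comm (f 0) 1#
  product-snoc (suc n) f = trans (*-congˡ (product-snoc n (f ∘ suc))) (sym (*-assoc _ _ _))

  product-inverse : ∀ {n} (f g : Fin n → Carrier) → (∀ i → f i * g i ≈ 1#) → product f * product g ≈ 1#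
  product-inverse {zero}  f g eq = *-identityˡ 1#
  product-inverse {suc n} f g eq = trans (interchange _ _ _ _)
    (trans (*-cong (eq zero) (product-inverse (f ∘ suc) (g ∘ suc) (eq ∘ suc))) (*-identityˡ 1#))

  *≈1-unique : ∀ {d f g} → d * f ≈ 1# → d * g ≈ 1# → f ≈ g
  *≈1-unique {d} {f} {g} df dg = begin
    f             ≈⟨ *-identityʳ f ⟨
    f * 1#        ≈⟨ *-congˡ dg ⟨
    f * (d * g)   ≈⟨ *-assoc _ _ _ ⟨
    f * d * g     ≈⟨ *-congʳ (trans (*-comm f d) df) ⟩
    1# * g        ≈⟨ *-identityˡ g ⟩
    g             ∎

  module _ (S : Setoid 0ℓ 0ℓ) (weight : Setoid.Carrier S → ℕ)
           (weight-cong : ∀ {a b} → Setoid._≈_ S a b → weight a ≡ weight b) (weight-positive : ∀ a → 1 ≤ weight a) where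
    open Multisets S weight weight-cong weight-positive

    countSeries : List (Setoid.Carrier S) → Carrier
    countSeries as = mk (λ n → fromℤ (+ length (multisets as n)))

    denominator-countSeries : ∀ as → denominator weight as * countSeries as ≈ 1#
    denominator-countSeries []       = trans (*-identityˡ _) (coeff-ext λ where
      zero    → ≡.trans (coeff-mk _ 0) (≡.sym coeff-1#-0)
      (suc n) → ≡.trans (coeff-mk _ (suc n)) (≡.sym (coeff-1#-suc n)))
    denominator-countSeries (a ∷ as) = begin
      (1# - x ^ weight a) * denominator weight as * countSeries (a ∷ as)   ≈⟨ trans (*-assoc _ _ _) (x∙yz≈y∙xz _ _ _) ⟩
      denominator weight as * ((1# - x ^ weight a) * countSeries (a ∷ as)) ≈⟨ *-congˡ step ⟩
      denominator weight as * countSeries as                               ≈⟨ denominator-countSeries as ⟩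
      1#                                                                   ∎
      where
      step : (1# - x ^ weight a) * countSeries (a ∷ as) ≈ countSeries as
      step = euler-step (weight a) (countSeries as) (countSeries (a ∷ as))
        (λ n w≤n → ≡.trans (coeff-mk _ n) (≡.trans (≡.cong (λ l → fromℤ (+ l)) (length-multisets-≤ a as n w≤n))
          (≡.trans (fromℤ-+ (+ length (multisets as n)) (+ length (multisets (a ∷ as) (n ∸ weight a))))
            (≡.sym (≡.cong₂ ℚ._+_ (coeff-mk _ n) (coeff-mk _ (n ∸ weight a)))))))
        (λ n n<w → ≡.trans (coeff-mk _ n) (≡.trans (≡.cong (λ l → fromℤ (+ l)) (length-multisets-> a as n n<w))
          (≡.sym (coeff-mk _ n))))

open Defs

-- Residues of series with eventually constant coefficients.

module Residue where
  open Convolution ℚ.+-*-commutativeRing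
  open import Algebra.Properties.Ring (CommutativeRing.ring ℚ.+-*-commutativeRing) using (-1*x≈-x)

  -- The coefficients of a + (y - 1) f.
  differences : ℚ → FPS → FPS
  differences a f zero    = a ℚ.- f 0
  differences a f (suc n) = differences (f 0) (f ∘ suc) n

  differences-suc : ∀ a f n → differences a f (suc n) ≡ f n ℚ.- f (suc n)
  differences-suc a f zero    = ≡.refl
  differences-suc a f (suc n) = differences-suc (f 0) (f ∘ suc) n

  truncate : ℕ → FPS → Poly
  truncate zero    f = []
  truncate (suc N) f = f 0 ∷ truncate N (f ∘ suc)

  ⟦truncate⟧ : ∀ N f → (∀ n → N ≤ n → f n ≡ 0ℚ) → ⟦ truncate N f ⟧ ≈ f
  ⟦truncate⟧ zero    f f≡0 n       = ≡.sym (f≡0 n z≤n)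
  ⟦truncate⟧ (suc N) f f≡0 zero    = ≡.refl
  ⟦truncate⟧ (suc N) f f≡0 (suc n) = ⟦truncate⟧ N (f ∘ suc) (λ n N≤n → f≡0 (suc n) (s≤s N≤n)) n

  -- At 1 the coefficients telescope. The value `a` is kept free because `f 0` takes its place in
  -- the tail.
  eval-differences : ∀ N a f → eval (truncate (suc N) (differences a f)) 1ℚ ≡ a ℚ.- f N
  eval-differences zero    a f = ≡.trans (≡.cong (a ℚ.- f 0 ℚ.+_) (ℚ.*-zeroʳ 1ℚ)) (ℚ.+-identityʳ _)
  eval-differences (suc N) a f = ≡.trans (≡.cong (a ℚ.- f 0 ℚ.+_) (≡.trans (ℚ.*-identityˡ _) (eval-differences N (f 0) (f ∘ suc))))
    (≡.trans (ℚ.+-assoc a (ℚ.- f 0) _) (≡.cong (a ℚ.+_) (≡.trans (≡.sym (ℚ.+-assoc (ℚ.- f 0) (f 0) _))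
      (≡.trans (≡.cong (ℚ._- f (suc N)) (ℚ.+-inverseˡ (f 0))) (ℚ.+-identityˡ _)))))

  -- Multiplication by y - 1 turns the coefficients into differences, which vanish beyond index m.
  -- So (y - 1) f is a polynomial, the denominator is 1, and the value at 1 telescopes to - f m.
  stationary⇒residue : ∀ (f : FPS) m → (∀ n → m ≤ n → f n ≡ f m) → HasSimpleResidueAt 1ℚ f (ℚ.- f m)
  stationary⇒residue f m stationary = record
    { num      = truncate (suc m) (differences 0ℚ f)
    ; den      = 1ℚ ∷ []
    ; den[a]≢0 = λ ()
    ; rational = λ n → ≡.trans (⋆-identityˡ {⟦ 1ℚ ∷ [] ⟧} ≡.refl (λ _ → ≡.refl) (⟦ ℚ.- 1ℚ ∷ 1ℚ ∷ [] ⟧ * f) n)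
        (≡.trans (y-1*f n) (≡.sym (⟦truncate⟧ (suc m) (differences 0ℚ f) vanish n)))
    ; residue  = ≡.trans (eval-differences m 0ℚ f) (≡.trans (ℚ.+-identityˡ (ℚ.- f m)) (≡.sym (ℚ.*-identityʳ (ℚ.- f m))))
    }
    where
    y-1*f : ∀ n → (⟦ ℚ.- 1ℚ ∷ 1ℚ ∷ [] ⟧ * f) n ≡ differences 0ℚ f n
    y-1*f zero    = ≡.trans (ℚ.+-identityʳ _) (≡.trans (-1*x≈-x (f 0)) (≡.sym (ℚ.+-identityˡ _)))
    y-1*f (suc n) = ≡.trans (≡.cong₂ ℚ._+_ (-1*x≈-x (f (suc n))) (⋆-identityˡ {⟦ 1ℚ ∷ [] ⟧} ≡.refl (λ _ → ≡.refl) f n))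
      (≡.trans (ℚ.+-comm _ (f n)) (≡.sym (differences-suc 0ℚ f n)))

    vanish : ∀ n → suc m ≤ n → differences 0ℚ f n ≡ 0ℚ
    vanish (suc n) (s≤s m≤n) = ≡.trans (differences-suc 0ℚ f n)
      (≡.trans (≡.cong₂ ℚ._-_ (stationary n m≤n) (stationary (suc n) (ℕ.m≤n⇒m≤1+n m≤n))) (ℚ.+-inverseʳ (f m)))

-- The residue of Φʳ.

module ResidueOfΦ where
  open PowerSeriesRing ℚ[[X]] using (commutativeRing)
  private module R = CommutativeRing commutativeRing
  open PowerSeries ℚ[[X]] using (coeff-const-*; ×-const; const; const-*; const-1) renaming (_^ℤ_ to infixr 8 _^^_)
  open PowerSeries ℚ[[X]] using (^ℤ-cong; 1^ℤ)
  open RationalIntegers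
  open import Algebra.Properties.CommutativeMonoid.Sum R.*-commutativeMonoid using (sum-cong-≋)
  open ListSum R.semiring using (∑L-cong)
  open DeterminantProperties commutativeRing using (det-cong)
  open import Algebra.Definitions.RawSemiring (Semiring.rawSemiring R.semiring) using (_×_)
  open import Relation.Binary.Reasoning.Setoid R.setoid

  ^ℤ≡^^ : ∀ f r → f ^ℤ r ≡ f ^^ r
  ^ℤ≡^^ f (+ n)    = ≡.refl
  ^ℤ≡^^ f -[1+ n ] = ≡.refl

  module _ (r : ℤ) where
    open CycleWeights ℚ[[X]] r using (T; D; D-unital; D-[]; t-recurrence; weight)
    open Stabilisation ℚ[[X]] using (t≡G)
    open Integrality ℚ[[X]] using (binomial-β)

    b : ℕ → ℤ
    b k = binomial (+ k ℤ.- r ℤ.- + 1) k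

    factor : ℕ → FPS
    factor k = (1# - X ^ k) ^ℤ (ℤ.- b k)

    I-xM≈ : ∀ n σ → det (I-xM {n} σ) R.≈ D (replicate n 0) σ
    I-xM≈ n σ = det-cong {n} {I-xM σ} (λ i j → R.+-congˡ {identity n i j} (R.-‿cong (R.*-congʳ {permMatrix σ i j} (X≈ i))))
      where
      X≈ : ∀ i → X R.≈ weight (replicate n 0) i
      X≈ i = R.trans (R.sym (R.*-identityʳ X)) (R.reflexive (≡.cong (λ a → X ^ suc a) (≡.sym (Vec.lookup-replicate i 0))))

    -- This clears the division by n! and recognises the sum as the weighted one with all weights
    -- equal to x. For n = 0 the coefficient 1 is matched with a power of the empty determinant.
    n!Φ : ∀ n → ((n !) × Φ r n) R.≈ T (replicate n 0)
    n!Φ zero = begin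
      1# + 0#          ≈⟨ R.+-congʳ (1^ℤ r) ⟨
      (1# ^^ r) + 0#   ≈⟨ R.+-congʳ (^ℤ-cong {1#} ≡.refl (R.sym (D-[] Perm.id)) r) ⟩
      T []             ∎
    n!Φ (suc n) = begin
      ((suc n) !) × Φ r (suc n)                      ≈⟨ ×-const ((suc n) !) (Φ r (suc n)) ⟩
      const (fromℤ (+ ((suc n) !))) * (p · S)        ≈⟨ R.*-congˡ {const (fromℤ (+ ((suc n) !)))} {p · S} {const p * S} (λ i → ≡.sym (coeff-const-* p S i)) ⟩
      const (fromℤ (+ ((suc n) !))) * (const p * S)  ≈⟨ const-* (fromℤ (+ ((suc n) !))) p S ⟨
      const (fromℤ (+ ((suc n) !)) ℚ.* p) * S        ≡⟨ ≡.cong (λ z → const z * S) inv ⟩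
      const 1ℚ * S                                   ≈⟨ const-1 S ⟩
      S                                              ≈⟨ ∑L-cong (permutations (suc n)) (λ σ → term σ) ⟩
      T (replicate (suc n) 0)                        ∎
      where
      p = ((+ 1) ℚ./ ((suc n) !)) {{(suc n) ℕ.!≢0}}
      S = ∑S (suc n) (λ σ → det (I-xM σ) ^ℤ r)
      term : ∀ σ → (det (I-xM σ) ^ℤ r) R.≈ (D (replicate (suc n) 0) σ ^^ r)
      term σ = R.trans (R.reflexive (^ℤ≡^^ (det (I-xM σ)) r))
        (R.sym (^ℤ-cong {D (replicate (suc n) 0) σ} (D-unital (replicate (suc n) 0) σ) (R.sym (I-xM≈ (suc n) σ)) r))
      inv : fromℤ (+ ((suc n) !)) ℚ.* p ≡ 1ℚ
      inv = fromℤ-*-inverse ((suc n) !) {{(suc n) ℕ.!≢0}}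

    Φ≡partialProduct : ∀ m n K → m ≤ n → m ≤ K → Φ r n m ≡ product {K} (λ i → factor (suc (toℕ i))) m
    Φ≡partialProduct m n K m≤n m≤K = ≡.trans
      (t≡G r b (binomial-β r) (Φ r) (λ _ → ≡.refl) (t-recurrence (Φ r) n!Φ) m n K m≤n m≤K)
      (sum-cong-≋ {K} (λ i → R.reflexive (≡.sym (^ℤ≡^^ (1# - X ^ suc (toℕ i)) (ℤ.- b (suc (toℕ i)))))) m)

    -- The coefficient of xᵐ in that of yⁿ no longer changes from n = m on, so the diagonal already
    -- holds the limits.
    P : FPS
    P m = Φ r m m

    P-isInfiniteProduct : IsInfiniteProduct factor P
    P-isInfiniteProduct m = m , λ K m≤K → ≡.sym (Φ≡partialProduct m m K ℕ.≤-refl m≤K)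

    Φ-hasResidue : HasResidue₁ (Φ r) (- P)
    Φ-hasResidue m = Residue.stationary⇒residue (λ n → Φ r n m) m
      (λ n m≤n → ≡.trans (Φ≡partialProduct m n m m≤n ℕ.≤-refl) (≡.sym (Φ≡partialProduct m m m ℕ.≤-refl ℕ.≤-refl)))

open Defs
open Product using (_×_)
open ↭ using (_↭_; ↭⇒↭ₛ; ↭ₛ⇒↭)

-- Counting coloured partitions.

module NonEmptyLists {A : Set} where

  -- Multisets of colours are enumerated as lists, whereas a part is a `List⁺`. The empty lists
  -- dropped here do not occur among colourings of positive size.
  nonEmpty : List (List A) → List (List⁺ A)
  nonEmpty []               = []
  nonEmpty ([] ∷ xss)       = nonEmpty xss
  nonEmpty ((x ∷ xs) ∷ xss) = (x ∷ xs) ∷ nonEmpty xss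

  length-nonEmpty : ∀ {xss} → All (λ xs → 1 ℕ.≤ length xs) xss → length (nonEmpty xss) ≡ length xss
  length-nonEmpty []                        = ≡.refl
  length-nonEmpty {[] ∷ _}       (() ∷ _)
  length-nonEmpty {(x ∷ xs) ∷ _} (_ ∷ ps)  = ≡.cong suc (length-nonEmpty ps)

  nonEmpty-All : ∀ {P : List A → Set} {xss} → All P xss → All (P ∘ List⁺.toList) (nonEmpty xss)
  nonEmpty-All []                        = []
  nonEmpty-All {xss = [] ∷ _}       (_ ∷ ps) = nonEmpty-All ps
  nonEmpty-All {xss = (x ∷ xs) ∷ _} (p ∷ ps) = p ∷ nonEmpty-All ps

  nonEmpty-AllPairs : ∀ {R : List A → List A → Set} {xss} → AllPairs R xss →
                      AllPairs (λ p q → R (List⁺.toList p) (List⁺.toList q)) (nonEmpty xss)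
  nonEmpty-AllPairs []                        = []
  nonEmpty-AllPairs {xss = [] ∷ _}       (_ ∷ ps) = nonEmpty-AllPairs ps
  nonEmpty-AllPairs {xss = (x ∷ xs) ∷ _} (p ∷ ps) = nonEmpty-All p ∷ nonEmpty-AllPairs ps

  nonEmpty-Any : ∀ {P : List A → Set} {xss} → ¬ P [] → Any P xss → Any (P ∘ List⁺.toList) (nonEmpty xss)
  nonEmpty-Any {xss = [] ∷ _}       ¬p (here p)  = contradiction p ¬p
  nonEmpty-Any {xss = (x ∷ xs) ∷ _} ¬p (here p)  = here p
  nonEmpty-Any {xss = [] ∷ _}       ¬p (there p) = nonEmpty-Any ¬p p
  nonEmpty-Any {xss = (x ∷ xs) ∷ _} ¬p (there p) = there (nonEmpty-Any ¬p p)

module ColoredPartitions (c : ℕ) where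
  open NonEmptyLists
  open RationalIntegers
  open CountingSeries ℚ[[X]]
  open PowerSeries ℚ[[X]] using () renaming (_^ℤ_ to infixr 8 _^^_)
  open Dilation ℚ[[X]] using (1-y-unital; coeff-x^-0)
  open Integrality ℚ[[X]] using (binomial-β)
  open PowerSeriesRing ℚ[[X]] using (commutativeRing)
  private module R = CommutativeRing commutativeRing

  Color : Set
  Color = Fin c

  private
    module Colors = Multisets (≡.setoid Color) (λ _ → 1) (λ _ → ≡.refl) (λ _ → s≤s z≤n)
    module Parts  = Multisets (partSetoid c) List⁺.length ↭-length (λ _ → s≤s z≤n)

  colorings : ℕ → List (List Color)
  colorings = Colors.multisets (allFin c)

  total≡length : ∀ xs → Colors.total xs ≡ length xs
  total≡length []       = ≡.refl
  total≡length (x ∷ xs) = ≡.cong suc (total≡length xs)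

  colorings-length : ∀ k → All (λ xs → length xs ≡ k) (colorings k)
  colorings-length k = All.map (λ {xs} eq → ≡.trans (≡.sym (total≡length xs)) eq) (Colors.multisets-total (allFin c) k)

  r : ℤ
  r = ℤ.- + c

  b : ℕ → ℤ
  b k = binomial (+ k ℤ.- r ℤ.- + 1) k

  -- Each colour has weight 1, so the Euler denominator is the c-th power of 1 - X. The counting
  -- series is thus its power with exponent - c, whose coefficients are given by `binomial-β`.
  length-colorings : ∀ k → + length (colorings k) ≡ b k
  length-colorings k = fromℤ-injective (≡.trans
    (*≈1-unique {d = (1# - X) ^ c} colors (^-*-^ℤ-neg (1-y-unital {X} ≡.refl) c) k) (binomial-β r k))
    where
    series : FPS
    series = countSeries (≡.setoid Color) (λ _ → 1) (λ _ → ≡.refl) (λ _ → s≤s z≤n) (allFin c)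

    colors : (1# - X) ^ c * series ≈ 1#
    colors = R.trans (R.*-congʳ {series} (R.sym denominator≈)) (denominator-countSeries (≡.setoid Color) (λ _ → 1) (λ _ → ≡.refl) (λ _ → s≤s z≤n) (allFin c))
      where
      denominator≈ : denominator (λ _ → 1) (allFin c) ≈ (1# - X) ^ c
      denominator≈ = R.trans (denominator-constant (λ _ → 1) 1 (All.universal (λ _ → ≡.refl) (allFin c)))
        (R.trans (R.reflexive (≡.cong ((1# - X ^ 1) ^_) (List.length-tabulate {n = c} (λ i → i))))
          (^-congˡ c (R.+-congˡ {1#} (R.-‿cong (R.*-identityʳ X)))))
        where open import Algebra.Properties.Semiring.Exp R.semiring using (^-congˡ)

  partsOfSize : ℕ → List (List⁺ Color)
  partsOfSize k = nonEmpty (colorings k)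

  -- A part of a partition of n has size at most n, so this finite list suffices for that n.
  parts : ℕ → List (List⁺ Color)
  parts zero    = []
  parts (suc n) = parts n ++ partsOfSize (suc n)

  partsOfSize-length : ∀ k → All (λ p → List⁺.length p ≡ k) (partsOfSize k)
  partsOfSize-length k = nonEmpty-All (colorings-length k)

  length-partsOfSize : ∀ k → length (partsOfSize (suc k)) ≡ length (colorings (suc k))
  length-partsOfSize k = length-nonEmpty (All.map (λ eq → ℕ.≤-trans (s≤s z≤n) (ℕ.≤-reflexive (≡.sym eq))) (colorings-length (suc k)))

  parts-length : ∀ n → All (λ p → List⁺.length p ℕ.≤ n) (parts n)
  parts-length zero    = []
  parts-length (suc n) = All.++⁺ (All.map ℕ.m≤n⇒m≤1+n (parts-length n)) (All.map ℕ.≤-reflexive (partsOfSize-length (suc n)))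

  parts-distinct : ∀ n → AllPairs (λ p q → ¬ (List⁺.toList p ↭ List⁺.toList q)) (parts n)
  parts-distinct zero    = []
  parts-distinct (suc n) = AllPairs.++⁺ (parts-distinct n)
    (AllPairs.map (λ ne p → ne (↭⇒↭ₛ p)) (nonEmpty-AllPairs (Colors.multisets-distinct (suc n) (Unique.allFin⁺ c))))
    (All.map (λ {p} p≤n → All.map (λ {q} q≡n p↭q → ℕ.1+n≰n (ℕ.≤-trans (ℕ.≤-reflexive (≡.sym (≡.trans (↭-length p↭q) q≡n))) p≤n))
      (partsOfSize-length (suc n))) (parts-length n))

  partsOfSize-complete : ∀ p → Any (λ q → List⁺.toList p ↭ List⁺.toList q) (partsOfSize (List⁺.length p))
  partsOfSize-complete (x ∷ xs) = nonEmpty-Any (λ p → contradiction (↭-length p) λ ())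
    (Any.map ↭ₛ⇒↭ (Colors.multisets-complete (allFin c) (x ∷ xs) (suc (length xs)) (All.universal ∈ₚ.∈-allFin (x ∷ xs)) (total≡length (x ∷ xs))))

  parts-complete : ∀ n p → List⁺.length p ℕ.≤ n → Any (λ q → List⁺.toList p ↭ List⁺.toList q) (parts n)
  parts-complete (suc n) p p≤ with List⁺.length p ℕ.≤? n
  ... | yes p≤n = Any.++⁺ˡ (parts-complete n p p≤n)
  ... | no  p≰n = Any.++⁺ʳ (parts n) (≡.subst (λ k → Any (λ q → List⁺.toList p ↭ List⁺.toList q) (partsOfSize k))
                    (ℕ.≤-antisym p≤ (ℕ.≰⇒> p≰n)) (partsOfSize-complete p))

  partitions : ℕ → List (List (List⁺ Color))
  partitions n = Parts.multisets (parts n) n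

  count : ℕ → ℕ
  count n = length (partitions n)

  part≤size : ∀ (π : List (List⁺ Color)) → All (λ p → List⁺.length p ℕ.≤ size π) π
  part≤size []      = []
  part≤size (p ∷ π) = ℕ.m≤m+n _ _ ∷ All.map (λ q≤ → ℕ.≤-trans q≤ (ℕ.m≤n+m _ (List⁺.length p))) (part≤size π)

  count-correct : CountsColoredPartitions c count
  count-correct n = enumerate {λ π → size π ≡ n} (partitions n) (Parts.multisets-total (parts n) n)
    (Parts.multisets-distinct n (parts-distinct n))
    (λ { π ≡.refl → Parts.multisets-complete (parts n) π n (All.map (λ {p} p≤n → parts-complete n p p≤n) (part≤size π)) ≡.refl })
    where open Enumeration (PermutationSetoid.↭-setoid (partSetoid c))

  denominator-parts : ∀ n → denominator List⁺.length (parts n) ≈ product {n} (λ i → (1# - X ^ suc (toℕ i)) ^ length (colorings (suc (toℕ i))))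
  denominator-parts zero    = R.refl {1#}
  denominator-parts (suc n) = R.trans (denominator-++ List⁺.length (parts n) (partsOfSize (suc n)))
    (R.trans (R.*-cong {denominator List⁺.length (parts n)} (denominator-parts n) (R.trans
      (denominator-constant List⁺.length (suc n) (partsOfSize-length (suc n)))
      (R.reflexive (≡.cong ((1# - X ^ suc n) ^_) (length-partsOfSize n)))))
    (R.sym (product-snoc n (λ i → (1# - X ^ suc i) ^ length (colorings (suc i))))))

  -- For fixed `n` both series are inverse to the product over the parts of size at most `n`, hence
  -- equal. Both change with `n` and are read only at index `n`.
  count-series : ∀ n → fromℤ (+ count n) ≡ product {n} (λ i → (1# - X ^ suc (toℕ i)) ^ℤ (ℤ.- b (suc (toℕ i)))) n
  count-series n = *≈1-unique {d = denominator List⁺.length (parts n)}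
    (denominator-countSeries (partSetoid c) List⁺.length ↭-length (λ _ → s≤s z≤n) (parts n))
    (R.trans (R.*-congʳ {product {n} g} (denominator-parts n)) (product-inverse {n} f g f*g)) n
    where
    f g : Fin n → FPS
    f i = (1# - X ^ suc (toℕ i)) ^ length (colorings (suc (toℕ i)))
    g i = (1# - X ^ suc (toℕ i)) ^ℤ (ℤ.- b (suc (toℕ i)))

    f*g : ∀ i → f i * g i ≈ 1#
    f*g i = R.trans (R.*-congˡ {f i} (R.reflexive (≡.trans (ResidueOfΦ.^ℤ≡^^ (1# - X ^ suc (toℕ i)) (ℤ.- b (suc (toℕ i))))
        (≡.cong (λ z → (1# - X ^ suc (toℕ i)) ^^ (ℤ.- z)) (≡.sym (length-colorings (suc (toℕ i))))))))
      (^-*-^ℤ-neg (1-y-unital {X ^ suc (toℕ i)} (coeff-x^-0 (toℕ i))) (length (colorings (suc (toℕ i)))))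

  count≈P : - (- ResidueOfΦ.P r) ≈ generatingFunction count
  count≈P n = ≡.trans (-‿involutive (Φ r n n)) (≡.trans (ResidueOfΦ.Φ≡partialProduct r n n n ℕ.≤-refl ℕ.≤-refl) (≡.sym (count-series n)))
    where open import Algebra.Properties.Ring (CommutativeRing.ring ℚ.+-*-commutativeRing) using (-‿involutive)

corollary1p3 : ((r : ℤ) →
    ∃ λ P →
    IsInfiniteProduct (λ k → (1# - X ^ k) ^ℤ (ℤ.- binomial (+ k ℤ.- r ℤ.- + 1) k)) P
    × HasResidue₁ (Φ r) (- P))
    ×
    ((c : ℕ) → .{{_ : NonZero c}} →
    ∃ λ (p : ℕ → ℕ) → ∃ λ ρ →
    CountsColoredPartitions c p
    × p 0 ≡ 1
    × HasResidue₁ (Φ (ℤ.- + c)) ρ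
    × - ρ ≈ generatingFunction p)
corollary1p3 =
  (λ r → ResidueOfΦ.P r , ResidueOfΦ.P-isInfiniteProduct r , ResidueOfΦ.Φ-hasResidue r) ,
  -- The value at 0 is 1 by computation: `parts 0` is empty, which leaves the empty partition alone.
  (λ c → ColoredPartitions.count c , - ResidueOfΦ.P (ℤ.- + c) , ColoredPartitions.count-correct c , ≡.refl ,
         ResidueOfΦ.Φ-hasResidue (ℤ.- + c) , ColoredPartitions.count≈P c)
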